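{- Let $G$ be a (finite) maximal triangle-free graph which contains the Mycielski–Grötzsch graph $\Upsilon$ as a subgraph and satisfies property $\mathscr{D}_4$. Then $G$ is a blow-up of some Vega graph $\Upsilon_i^{\mu\nu}$ ($i\ge2$, $\mu,\nu\in\{0,1\}$).
   Context: A graph is maximal triangle-free if it contains no triangle but adding any new edge creates a triangle. A blow-up of $H$ is any graph obtained by replacing each vertex of $H$ by a non-empty independent set and each edge of $H$ by the complete bipartite graph between the corresponding sets, with no further edges. Property $\mathscr{D}_k$: for every $m\in\{1,\dots,k\}$ and every sequence $x_1,\dots,x_{3m}$ of (not necessarily distinct) vertices there is a vertex $y$ with $|\{i\in[3m]: x_iy\in E(G)\}|\ge m+1$. Mycielski–Grötzsch graph $\Upsilon$: vertices $a_j,b_j$ ($j\in\mathbb Z/5\mathbb Z$) and $c$; edges all pairs $a_jc$, $a_jb_{j\pm2}$, $b_jb_{j+2}$. Andrásfai graph $\Gamma_i$: vertex set $\mathbb Z/(3i-1)\mathbb Z$, $jm$ an edge iff $j-m\in\{i,\dots,2i-1\}$ mod $3i-1$. Vega graphs: for $i\ge2$, $\Upsilon_i^{00}$ has vertex set $\mathbb Z/(3i-1)\mathbb Z\cup\{a,b,c,u,v,w,x,y\}$; edges: those of $\Gamma_i$; the hexagon $av,vc,cu,ub,bw,wa$; all edges from $a,u$ to $\{0,\dots,i-1\}$; from $b,v$ to $\{i,\dots,2i-1\}$; from $c,w$ to $\{2i,\dots,3i-2\}$; and $xa,xb,xc,yu,yv,yw,xy$. Further $\Upsilon_i^{10}=\Upsilon_i^{00}-y$,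 $\Upsilon_i^{01}=\Upsilon_i^{00}-(2i-1)$, $\Upsilon_i^{11}=\Upsilon_i^{00}-\{y,2i-1\}$. -}

module Defs where

open import Data.Fin.Base using (Fin; zero; suc; toℕ)
open import Data.Integer.Base as ℤ using (ℤ; +_; ∣_∣)
import Data.Integer.Divisibility as ℤᵈ
import Data.Integer.Properties as ℤᵖ
open import Data.Nat.Base using (ℕ; zero; suc; _+_; _*_; _∸_; _≤_; _<_; s≤s; z≤n; >-nonZero)
open import Data.Nat.Divisibility using (_∣_; ∣⇒≤)
open import Data.Nat.Properties using (≤-trans; ≤-<-trans; <⇒≱; m≤n+m)
open import Data.Product.Base using (_×_; ∃; ∃-syntax; _,_)
open import Data.Refinement.Base using (Refinement-syntax; value)
open import Data.Sum.Base using (_⊎_; inj₁; inj₂)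
open import Data.Vec.Base using (Vec; count)
open import Function.Bundles using (_⇔_)
open import Function.Definitions using (Injective; StrictlySurjective)
open import Relation.Binary.Construct.Closure.Symmetric using (SymClosure; fwd; bwd; symmetric)
open import Relation.Binary.Definitions using (Decidable)
open import Relation.Binary.PropositionalEquality using (_≡_; _≢_; refl; sym; trans; cong; subst)
open import Relation.Nullary.Negation using (¬_)

record Graph (V : Set) : Set₁ where
  field
    Adj        : V → V → Set
    adj-sym    : ∀ {x y} → Adj x y → Adj y x
    adj-irrefl : ∀ {x} → ¬ Adj x x

open Graph public

fromEdges : {V : Set} (E : V → V → Set) → (∀ {x} → ¬ E x x) → Graph V
fromEdges E irr = record
  { Adj        = SymClosure E
  ; adj-sym    = symmetric E
  ; adj-irrefl = λ { (fwd e) → irr e ; (bwd e) → irr e }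
  }

HasTriangle : {V : Set} → Graph V → Set
HasTriangle G = ∃[ x ] ∃[ y ] ∃[ z ] (Adj G x y × Adj G y z × Adj G z x)

addEdge : {V : Set} → Graph V → (x y : V) → x ≢ y → Graph V
addEdge G x y x≢y = record
  { Adj        = λ p q → Adj G p q ⊎ (p ≡ x × q ≡ y) ⊎ (p ≡ y × q ≡ x)
  ; adj-sym    = λ { (inj₁ e)               → inj₁ (adj-sym G e)
                   ; (inj₂ (inj₁ (p , q))) → inj₂ (inj₂ (q , p))
                   ; (inj₂ (inj₂ (p , q))) → inj₂ (inj₁ (q , p)) }
  ; adj-irrefl = λ { (inj₁ e)               → adj-irrefl G e
                   ; (inj₂ (inj₁ (p , q))) → x≢y (trans (sym p) q)
                   ; (inj₂ (inj₂ (p , q))) → x≢y (trans (sym q) p) }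
  }

MaximalTriangleFree : {V : Set} → Graph V → Set
MaximalTriangleFree G =
  ¬ HasTriangle G ×
  (∀ x y (x≢y : x ≢ y) → ¬ Adj G x y → HasTriangle (addEdge G x y x≢y))

-- Not necessarily induced.
_ContainsSubgraph_ : {V W : Set} → Graph V → Graph W → Set
_ContainsSubgraph_ {V} {W} G H =
  ∃ λ (f : W → V) → Injective _≡_ _≡_ f × (∀ {p q} → Adj H p q → Adj G (f p) (f q))

-- The fibre of f over p is the non-empty set replacing the vertex p; it is
-- independent since Adj H is irreflexive.
_IsBlowUpOf_ : {V W : Set} → Graph V → Graph W → Set
_IsBlowUpOf_ {V} {W} G H =
  ∃ λ (f : V → W) → StrictlySurjective _≡_ f × (∀ x y → Adj G x y ⇔ Adj H (f x) (f y))

-- Decidability of adjacency is only used to count the i with x_i y ∈ E(G).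
Property𝒟 : ℕ → {V : Set} (G : Graph V) → Decidable (Adj G) → Set
Property𝒟 k {V} G _~?_ =
  ∀ m → 1 ≤ m → m ≤ k → (xs : Vec V (3 * m)) →
  ∃[ y ] m + 1 ≤ count (λ x → x ~? y) xs

-- Membership proofs are irrelevant, so vertices with equal values are equal.
_minus_ : {V : Set} → Graph V → (S : V → Set) → Graph [ v ∈ V ∣ ¬ S v ]
G minus S = record
  { Adj        = λ p q → Adj G (value p) (value q)
  ; adj-sym    = adj-sym G
  ; adj-irrefl = adj-irrefl G
  }

-- ℤ/nℤ is represented by Fin n; residues are compared through their
-- representatives in ℤ.
infix 4 _≡_mod_
_≡_mod_ : ℤ → ℤ → ℕ → Set
x ≡ y mod n = + n ℤᵈ.∣ (x ℤ.- y)

⟦_⟧ : ∀ {n} → Fin n → ℤ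
⟦ j ⟧ = + toℕ j

data ΥVertex : Set where
  a b : Fin 5 → ΥVertex
  c   : ΥVertex

data ΥEdge : ΥVertex → ΥVertex → Set where
  ac  : ∀ {j} → ΥEdge (a j) c
  ab⁺ : ∀ {j k} → ⟦ k ⟧ ≡ ⟦ j ⟧ ℤ.+ + 2 mod 5 → ΥEdge (a j) (b k)
  ab⁻ : ∀ {j k} → ⟦ k ⟧ ≡ ⟦ j ⟧ ℤ.- + 2 mod 5 → ΥEdge (a j) (b k)
  bb  : ∀ {j k} → ⟦ k ⟧ ≡ ⟦ j ⟧ ℤ.+ + 2 mod 5 → ΥEdge (b j) (b k)

-- Vertices of the Andrásfai graph Γᵢ are residues modulo 3i − 1; for i = 0 the
-- truncated subtraction gives the empty graph.
order : ℕ → ℕ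
order i = 3 * i ∸ 1

ΓEdge : ∀ i → Fin (order i) → Fin (order i) → Set
ΓEdge i j m = ∃[ d ] i ≤ d × d ≤ 2 * i ∸ 1 × ⟦ j ⟧ ℤ.- ⟦ m ⟧ ≡ + d mod order i

data VegaVertex (i : ℕ) : Set where
  res             : Fin (order i) → VegaVertex i
  a b c u v w x y : VegaVertex i

data VegaEdge (i : ℕ) : VegaVertex i → VegaVertex i → Set where
  Γ  : ∀ {j m} → ΓEdge i j m → VegaEdge i (res j) (res m)
  av : VegaEdge i a v
  vc : VegaEdge i v c
  cu : VegaEdge i c u
  ub : VegaEdge i u b
  bw : VegaEdge i b w
  wa : VegaEdge i w a
  a₀ : ∀ {j} → toℕ j < i → VegaEdge i a (res j)
  u₀ : ∀ {j} → toℕ j < i → VegaEdge i u (res j)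
  b₁ : ∀ {j} → i ≤ toℕ j → toℕ j < 2 * i → VegaEdge i b (res j)
  v₁ : ∀ {j} → i ≤ toℕ j → toℕ j < 2 * i → VegaEdge i v (res j)
  c₂ : ∀ {j} → 2 * i ≤ toℕ j → VegaEdge i c (res j)
  w₂ : ∀ {j} → 2 * i ≤ toℕ j → VegaEdge i w (res j)
  xa : VegaEdge i x a
  xb : VegaEdge i x b
  xc : VegaEdge i x c
  yu : VegaEdge i y u
  yv : VegaEdge i y v
  yw : VegaEdge i y w
  xy : VegaEdge i x y

ΥEdge-irrefl : ∀ {p} → ¬ ΥEdge p p
ΥEdge-irrefl (bb {j} d) = 5∤2 (subst (5 ∣_) (cong ∣_∣ eq) d)
  where
  eq : ⟦ j ⟧ ℤ.- (⟦ j ⟧ ℤ.+ + 2) ≡ ℤ.- + 2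
  eq = trans (cong (λ t → ⟦ j ⟧ ℤ.+ t) (ℤᵖ.neg-distrib-+ ⟦ j ⟧ (+ 2)))
      (trans (sym (ℤᵖ.+-assoc ⟦ j ⟧ (ℤ.- ⟦ j ⟧) (ℤ.- + 2)))
             (cong (λ t → t ℤ.+ ℤ.- + 2) (ℤᵖ.+-inverseʳ ⟦ j ⟧)))
  5∤2 : ¬ (5 ∣ 2)
  5∤2 5∣2 with ∣⇒≤ 5∣2
  ... | s≤s (s≤s ())

ΓEdge-irrefl : ∀ i {j} → ¬ ΓEdge i j j
ΓEdge-irrefl (suc i) {j} (d , i≤d , d≤ , n∣) =
  <⇒≱ (≤-<-trans d≤ bound)
      (∣⇒≤ {{>-nonZero (≤-trans (s≤s z≤n) i≤d)}} (subst (order (suc i) ∣_) eq n∣))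
  where
  bound : 2 * suc i ∸ 1 < order (suc i)
  bound = m≤n+m (suc (i + (suc i + 0))) i
  eq : ∣ (⟦ j ⟧ ℤ.- ⟦ j ⟧) ℤ.- + d ∣ ≡ d
  eq = trans (cong (λ t → ∣ t ℤ.- + d ∣) (ℤᵖ.+-inverseʳ ⟦ j ⟧))
      (trans (cong ∣_∣ (ℤᵖ.+-identityˡ (ℤ.- + d))) (ℤᵖ.∣-i∣≡∣i∣ (+ d)))

VegaEdge-irrefl : ∀ {i p} → ¬ VegaEdge i p p
VegaEdge-irrefl {i} (Γ {j} e) = ΓEdge-irrefl i {j} e

Υ : Graph ΥVertex
Υ = fromEdges ΥEdge ΥEdge-irrefl

Vega⁰⁰ : ∀ i → Graph (VegaVertex i)
Vega⁰⁰ i = fromEdges (VegaEdge i) VegaEdge-irrefl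

data Deleted (i : ℕ) : Fin 2 → Fin 2 → VegaVertex i → Set where
  del-y    : ∀ {ν} → Deleted i (suc zero) ν y
  del-2i-1 : ∀ {μ j} → toℕ j ≡ 2 * i ∸ 1 → Deleted i μ (suc zero) (res j)

Vega : ∀ i (μ ν : Fin 2) → Graph [ p ∈ VegaVertex i ∣ ¬ Deleted i μ ν p ]
Vega i μ ν = Vega⁰⁰ i minus Deleted i μ ν

{-# OPTIONS --safe #-}

-- Density leaves only 41 possibilities for the neighbourhood of a vertex in a given
-- copy of Υ, and severely restricts which of them occur together. Each of these finitely
-- many facts is refuted from its negation by a short tree of case distinctions, which a
-- verified checker replays. It follows that, up to a rotation of the copy of Υ, every
-- vertex looks like one of a, b, c, u, v, w, x, y or like a residue in one of the three
-- intervals.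
--
-- Orient the edges between residues from each interval to the cyclically next one. Six
-- vertices, two of each interval, such that any two intervals are joined by a perfect
-- matching violate density for m = 2; hence the bipartite graphs between the intervals
-- contain no induced 2K₂ and directed paths are bounded. The length of a longest path
-- ending in a vertex determines which residue the vertex replaces.

module Submission where

open import Data.Bool.Base using (Bool; true; false; if_then_else_; T; _∧_; _∨_; not)
open import Data.Bool.ListAction using (all; any)
open import Data.Bool.Properties using (¬-not) renaming (_≟_ to _≟ᵇ_)
open import Data.Empty using (⊥; ⊥-elim; ⊥-elim-irr)
open import Data.Fin using (#_)
open import Data.Fin.Base using (Fin; zero; suc; toℕ; fromℕ<)
open import Data.Fin.Properties using (any?; all?; toℕ<n; toℕ-fromℕ<; toℕ-injective; ¬∀⟶∃¬) renaming (_≟_ to _≟ᶠ_)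
open import Data.Fin.Subset using (Subset) renaming (∣_∣ to size; _∈_ to _∈ˢ_; _⊆_ to _⊆ˢ_)
open import Data.Fin.Subset.Properties using (p⊂q⇒∣p∣<∣q∣; ∣p∣≤n)
open import Data.Integer.Base as ℤ using (ℤ; ∣_∣; _⊖_) renaming (+_ to pos)
import Data.Integer.Properties as ℤᵖ
import Data.Irrelevant as Irrelevant
open import Data.List.Base using (List; []; _∷_; length; map; _++_; downFrom; filterᵇ; cartesianProductWith; [_]; upTo; replicate)
open import Data.List.Membership.Propositional using (_∈_)
open import Data.List.Properties using (length-++; length-replicate)
open import Data.List.Relation.Unary.All as All using (All; []; _∷_)
open import Data.List.Relation.Unary.All.Properties using (map⁺)
open import Data.List.Relation.Unary.Any as Any using (Any; here; there)
open import Data.List.Relation.Unary.Any.Properties using (cartesianProductWith⁺)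
open import Data.Maybe.Base using (Maybe; just; nothing; is-just)
open import Data.Maybe.Properties using (just-injective)
open import Data.Nat.Base using (ℕ; zero; suc; _+_; _*_; _∸_; _≤_; _<_; s≤s; z≤n; _≤ᵇ_; _≡ᵇ_; _<ᵇ_)
open import Data.Nat.DivMod using (_%_)
open import Data.Nat.Divisibility using (_∣_; divides)
open import Data.Nat.ListAction using (sum)
open import Data.Nat.Properties
open import Data.Nat.Tactic.RingSolver using (solve-∀)
open import Data.Product.Base using (_×_; ∃-syntax; _,_; proj₁; proj₂)
open import Data.Refinement.Base using (Refinement; _,_)
open import Data.Sum.Base using (_⊎_; inj₁; inj₂)
open import Data.Unit.Base using (⊤; tt)
open import Data.Vec.Base as Vec using (Vec; []; _∷_; count; fromList; tabulate; lookup)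
open import Data.Vec.Properties using (lookup∘tabulate; []=⇒lookup; lookup⇒[]=)
open import Defs using (Graph; Adj; adj-sym; adj-irrefl; ΓEdge; order; VegaVertex; VegaEdge; Vega; Deleted; _IsBlowUpOf_; addEdge; HasTriangle; MaximalTriangleFree; _ContainsSubgraph_; Property𝒟; Υ; ΥVertex; ΥEdge)
open import Function.Bundles using (mk⇔)
open import Relation.Binary.Construct.Closure.Symmetric using (SymClosure; fwd; bwd; symmetric; gmap)
open import Relation.Binary.Definitions using (Decidable; DecidableEquality)
open import Relation.Binary.PropositionalEquality using (_≡_; _≢_; refl; sym; trans; cong; cong₂; subst; subst₂; module ≡-Reasoning)
open import Relation.Nullary using (¬_; Dec; yes; no; does)
open import Relation.Nullary.Decidable using (_×-dec_; _⊎-dec_; ¬?; map′; dec-true)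
open import Relation.Nullary.Negation using (contradiction)

-- Local information can only name the class of a vertex, since the number of residues is unbounded;
-- the order of the residues has to come from G itself. Its source is maximality: non-adjacent
-- vertices have a common neighbour, so a missing edge from one interval to the next is a directed
-- path of length two in return. Adjacency of residues thereby becomes comparison of levels. Level
-- `ℓ` corresponds to the residue `i ℓ` modulo `3 i - 1`: as `3 i ≡ 1`, level `3 s + k` becomes
-- `s + k i`, which lies in interval `k`.
--
-- Υ is itself the Vega graph with `i = 2` and both deletions, and the classes of its vertices are
-- read off from this isomorphism. It singles out the vertex a_j that becomes x, whence five
-- rotations to try. That one of them suits all vertices is not a statement about pairs: three
-- vertices not excluded pairwise can spoil all five, so one triple has to be refuted as well.
--
-- Density is used with weights: if the total is `3 m`, some neighbourhood weighs more than `m`.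
-- Neighbourhoods are independent, so this leaves a finite case distinction over heavy independent
-- sets.

-- Classes of vertices and the adjacencies between them

data ℤ₃ : Set where
  0₃ 1₃ 2₃ : ℤ₃

next : ℤ₃ → ℤ₃
next 0₃ = 1₃
next 1₃ = 2₃
next 2₃ = 0₃

next³ : ∀ k → next (next (next k)) ≡ k
next³ 0₃ = refl
next³ 1₃ = refl
next³ 2₃ = refl

next≢ : ∀ {k} → next k ≢ k
next≢ {0₃} ()
next≢ {1₃} ()
next≢ {2₃} ()

next-injective : ∀ {k l} → next k ≡ next l → k ≡ l
next-injective {k} {l} e = trans (sym (next³ k)) (trans (cong (λ t → next (next t)) e) (next³ l))

compare₃ : ∀ k l → k ≡ l ⊎ l ≡ next k ⊎ k ≡ next l
compare₃ 0₃ 0₃ = inj₁ refl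
compare₃ 0₃ 1₃ = inj₂ (inj₁ refl)
compare₃ 0₃ 2₃ = inj₂ (inj₂ refl)
compare₃ 1₃ 0₃ = inj₂ (inj₂ refl)
compare₃ 1₃ 1₃ = inj₁ refl
compare₃ 1₃ 2₃ = inj₂ (inj₁ refl)
compare₃ 2₃ 0₃ = inj₂ (inj₁ refl)
compare₃ 2₃ 1₃ = inj₂ (inj₂ refl)
compare₃ 2₃ 2₃ = inj₁ refl

lab : ℕ → ℤ₃
lab zero    = 0₃
lab (suc m) = next (lab m)

-- hub 0₃, 1₃, 2₃ are a, b, c; anti 0₃, 1₃, 2₃ are u, v, w; R 0₃, 1₃, 2₃ are the
-- residues in [0,i), [i,2i), [2i,3i-1).
data Class : Set where
  hub anti R : ℤ₃ → Class
  X Y        : Class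

data Link : Class → Class → Set where
  hub-anti : ∀ {k l} → k ≢ l → Link (hub k) (anti l)
  hub-R    : ∀ {k} → Link (hub k) (R k)
  anti-R   : ∀ {k} → Link (anti k) (R k)
  X-hub    : ∀ {k} → Link X (hub k)
  Y-anti   : ∀ {k} → Link Y (anti k)
  X-Y      : Link X Y

data Step : Class → Class → Set where
  step : ∀ {k} → Step (R k) (R (next k))

data Compat (C D : Class) : Set where
  link : Link C D → Compat C D
  step : Step C D → Compat C D

infix 4 _≟₃_
_≟₃_ : DecidableEquality ℤ₃
k ≟₃ l with compare₃ k l
... | inj₁ e           = yes e
... | inj₂ (inj₁ refl) = no λ e → next≢ (sym e)
... | inj₂ (inj₂ refl) = no next≢

step? : Decidable Step
step? (hub _)  _        = no λ ()
step? (anti _) _        = no λ ()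
step? X        _        = no λ ()
step? Y        _        = no λ ()
step? (R _)    (hub _)  = no λ ()
step? (R _)    (anti _) = no λ ()
step? (R _)    X        = no λ ()
step? (R _)    Y        = no λ ()
step? (R k)    (R l)    = map′ (λ { refl → step }) (λ { step → refl }) (next k ≟₃ l)

link? : Decidable Link
link? (hub _)  (hub _)  = no λ ()
link? (hub k)  (anti l) = map′ hub-anti (λ { (hub-anti k≢l) → k≢l }) (¬? (k ≟₃ l))
link? (hub k)  (R l)    = map′ (λ { refl → hub-R }) (λ { hub-R → refl }) (k ≟₃ l)
link? (hub _)  X        = no λ ()
link? (hub _)  Y        = no λ ()
link? (anti _) (hub _)  = no λ ()
link? (anti _) (anti _) = no λ ()
link? (anti k) (R l)    = map′ (λ { refl → anti-R }) (λ { anti-R → refl }) (k ≟₃ l)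
link? (anti _) X        = no λ ()
link? (anti _) Y        = no λ ()
link? (R _)    _        = no λ ()
link? X        (hub _)  = yes X-hub
link? X        (anti _) = no λ ()
link? X        (R _)    = no λ ()
link? X        X        = no λ ()
link? X        Y        = yes X-Y
link? Y        (hub _)  = no λ ()
link? Y        (anti _) = yes Y-anti
link? Y        (R _)    = no λ ()
link? Y        X        = no λ ()
link? Y        Y        = no λ ()

compat? : Decidable (SymClosure Compat)
compat? C D = map′ (λ { (inj₁ (inj₁ p)) → fwd (link p) ; (inj₁ (inj₂ p)) → fwd (step p)
                      ; (inj₂ (inj₁ p)) → bwd (link p) ; (inj₂ (inj₂ p)) → bwd (step p) })
                   (λ { (fwd (link p)) → inj₁ (inj₁ p) ; (fwd (step p)) → inj₁ (inj₂ p)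
                      ; (bwd (link p)) → inj₂ (inj₁ p) ; (bwd (step p)) → inj₂ (inj₂ p) })
                   ((link? C D ⊎-dec step? C D) ⊎-dec (link? D C ⊎-dec step? D C))

R-injective : ∀ {k l} → R k ≡ R l → k ≡ l
R-injective refl = refl

labels : ∀ {C D} → Step C D → ∃[ k ] (C ≡ R k × D ≡ R (next k))
labels (step {k}) = k , refl , refl

steps : ∀ {C D k} → C ≡ R k → D ≡ R (next k) → Step C D
steps refl refl = step

-- Linked classes are completely joined, whereas a step only permits an edge: which edges between
-- residues occur is decided later, by levels. There is no clause for `Y`, because its absence leads
-- to the Vega graphs with `y` deleted. Residues are supplied separately, by a directed path of
-- length three.
record Structured {n} (G : Graph (Fin n)) (cls : Fin n → Class) : Set where
  field
    adj⇒    : ∀ {x y} → Adj G x y → SymClosure Compat (cls x) (cls y)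
    link⇒   : ∀ {x y} → Link (cls x) (cls y) → Adj G x y
    hubs    : ∀ k → ∃[ x ] cls x ≡ hub k
    antis   : ∀ k → ∃[ x ] cls x ≡ anti k
    anX     : ∃[ x ] cls x ≡ X

-- Levels of residues

module Order {n} (G : Graph (Fin n)) (_~?_ : Decidable (Adj G))
  (triangle-free : ∀ {x y z} → Adj G x y → Adj G y z → Adj G z x → ⊥)
  (common : ∀ {x y} → ¬ Adj G x y → ∃[ z ] (Adj G x z × Adj G z y))
  (𝒟₂ : (xs : Vec (Fin n) 6) → ∃[ y ] 3 ≤ count (λ x → x ~? y) xs)
  (cls : Fin n → Class) (S : Structured G cls) where

  open Structured S

  private
    V = Fin n
    _~_ = Adj G

  infix 4 _⟶_
  _⟶_ : V → V → Set
  x ⟶ y = x ~ y × Step (cls x) (cls y)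

  _⟶?_ : Decidable _⟶_
  x ⟶? y = (x ~? y) ×-dec step? (cls x) (cls y)

  ~sym : ∀ {x y} → x ~ y → y ~ x
  ~sym = adj-sym G

  ind : V → V → ℕ
  ind t x = if does (x ~? t) then 1 else 0

  ind-non : ∀ {t x} → ¬ x ~ t → ind t x ≤ 0
  ind-non {t} {x} ¬e with x ~? t
  ... | yes e = contradiction e ¬e
  ... | no _  = z≤n

  ind≤1 : ∀ {t x} → ind t x ≤ 1
  ind≤1 {t} {x} with x ~? t
  ... | yes _ = s≤s z≤n
  ... | no _  = z≤n

  ind-edge : ∀ {t x y} → x ~ y → ind t x + ind t y ≤ 1
  ind-edge {t} {x} {y} e with x ~? t | y ~? t
  ... | yes p | yes q = ⊥-elim (triangle-free e q (~sym p))
  ... | yes _ | no _  = s≤s z≤n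
  ... | no _  | yes _ = s≤s z≤n
  ... | no _  | no _  = z≤n

  sum₆ : ∀ t x₁ x₂ x₃ x₄ x₅ x₆ →
         count (λ z → z ~? t) (x₁ ∷ x₂ ∷ x₃ ∷ x₄ ∷ x₅ ∷ x₆ ∷ []) ≡
         (ind t x₁ + ind t x₂) + ((ind t x₃ + ind t x₄) + (ind t x₅ + ind t x₆))
  sum₆ t x₁ x₂ x₃ x₄ x₅ x₆ with x₁ ~? t | x₂ ~? t | x₃ ~? t | x₄ ~? t | x₅ ~? t | x₆ ~? t
  ... | p₁ | p₂ | p₃ | p₄ | p₅ | p₆ = go (does p₁) (does p₂) (does p₃) (does p₄) (does p₅) (does p₆)
    where
    inc : Bool → ℕ → ℕ
    inc b m = (if b then suc else (λ k → k)) m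
    one : Bool → ℕ
    one b = if b then 1 else 0
    inc≡ : ∀ b m → inc b m ≡ one b + m
    inc≡ true m  = refl
    inc≡ false m = refl
    go : ∀ e₁ e₂ e₃ e₄ e₅ e₆ → inc e₁ (inc e₂ (inc e₃ (inc e₄ (inc e₅ (inc e₆ 0))))) ≡
         (one e₁ + one e₂) + ((one e₃ + one e₄) + (one e₅ + one e₆))
    go e₁ e₂ e₃ e₄ e₅ e₆
      rewrite inc≡ e₁ (inc e₂ (inc e₃ (inc e₄ (inc e₅ (inc e₆ 0)))))
            | inc≡ e₂ (inc e₃ (inc e₄ (inc e₅ (inc e₆ 0))))
            | inc≡ e₃ (inc e₄ (inc e₅ (inc e₆ 0)))
            | inc≡ e₄ (inc e₅ (inc e₆ 0))
            | inc≡ e₅ (inc e₆ 0) | inc≡ e₆ 0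
            | +-identityʳ (one e₆)
            | +-assoc (one e₁) (one e₂) ((one e₃ + one e₄) + (one e₅ + one e₆))
            | +-assoc (one e₃) (one e₄) (one e₅ + one e₆) = refl

  classCases : ∀ {t x} → ¬ SymClosure Compat (cls x) (cls t) → ind t x ≤ 0
  classCases ¬c = ind-non (λ e → ¬c (adj⇒ e))

  same-R : ∀ {k x y} → cls x ≡ R k → cls y ≡ R k → ¬ x ~ y
  same-R {k} cx cy e with adj⇒ e
  ... | p rewrite cx | cy = go k refl p
    where
    go : ∀ l {m} → l ≡ m → ¬ SymClosure Compat (R l) (R m)
    go 0₃ refl (fwd (step ()))
    go 0₃ refl (bwd (step ()))
    go 1₃ refl (fwd (step ()))
    go 1₃ refl (bwd (step ()))
    go 2₃ refl (fwd (step ()))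
    go 2₃ refl (bwd (step ()))

  crossed : ∀ {m₁ m₂ m₃ m₄} → m₁ + m₄ ≤ 1 → m₂ + m₃ ≤ 1 → (m₁ + m₂) + (m₃ + m₄) ≤ 2
  crossed {m₁} {m₂} {m₃} {m₄} p q = ≤-trans (≤-reflexive lemma) (+-mono-≤ p q)
    where
    lemma : (m₁ + m₂) + (m₃ + m₄) ≡ (m₁ + m₄) + (m₂ + m₃)
    lemma = trans (+-assoc m₁ m₂ (m₃ + m₄))
           (trans (cong (m₁ +_) (trans (sym (+-assoc m₂ m₃ m₄)) (+-comm (m₂ + m₃) m₄)))
                  (sym (+-assoc m₁ m₄ (m₂ + m₃))))

  matched : ∀ {m₁ m₂ m₃ m₄} → m₁ + m₃ ≤ 1 → m₂ + m₄ ≤ 1 → (m₁ + m₂) + (m₃ + m₄) ≤ 2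
  matched {m₁} {m₂} {m₃} {m₄} p q =
    subst (_≤ 2) (cong ((m₁ + m₂) +_) (+-comm m₄ m₃)) (crossed {m₁} {m₂} {m₄} {m₃} p q)

  hubR : ∀ {m l} → SymClosure Compat (R m) (hub l) → m ≡ l
  hubR (fwd (link ()))
  hubR (fwd (step ()))
  hubR (bwd (link hub-R)) = refl
  hubR (bwd (step ()))

  antiR : ∀ {m l} → SymClosure Compat (R m) (anti l) → m ≡ l
  antiR (fwd (link ()))
  antiR (fwd (step ()))
  antiR (bwd (link anti-R)) = refl
  antiR (bwd (step ()))

  RX : ∀ {m} → ¬ SymClosure Compat (R m) X
  RX (fwd (link ()))
  RX (fwd (step ()))
  RX (bwd (link ()))
  RX (bwd (step ()))

  RY : ∀ {m} → ¬ SymClosure Compat (R m) Y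
  RY (fwd (link ()))
  RY (fwd (step ()))
  RY (bwd (link ()))
  RY (bwd (step ()))

  -- The six vertices are pairwise matched between any two of the three residue
  -- classes, hence no vertex has three neighbours among them.
  no-hexagon : ∀ {k p₁ p₂ q₁ q₂ r₁ r₂} →
    cls p₁ ≡ R k → cls p₂ ≡ R k → cls q₁ ≡ R (next k) → cls q₂ ≡ R (next k) →
    cls r₁ ≡ R (next (next k)) → cls r₂ ≡ R (next (next k)) →
    p₁ ~ q₁ → p₂ ~ q₂ → q₂ ~ r₁ → q₁ ~ r₂ → r₁ ~ p₁ → r₂ ~ p₂ → ⊥
  no-hexagon {k} {p₁} {p₂} {q₁} {q₂} {r₁} {r₂} cp₁ cp₂ cq₁ cq₂ cr₁ cr₂ pq₁ pq₂ qr₂ qr₁ rp₁ rp₂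
    with 𝒟₂ (p₁ ∷ p₂ ∷ q₁ ∷ q₂ ∷ r₁ ∷ r₂ ∷ [])
  ... | t , 3≤ = <⇒≱ 3≤ (≤-trans (≤-reflexive (sum₆ t p₁ p₂ q₁ q₂ r₁ r₂)) bound)
    where
    P Q Rs : ℕ
    P = ind t p₁ + ind t p₂
    Q = ind t q₁ + ind t q₂
    Rs = ind t r₁ + ind t r₂
    P≤ : P ≤ 2
    P≤ = +-mono-≤ ind≤1 ind≤1
    Q≤ : Q ≤ 2
    Q≤ = +-mono-≤ ind≤1 ind≤1
    R≤ : Rs ≤ 2
    R≤ = +-mono-≤ ind≤1 ind≤1
    off : ∀ {l x y} → cls x ≡ R l → cls y ≡ R l → ¬ SymClosure Compat (R l) (cls t) → ind t x + ind t y ≤ 0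
    off cx cy ¬c = +-mono-≤ (classCases (subst (λ C → ¬ SymClosure Compat C (cls t)) (sym cx) ¬c))
                            (classCases (subst (λ C → ¬ SymClosure Compat C (cls t)) (sym cy) ¬c))
    -- A vertex outside the residues is compatible with at most one of the three residue classes,
    -- and this class contains two of the six vertices.
    only : ∀ {l} → (∀ m → m ≢ l → ¬ SymClosure Compat (R m) (cls t)) → P + (Q + Rs) ≤ 2
    only {l} ¬c with compare₃ k l
    ... | inj₁ refl =
        +-mono-≤ P≤ (+-mono-≤ (off cq₁ cq₂ (¬c _ next≢)) (off cr₁ cr₂ (¬c _ λ e → next≢ (trans (sym (cong next e)) (next³ k)))))
    ... | inj₂ (inj₁ refl) =
        +-mono-≤ (off cp₁ cp₂ (¬c _ λ e → next≢ (sym e))) (+-mono-≤ Q≤ (off cr₁ cr₂ (¬c _ next≢)))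
    ... | inj₂ (inj₂ refl) =
        +-mono-≤ (off cp₁ cp₂ (¬c _ next≢)) (+-mono-≤ (off cq₁ cq₂ (¬c _ λ e → next≢ (trans (sym (cong next e)) (next³ l)))) R≤)
    -- A residue has no neighbour in its own class, and of each of the two matching edges between
    -- the other classes it sees at most one end.
    inside : ∀ {l} → cls t ≡ R l → P + (Q + Rs) ≤ 2
    inside {l} ct with compare₃ k l
    ... | inj₁ refl = +-mono-≤ (+-mono-≤ (ind-non (same-R cp₁ ct)) (ind-non (same-R cp₂ ct)))
                               (crossed {ind t q₁} (ind-edge qr₁) (ind-edge qr₂))
    ... | inj₂ (inj₁ refl) =
        ≤-trans (+-monoʳ-≤ P (+-monoˡ-≤ Rs (+-mono-≤ (ind-non (same-R cq₁ ct)) (ind-non (same-R cq₂ ct)))))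
                               (matched {ind t p₁} (ind-edge (~sym rp₁)) (ind-edge (~sym rp₂)))
    ... | inj₂ (inj₂ refl) =
        ≤-trans (+-monoʳ-≤ P (+-monoʳ-≤ Q (+-mono-≤ (ind-non (same-R cr₁ ct′)) (ind-non (same-R cr₂ ct′)))))
                               (≤-trans (≤-reflexive (cong (P +_) (+-identityʳ Q))) (matched {ind t p₁} (ind-edge pq₁) (ind-edge pq₂)))
      where
      ct′ : cls t ≡ R (next (next k))
      ct′ = trans ct (cong R (sym (next³ l)))
    bound : P + (Q + Rs) ≤ 2
    bound with cls t in ct
    ... | R l    = inside ct
    ... | hub l  = only {l} λ { m m≢ p → m≢ (hubR (subst (SymClosure Compat (R m)) ct p)) }
    ... | anti l = only {l} λ { m m≢ p → m≢ (antiR (subst (SymClosure Compat (R m)) ct p)) }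
    -- `X` and `Y` are compatible with no residue class, so any label serves.
    ... | X      = only {0₃} λ { m m≢ p → RX (subst (SymClosure Compat (R m)) ct p) }
    ... | Y      = only {0₃} λ { m m≢ p → RY (subst (SymClosure Compat (R m)) ct p) }

  -- Hubs and antihubs are compatible with a single residue class, `X` and `Y` with none, and two
  -- residues of one class are not adjacent; this leaves the third residue class.
  third : ∀ {x y z k} → cls x ≡ R k → cls y ≡ R (next k) → x ~ z → z ~ y → cls z ≡ R (next (next k))
  third {x} {y} {z} {k} cx cy xz zy = go (cls z) refl
    where
    cxz : ∀ {C} → cls z ≡ C → SymClosure Compat (R k) C
    cxz e = subst₂ (SymClosure Compat) cx e (adj⇒ xz)
    cyz : ∀ {C} → cls z ≡ C → SymClosure Compat (R (next k)) C
    cyz e = subst₂ (SymClosure Compat) cy e (adj⇒ (~sym zy))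
    go : ∀ C → cls z ≡ C → cls z ≡ R (next (next k))
    go (hub l)  e = contradiction (trans (hubR (cyz e)) (sym (hubR (cxz e)))) next≢
    go (anti l) e = contradiction (trans (antiR (cyz e)) (sym (antiR (cxz e)))) next≢
    go X        e = ⊥-elim (RX (cxz e))
    go Y        e = ⊥-elim (RY (cxz e))
    go (R l)    e with compare₃ k l
    ... | inj₁ refl               = contradiction xz (same-R cx e)
    ... | inj₂ (inj₁ refl)        = contradiction (~sym zy) (same-R cy e)
    ... | inj₂ (inj₂ refl)        = trans e (cong R (sym (next³ l)))

  -- The common neighbour given by maximality lies in the third class, hence directed from `y` to
  -- `x`. This turns a missing edge into positive information, on which all arguments about the
  -- order rest.
  between : ∀ {x y} → Step (cls x) (cls y) → ¬ x ~ y → ∃[ z ] (y ⟶ z × z ⟶ x)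
  between {x} {y} st ¬e with labels st | common ¬e
  ... | k , cx , cy | z , xz , zy =
    z , (~sym zy , steps cy cz) , (~sym xz , steps cz (trans cx (cong R (sym (next³ k)))))
    where
    cz : cls z ≡ R (next (next k))
    cz = third cx cy xz zy

  -- If both cross edges are missing, the two vertices that `between` provides for them complete
  -- `p₁`, `p₂`, `q₁`, `q₂` to the configuration of `no-hexagon`.
  no-2K₂ : ∀ {p₁ p₂ q₁ q₂} → p₁ ⟶ q₁ → p₂ ⟶ q₂ → Step (cls p₁) (cls q₂) → Step (cls p₂) (cls q₁) →
           ¬ p₁ ~ q₂ → p₂ ~ q₁
  no-2K₂ {p₁} {p₂} {q₁} {q₂} (e₁ , s₁) (e₂ , s₂) s₁₂ s₂₁ ¬e with p₂ ~? q₁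
  ... | yes e = e
  ... | no ¬e′ with labels s₁ | labels s₂ | between s₁₂ ¬e | between s₂₁ ¬e′
  ... | k , cp₁ , cq₁ | l , cp₂ , cq₂ | r₁ , (q₂r₁ , t₁) , (r₁p₁ , _) | r₂ , (q₁r₂ , t₂) , (r₂p₂ , _)
    = ⊥-elim (no-hexagon cp₁ cp₂′ cq₁ cq₂′ (cr cq₂′ t₁) (cr cq₁ t₂) e₁ e₂ q₂r₁ q₁r₂ r₁p₁ r₂p₂)
    where
    cr : ∀ {q r} → cls q ≡ R (next k) → Step (cls q) (cls r) → cls r ≡ R (next (next k))
    cr cq t with labels t
    ... | m , cq′ , c = trans c (cong (λ j → R (next j)) (R-injective (trans (sym cq′) cq)))
    cq₂′ : cls q₂ ≡ R (next k)
    cq₂′ with labels s₁₂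
    ... | m , cp , c = trans c (cong (λ j → R (next j)) (R-injective (trans (sym cp) cp₁)))
    cp₂′ : cls p₂ ≡ R k
    cp₂′ = trans cp₂ (cong R (next-injective (R-injective (trans (sym cq₂) cq₂′))))

  preds : V → Subset n
  preds x = tabulate (λ p → does (p ⟶? x))

  ∈preds⁺ : ∀ {p x} → p ⟶ x → p ∈ˢ preds x
  ∈preds⁺ {p} {x} e = lookup⇒[]= p (preds x) (trans (lookup∘tabulate _ p) (dec-true (p ⟶? x) e))

  ∈preds⁻ : ∀ {p x} → p ∈ˢ preds x → p ⟶ x
  ∈preds⁻ {p} {x} p∈ =
      witness (p ⟶? x) (trans (sym (lookup∘tabulate (λ p → does (p ⟶? x)) p)) ([]=⇒lookup p∈))
    where
    witness : ∀ {A : Set} (d : Dec A) → does d ≡ true → A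
    witness (yes e) _ = e

  step³ : ∀ {C D E F} → Step C D → Step D E → Step E F → C ≡ F
  step³ (step {k}) step step = cong R (sym (next³ k))

  -- A predecessor `p` of `x` is one of `w`: otherwise `no-2K₂` for the arrows from `p` to `x` and
  -- from `z` to `w` joins `z` to `x`, a triangle with `y`. For the same reason `z`, a predecessor
  -- of `w`, is not one of `x`.
  ⟶³-grows : ∀ {x y z w} → x ⟶ y → y ⟶ z → z ⟶ w → size (preds x) < size (preds w)
  ⟶³-grows {x} {y} {z} {w} xy@(exy , sxy) yz@(eyz , syz) zw@(ezw , szw) =
    p⊂q⇒∣p∣<∣q∣ (incl , z , ∈preds⁺ zw , λ z∈ → triangle-free exy eyz (proj₁ (∈preds⁻ z∈)))
    where
    cxw : cls x ≡ cls w
    cxw = step³ sxy syz szw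
    incl : preds x ⊆ˢ preds w
    incl {p} p∈ with p ~? w | ∈preds⁻ p∈
    ... | yes e | _ , s = ∈preds⁺ (e , subst (Step (cls p)) cxw s)
    ... | no ¬e | px@(_ , s) = ⊥-elim (triangle-free exy eyz
            (no-2K₂ px zw (subst (Step (cls p)) cxw s) (subst (Step (cls z)) (sym cxw) szw) ¬e))

  -- Vertices may repeat; the absence of directed cycles is a consequence of the bound on the
  -- length.
  data Path : ℕ → V → Set where
    start : ∀ {x} → Path 0 x
    _▻_   : ∀ {k x y} → Path k x → x ⟶ y → Path (suc k) y

  Path? : ∀ k x → Dec (Path k x)
  Path? zero    x = yes start
  Path? (suc k) y = map′ (λ { (_ , p , e) → p ▻ e }) (λ { (p ▻ e) → _ , p , e })
                         (any? (λ x → Path? k x ×-dec (x ⟶? y)))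

  -- Every three steps enlarge `preds`, so three steps are available per predecessor; the 2 accounts
  -- for an initial piece of fewer than three steps.
  Path-bounded : ∀ {k x} → Path k x → k ≤ 3 * size (preds x) + 2
  Path-bounded start = z≤n
  Path-bounded (start ▻ _) = m≤n⇒m≤o+n _ (s≤s z≤n)
  Path-bounded ((start ▻ _) ▻ _) = m≤n⇒m≤o+n _ (s≤s (s≤s z≤n))
  Path-bounded (_▻_ {suc (suc k)} {_} {w} (_▻_ (_▻_ {x = x} p xy) yz) zw) = begin
    3 + k                          ≤⟨ +-monoʳ-≤ 3 (Path-bounded p) ⟩
    3 + (3 * size (preds x) + 2)      ≡⟨ +-assoc 3 (3 * size (preds x)) 2 ⟨
    3 + 3 * size (preds x) + 2        ≡⟨ cong (_+ 2) (*-suc 3 (size (preds x))) ⟨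
    3 * suc (size (preds x)) + 2        ≤⟨ +-monoˡ-≤ 2 (*-monoʳ-≤ 3 (⟶³-grows xy yz zw)) ⟩
    3 * size (preds w) + 2            ∎
    where open ≤-Reasoning

  greatest : ∀ {P : ℕ → Set} → (∀ k → Dec (P k)) → P 0 → ∀ b → ∃[ k ] (P k × (∀ {j} → P j → j ≤ b → j ≤ k))
  greatest P? p₀ zero    = 0 , p₀ , λ _ j≤ → j≤
  greatest P? p₀ (suc b) with P? (suc b) | greatest P? p₀ b
  ... | yes p | _          = suc b , p , λ _ j≤ → j≤
  ... | no ¬p | k , p , k≥ = k , p , λ {j} q j≤ → k≥ q (≤-pred (≤∧≢⇒< j≤ λ { refl → ¬p q }))

  abstract
    longest : ∀ x → ∃[ k ] (Path k x × (∀ {j} → Path j x → j ≤ 3 * size (preds x) + 2 → j ≤ k))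
    longest x = greatest (λ k → Path? k x) start (3 * size (preds x) + 2)

  level : V → ℕ
  level x = proj₁ (longest x)

  level-path : ∀ x → Path (level x) x
  level-path x = proj₁ (proj₂ (longest x))

  level-max : ∀ {k x} → Path k x → k ≤ level x
  level-max {k} {x} p = proj₂ (proj₂ (longest x)) p (Path-bounded p)

  ⟶⇒< : ∀ {x y} → x ⟶ y → level x < level y
  ⟶⇒< {x} e = level-max (level-path x ▻ e)

  -- If the edge is missing, `between` gives a path from `y` to `x`, along which levels increase.
  -- Together with `⟶⇒<` this makes adjacency of consecutive residue classes a comparison of levels.
  <⇒⟶ : ∀ {x y} → Step (cls x) (cls y) → level x < level y → x ⟶ y
  <⇒⟶ {x} {y} s lt with x ~? y
  ... | yes e = e , s
  ... | no ¬e with between s ¬e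
  ... | z , yz , zx = contradiction (<-trans (⟶⇒< yz) (⟶⇒< zx)) (<-asym lt)

  -- In a longest path to `y` the last but one vertex has level at least `m`, by the initial
  -- segment, and less than `level y`, by the last arrow.
  level-pred : ∀ {m y} → level y ≡ suc m → ∃[ x ] (x ⟶ y × level x ≡ m)
  level-pred {m} {y} eq with level y | level-path y | (λ {x} (e : x ⟶ y) → ⟶⇒< e)
  level-pred refl | suc m | _▻_ {x = x} p e | lt = x , e , ≤-antisym (≤-pred (lt e)) (level-max p)

  source : ∀ {y} → level y ≡ 0 → ∀ {x} → ¬ x ⟶ y
  source eq e with subst (_ <_) eq (⟶⇒< e)
  ... | ()

  -- An edge would be an arrow into `y`, and a missing edge produces, by `between`, an arrow into
  -- `x`.
  no-consecutive-sources : ∀ {x y k} → cls x ≡ R k → cls y ≡ R (next k) → level x ≡ 0 → level y ≡ 0 → ⊥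
  no-consecutive-sources {x} {y} cx cy lx ly with x ~? y
  ... | yes e = source ly (e , steps cx cy)
  ... | no ¬e with between (steps cx cy) ¬e
  ... | z , _ , zx = source lx zx

  sources-agree : ∀ {x y k l} → cls x ≡ R k → cls y ≡ R l → level x ≡ 0 → level y ≡ 0 → k ≡ l
  sources-agree {k = k} {l} cx cy lx ly with compare₃ k l
  ... | inj₁ e           = e
  ... | inj₂ (inj₁ refl) = ⊥-elim (no-consecutive-sources cx cy lx ly)
  ... | inj₂ (inj₂ refl) = ⊥-elim (no-consecutive-sources cy cx ly lx)

  abstract
    top : ∃[ x ] (∀ y → level y ≤ level x)
    top
      with greatest {λ k → ∃[ x ] k ≤ level x} (λ k → any? (λ x → k ≤? level x)) (proj₁ anX , z≤n) (3 * n + 2)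
    ... | k , (x , k≤) , max =
        x , λ y → ≤-trans (max (y , ≤-refl) (≤-trans (Path-bounded (level-path y)) (+-monoˡ-≤ 2 (*-monoʳ-≤ 3 (∣p∣≤n (preds y)))))) k≤

  -- A rotation of the labels achieves this, since by `sources-agree` all residues of level 0 have
  -- the same label.
  Rooted : Set
  Rooted = ∀ {x k} → cls x ≡ R k → level x ≡ 0 → k ≡ 0₃

  label-level : Rooted → ∀ {m x k} → level x ≡ m → cls x ≡ R k → k ≡ lab m
  label-level root {zero}  eq c = root c eq
  label-level root {suc m} eq c with level-pred eq
  ... | p , (_ , s) , eq′ with labels s
  ... | l , cp , cx = trans (R-injective (trans (sym c) cx)) (cong next (label-level root eq′ cp))

  level⇒R : ∀ {m x} → level x ≡ suc m → ∃[ k ] cls x ≡ R k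
  level⇒R eq with level-pred eq
  ... | _ , (_ , s) , _ with labels s
  ... | k , _ , cx = next k , cx

  level-attained : ∀ {x} d {m} → level x ≡ d + m → ∃[ y ] level y ≡ m
  level-attained zero    eq = _ , eq
  level-attained (suc d) eq with level-pred eq
  ... | p , _ , eq′ = level-attained d eq′

  attained-R : ∀ {m} x → 1 ≤ level x → m ≤ level x → ∃[ y ] ∃[ k ] (cls y ≡ R k × level y ≡ m)
  -- Vertices that are not residues have level 0 too, so a residue of level 0 is found as a
  -- predecessor of a vertex of level 1.
  attained-R {zero} x 1≤ _ with level-attained (level x ∸ 1) (sym (m∸n+n≡m 1≤))
  ... | y , e with level-pred e
  ... | p , (_ , s) , e′ with labels s
  ... | k , cp , _ = p , k , cp , e′
  attained-R {suc m} x _ m≤ with level-attained (level x ∸ suc m) (sym (m∸n+n≡m m≤))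
  ... | y , e with level⇒R e
  ... | k , cy = y , k , cy , e

  -- Otherwise no vertex has three neighbours among a first vertex, a last vertex,
  -- and the hubs and antihubs of their classes.
  top-label : ∀ {p q} → cls p ≡ R 0₃ → (∀ {y} → ¬ y ⟶ p) → (∀ {y} → ¬ q ⟶ y) → cls q ≢ R 2₃
  top-label {p} {q} cp ¬p ¬q cq with hubs 0₃ | hubs 2₃ | antis 0₃ | antis 2₃
  ... | h₀ , ch₀ | h₂ , ch₂ | g₀ , cg₀ | g₂ , cg₂ with 𝒟₂ (p ∷ q ∷ h₀ ∷ h₂ ∷ g₀ ∷ g₂ ∷ [])
  ... | t , 3≤ = <⇒≱ 3≤ (≤-trans (≤-reflexive (sum₆ t p q h₀ h₂ g₀ g₂)) (bound (cls t) refl))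
    where
    off : ∀ {x C D} → cls x ≡ C → cls t ≡ D → ¬ SymClosure Compat C D → ind t x ≤ 0
    off refl refl ¬c = classCases ¬c
    on : ∀ {x} → ind t x ≤ 1
    on = ind≤1
    cap : Class → Class → ℕ
    cap C D = if does (compat? C D) then 1 else 0
    ≤cap : ∀ {x C D} → cls x ≡ C → cls t ≡ D → ind t x ≤ cap C D
    ≤cap {x} {C} {D} cx ct = choose (compat? C D) (off cx ct)
      where
      choose : ∀ {A : Set} (d : Dec A) → (¬ A → ind t x ≤ 0) → ind t x ≤ (if does d then 1 else 0)
      choose (yes _) _ = ind≤1
      choose (no ¬a) f = f ¬a
    total : Class → ℕ
    total C =
        (cap (R 0₃) C + cap (R 2₃) C) +
          ((cap (hub 0₃) C + cap (hub 2₃) C) + (cap (anti 0₃) C + cap (anti 2₃) C))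
    below : ∀ {C} → cls t ≡ C → total C ≤ 2 →
            (ind t p + ind t q) + ((ind t h₀ + ind t h₂) + (ind t g₀ + ind t g₂)) ≤ 2
    below ct ≤2 = ≤-trans (+-mono-≤ (+-mono-≤ (≤cap cp ct) (≤cap cq ct))
                    (+-mono-≤ (+-mono-≤ (≤cap ch₀ ct) (≤cap ch₂ ct)) (+-mono-≤ (≤cap cg₀ ct) (≤cap cg₂ ct)))) ≤2
    bound : ∀ C → cls t ≡ C →
            (ind t p + ind t q) + ((ind t h₀ + ind t h₂) + (ind t g₀ + ind t g₂)) ≤ 2
    -- Judged by its class, a vertex of `R 0₃` may see `q`, `h₀` and `g₀`; that `q` is last excludes
    -- `q`. In `R 2₃` it is `p` that is excluded, being first. For each remaining class exactly two
    -- of the six vertices have a compatible class.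
    bound (R 0₃) ct = +-mono-≤ (+-mono-≤ (off cp ct λ { (fwd (step ())) ; (bwd (step ())) })
                                         (ind-non (λ e → ¬q (e , steps cq ct))))
                        (+-mono-≤ (+-mono-≤ ind≤1 (≤cap ch₂ ct)) (+-mono-≤ ind≤1 (≤cap cg₂ ct)))
    bound (R 2₃) ct = +-mono-≤ (+-mono-≤ (ind-non (λ e → ¬p (~sym e , steps ct cp)))
                                         (off cq ct λ { (fwd (step ())) ; (bwd (step ())) }))
                        (+-mono-≤ (+-mono-≤ (≤cap ch₀ ct) ind≤1) (+-mono-≤ (≤cap cg₀ ct) ind≤1))
    bound (R 1₃)    ct = below ct ≤-refl
    bound (hub 0₃)  ct = below ct ≤-refl
    bound (hub 1₃)  ct = below ct ≤-refl
    bound (hub 2₃)  ct = below ct ≤-refl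
    bound (anti 0₃) ct = below ct ≤-refl
    bound (anti 1₃) ct = below ct ≤-refl
    bound (anti 2₃) ct = below ct ≤-refl
    bound X         ct = below ct ≤-refl
    bound Y         ct = below ct ≤-refl

-- Adjacency in Andrásfai graphs by representatives

∣j-m-d∣ : ∀ j m d → ∣ (pos j ℤ.- pos m) ℤ.- pos d ∣ ≡ ∣ j ⊖ (m + d) ∣
∣j-m-d∣ j m d = cong ∣_∣ (begin
  (pos j ℤ.- pos m) ℤ.- pos d        ≡⟨ ℤᵖ.+-assoc (pos j) (ℤ.- pos m) (ℤ.- pos d) ⟩
  pos j ℤ.+ (ℤ.- pos m ℤ.- pos d)    ≡⟨ cong (λ t → pos j ℤ.+ t) (ℤᵖ.neg-distrib-+ (pos m) (pos d)) ⟨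
  pos j ℤ.- pos (m + d)            ≡⟨ ℤᵖ.m-n≡m⊖n j (m + d) ⟩
  j ⊖ (m + d)                  ∎)
  where open ≡-Reasoning

order-suc : ∀ i → order (suc i) ≡ suc i + (suc i + i)
order-suc i = trans (cong (λ t → i + (suc i + t)) (+-identityʳ (suc i))) (lemma i)
  where
  lemma : ∀ i → i + (suc i + suc i) ≡ suc i + (suc i + i)
  lemma = solve-∀

2i∸1 : ∀ i → 2 * suc i ∸ 1 ≡ suc i + i
2i∸1 i = trans (cong (i +_) (+-identityʳ (suc i))) (+-suc i i)

private
  Multiple : ∀ {N r} → N ∣ r → r < N + N → r ≡ 0 ⊎ r ≡ N
  Multiple (divides 0 eq) _ = inj₁ eq
  Multiple {N} (divides 1 eq) _ = inj₂ (trans eq (+-identityʳ N))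
  Multiple {N} (divides (suc (suc q)) eq) r< = contradiction r<
    (≤⇒≯ (subst (N + N ≤_) (sym eq) (+-monoʳ-≤ N (m≤m+n N (q * N)))))

-- The set {i, ..., 2i - 1} is invariant under d ↦ 3i - 1 - d, so adjacency in the Andrásfai graph
-- depends only on the absolute difference of the representatives.
Near : ℕ → ℕ → ℕ → Set
Near i j m = (m + i ≤ j × j < m + (i + i)) ⊎ (j + i ≤ m × m < j + (i + i))

module _ (i₀ : ℕ) where
  private
    i N : ℕ
    i = suc i₀
    N = order i

  Γ⇒Near : ∀ {j m} → ΓEdge i j m → Near i (toℕ j) (toℕ m)
  Γ⇒Near {j} {m} (d , i≤d , d≤ , N∣) = cases (≤-total (b + d) a)
    where
    a b : ℕ
    a = toℕ j
    b = toℕ m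
    d≤′ : d ≤ i + i₀
    d≤′ = subst (d ≤_) (2i∸1 i₀) d≤
    N≡ : N ≡ i + (i + i₀)
    N≡ = order-suc i₀
    d<2i : d < i + i
    d<2i = subst (d <_) (sym (+-suc i i₀)) (s≤s d≤′)
    plain : b + d ≡ a → Near i a b
    plain e = inj₁ (subst (b + i ≤_) e (+-monoʳ-≤ b i≤d) , subst (_< b + (i + i)) e (+-monoʳ-< b d<2i))
    -- Here `b - a` equals `N - d`, and subtraction from `N = 3 i - 1` exchanges the extreme
    -- differences `i` and `2 i - 1`.
    wrapped : b + d ≡ N + a → Near i a b
    wrapped e = inj₂ (+-cancelʳ-≤ (i + i₀) (a + i) b low , +-cancelʳ-< i b (a + (i + i)) high)
      where
      open ≤-Reasoning
      low : (a + i) + (i + i₀) ≤ b + (i + i₀)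
      low = begin
        (a + i) + (i + i₀)  ≡⟨ +-assoc a i (i + i₀) ⟩
        a + (i + (i + i₀))  ≡⟨ cong (a +_) N≡ ⟨
        a + N               ≡⟨ +-comm a N ⟩
        N + a               ≡⟨ e ⟨
        b + d               ≤⟨ +-monoʳ-≤ b d≤′ ⟩
        b + (i + i₀)        ∎
      high : b + i < (a + (i + i)) + i
      high = begin-strict
        b + i               ≤⟨ +-monoʳ-≤ b i≤d ⟩
        b + d               ≡⟨ e ⟩
        N + a               ≡⟨ cong (_+ a) N≡ ⟩
        i + (i + i₀) + a    <⟨ ≤-reflexive (rearrange i₀ a) ⟩
        (a + (i + i)) + i   ∎
        where
        rearrange : ∀ i₀ a → suc (suc i₀ + (suc i₀ + i₀) + a) ≡ (a + (suc i₀ + suc i₀)) + suc i₀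
        rearrange = solve-∀
    cases : b + d ≤ a ⊎ a ≤ b + d → Near i a b
    cases (inj₁ m+d≤j)
     
        with Multiple (subst (N ∣_) (trans (∣j-m-d∣ a b d) (trans (ℤᵖ.∣m⊖n∣≡∣n⊖m∣ a (b + d)) (ℤᵖ.∣⊖∣-≤ m+d≤j))) N∣)
                    (≤-<-trans (m∸n≤m a (b + d)) (<-≤-trans (toℕ<n j) (m≤m+n N N)))
    ... | inj₁ 0≡ = plain (≤-antisym m+d≤j (m∸n≡0⇒m≤n 0≡))
    ... | inj₂ e  = contradiction (toℕ<n j) (≤⇒≯ (subst (_≤ a) e (m∸n≤m a (b + d))))
    cases (inj₂ j≤m+d)
      with Multiple (subst (N ∣_) (trans (∣j-m-d∣ a b d) (ℤᵖ.∣⊖∣-≤ j≤m+d)) N∣)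
                    (≤-<-trans (m∸n≤m (b + d) a) (+-mono-<-≤ (toℕ<n m) (≤-trans d≤′ (subst (i + i₀ ≤_) (sym N≡) (m≤n+m (i + i₀) i)))))
    ... | inj₁ 0≡ = plain (≤-antisym (m∸n≡0⇒m≤n 0≡) j≤m+d)
    ... | inj₂ e  = wrapped (trans (sym (m∸n+n≡m j≤m+d)) (cong (_+ a) e))

  Near⇒Γ : ∀ {j m} → Near i (toℕ j) (toℕ m) → ΓEdge i j m
  Near⇒Γ {j} {m} (inj₁ (low , high)) = d , +-cancelˡ-≤ b i d (subst (b + i ≤_) (sym b+d) low)
    , subst (d ≤_) (sym (2i∸1 i₀))
      (≤-pred (subst (d <_) (+-suc i i₀) (+-cancelˡ-< b d (i + i) (subst (_< b + (i + i)) (sym b+d) high))))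
    , subst (N ∣_) (sym (trans (∣j-m-d∣ a b d) (trans (cong (λ t → ∣ a ⊖ t ∣) b+d) (trans (ℤᵖ.∣⊖∣-≤ (≤-refl {a})) (n∸n≡0 a))))) (divides 0 refl)
    where
    a b d : ℕ
    a = toℕ j
    b = toℕ m
    d = a ∸ b
    b+d : b + d ≡ a
    b+d = m+[n∸m]≡n (≤-trans (m≤m+n b i) low)
  Near⇒Γ {j} {m} (inj₂ (low , high)) = d , +-cancelˡ-≤ b i d (subst (b + i ≤_) (sym b+d) low′)
    , subst (d ≤_) (sym (2i∸1 i₀)) (+-cancelˡ-≤ b d (i + i₀) (subst (_≤ b + (i + i₀)) (sym b+d) high′))
    , subst (N ∣_) (sym (trans (∣j-m-d∣ a b d) (trans (cong (λ t → ∣ a ⊖ t ∣) b+d) (trans (ℤᵖ.∣⊖∣-≤ (m≤n+m a N)) (m+n∸n≡m N a))))) (divides 1 (sym (+-identityʳ N)))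
    where
    a b d : ℕ
    a = toℕ j
    b = toℕ m
    d = (N + a) ∸ b
    b+d : b + d ≡ N + a
    b+d = m+[n∸m]≡n (≤-trans (<⇒≤ (toℕ<n m)) (m≤m+n N a))
    open ≤-Reasoning
    low′ : b + i ≤ N + a
    low′ = ≤-pred (begin-strict
      b + i                    <⟨ +-monoˡ-< i high ⟩
      (a + (i + i)) + i        ≡⟨ rearrange i₀ a ⟩
      suc (i + (i + i₀) + a)   ≡⟨ cong (λ t → suc (t + a)) (order-suc i₀) ⟨
      suc (N + a)              ∎)
      where
      rearrange : ∀ i₀ a → (a + (suc i₀ + suc i₀)) + suc i₀ ≡ suc (suc i₀ + (suc i₀ + i₀) + a)
      rearrange = solve-∀
    high′ : N + a ≤ b + (i + i₀)
    high′ = begin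
      N + a                    ≡⟨ +-comm N a ⟩
      a + N                    ≡⟨ cong (a +_) (order-suc i₀) ⟩
      a + (i + (i + i₀))       ≡⟨ +-assoc a i (i + i₀) ⟨
      (a + i) + (i + i₀)       ≤⟨ +-monoˡ-≤ (i + i₀) low ⟩
      b + (i + i₀)             ∎

-- Levels versus residues

toℕ₃ : ℤ₃ → ℕ
toℕ₃ 0₃ = 0
toℕ₃ 1₃ = 1
toℕ₃ 2₃ = 2

lev : ℕ → ℤ₃ → ℕ
lev s k = toℕ₃ k + 3 * s

-- The residue of the vertices of level lev s k.
resid : ℕ → ℕ → ℤ₃ → ℕ
resid i s 0₃ = s
resid i s 1₃ = s + i
resid i s 2₃ = s + (i + i)

split₃ : ∀ m → ∃[ s ] ∃[ k ] m ≡ lev s k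
split₃ zero = 0 , 0₃ , refl
split₃ (suc m) with split₃ m
... | s , 0₃ , refl = s , 1₃ , refl
... | s , 1₃ , refl = s , 2₃ , refl
... | s , 2₃ , refl = suc s , 0₃ , sym (*-suc 3 s)

lab-lev : ∀ s k → lab (lev s k) ≡ k
lab-lev zero    0₃ = refl
lab-lev zero    1₃ = refl
lab-lev zero    2₃ = refl
lab-lev (suc s) k  = trans (cong lab (shift (toℕ₃ k) s)) (trans (next³ _) (lab-lev s k))
  where
  shift : ∀ t s → t + 3 * suc s ≡ 3 + (t + 3 * s)
  shift = solve-∀

lev-injective : ∀ {s k s′ k′} → lev s k ≡ lev s′ k′ → s ≡ s′ × k ≡ k′
lev-injective {s} {k} {s′} {k′} e with trans (sym (lab-lev s k)) (trans (cong lab e) (lab-lev s′ k′))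
... | refl = *-cancelˡ-≡ s s′ 3 (+-cancelˡ-≡ (toℕ₃ k) (3 * s) (3 * s′) e) , refl

private
  far : ∀ {i s t} d → s < i → ¬ (t + d) + i ≤ s + d
  far {i} {s} {t} d s<i le = <⇒≱ s<i (≤-trans (m≤n+m i t)
    (+-cancelʳ-≤ d (t + i) s (subst (_≤ s + d) (trans (+-assoc t d i) (trans (cong (t +_) (+-comm d i)) (sym (+-assoc t i d)))) le)))

  far₀ : ∀ {i s t} → s < i → ¬ t + i ≤ s
  far₀ {i} {s} {t} s<i le = <⇒≱ s<i (≤-trans (m≤n+m i t) le)

  near-+i : ∀ {i s t} d → t < i → s ≤ t → Near i (s + d) (t + (d + i))
  near-+i {i} {s} {t} d t<i s≤t = inj₂
    ( ≤-trans (≤-reflexive (+-assoc s d i)) (+-monoˡ-≤ (d + i) s≤t)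
    , (begin-strict
        t + (d + i)          <⟨ +-monoˡ-< (d + i) t<i ⟩
        i + (d + i)          ≡⟨ trans (sym (+-assoc i d i))
          (trans (cong (_+ i) (+-comm i d)) (+-assoc d i i)) ⟩
        d + (i + i)          ≤⟨ m≤n+m (d + (i + i)) s ⟩
        s + (d + (i + i))    ≡⟨ +-assoc s d (i + i) ⟨
        (s + d) + (i + i)    ∎))
    where open ≤-Reasoning

-- From the first or second interval the residues differ by `i + s′ - s`, from the third by
-- `2 i + s - s′`. As `s` and `s′` are below `i`, only one of the two bounds on the difference can
-- fail, and it compares `s` with `s′` exactly as the levels do.
near-next : ∀ {i s s′} k → s < i → s′ < i → lev s k < lev s′ (next k) →
    Near i (resid i s k) (resid i s′ (next k))
near-next {i} {s} {s′} 0₃ s< s′< lt =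
    subst (λ a → Near i a (s′ + i)) (+-identityʳ s) (near-+i 0 s′< (*-cancelˡ-≤ 3 (≤-pred lt)))
near-next 1₃ s< s′< lt = near-+i _ s′< (*-cancelˡ-≤ 3 (≤-pred (≤-pred lt)))
near-next {i} {s} {s′} 2₃ s< s′< lt = inj₁
  ( ≤-trans (+-monoˡ-≤ i (<⇒≤ s′<)) (m≤n+m (i + i) s)
  , +-monoˡ-< (i + i) (*-cancelˡ-< 3 s s′ (≤-trans (s≤s (m≤n+m (3 * s) 2)) lt)))

near-next⁻ : ∀ {i s s′} k → s < i → s′ < i → Near i (resid i s k) (resid i s′ (next k)) →
    lev s k < lev s′ (next k)
near-next⁻ {i} {s} {s′} 0₃ s< s′< (inj₁ (le , _)) = ⊥-elim (far₀ s< le)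
near-next⁻ {i} {s} {s′} 0₃ s< s′< (inj₂ (le , _)) = s≤s (*-monoʳ-≤ 3 (+-cancelʳ-≤ i s s′ le))
near-next⁻ {i} {s} {s′} 1₃ s< s′< (inj₁ (le , _)) =
    ⊥-elim (far i s< (subst (λ t → t + i ≤ s + i) (sym (+-assoc s′ i i)) le))
near-next⁻ {i} {s} {s′} 1₃ s< s′< (inj₂ (le , _)) =
    s≤s (s≤s (*-monoʳ-≤ 3 (+-cancelʳ-≤ (i + i) s s′ (subst (_≤ s′ + (i + i)) (+-assoc s i i) le))))
near-next⁻ {i} {s} {s′} 2₃ s< s′< (inj₁ (_ , lt)) =
    subst (_≤ 3 * s′) (*-suc 3 s) (*-monoʳ-≤ 3 (+-cancelʳ-< (i + i) s s′ lt))
near-next⁻ {i} {s} {s′} 2₃ s< s′< (inj₂ (le , _)) = ⊥-elim (far₀ s′< le)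

near-same : ∀ {i s s′} k → s < i → s′ < i → ¬ Near i (resid i s k) (resid i s′ k)
near-same 0₃ s< s′< (inj₁ (le , _)) = far₀ s< le
near-same 0₃ s< s′< (inj₂ (le , _)) = far₀ s′< le
near-same 1₃ s< s′< (inj₁ (le , _)) = far _ s< le
near-same 1₃ s< s′< (inj₂ (le , _)) = far _ s′< le
near-same {i} {s} {s′} 2₃ s< s′< (inj₁ (le , _)) = far {t = s′} (i + i) s< le
near-same {i} {s} {s′} 2₃ s< s′< (inj₂ (le , _)) = far {t = s} (i + i) s′< le

-- Classes of the vertices of a Vega graph

module V = VegaVertex
module E = VegaEdge

data Of (i : ℕ) : VegaVertex i → Class → Set where
  of-a : Of i V.a (hub 0₃)
  of-b : Of i V.b (hub 1₃)
  of-c : Of i V.c (hub 2₃)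
  of-u : Of i V.u (anti 0₃)
  of-v : Of i V.v (anti 1₃)
  of-w : Of i V.w (anti 2₃)
  of-x : Of i V.x X
  of-y : Of i V.y Y
  of-0 : ∀ {j} → toℕ j < i → Of i (V.res j) (R 0₃)
  of-1 : ∀ {j} → i ≤ toℕ j → toℕ j < 2 * i → Of i (V.res j) (R 1₃)
  of-2 : ∀ {j} → 2 * i ≤ toℕ j → Of i (V.res j) (R 2₃)

private
  i≤2i : ∀ i → i ≤ 2 * i
  i≤2i i = m≤m+n i (i + 0)

link⇒edge : ∀ {i p q C D} → Of i p C → Of i q D → Link C D → SymClosure (VegaEdge i) p q
link⇒edge of-a of-u (hub-anti k≢l) = ⊥-elim (k≢l refl)
link⇒edge of-a of-v (hub-anti _)   = fwd E.av
link⇒edge of-a of-w (hub-anti _)   = bwd E.wa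
link⇒edge of-b of-u (hub-anti _)   = bwd E.ub
link⇒edge of-b of-v (hub-anti k≢l) = ⊥-elim (k≢l refl)
link⇒edge of-b of-w (hub-anti _)   = fwd E.bw
link⇒edge of-c of-u (hub-anti _)   = fwd E.cu
link⇒edge of-c of-v (hub-anti _)   = bwd E.vc
link⇒edge of-c of-w (hub-anti k≢l) = ⊥-elim (k≢l refl)
link⇒edge of-a (of-0 j<)    hub-R  = fwd (E.a₀ j<)
link⇒edge of-b (of-1 ≤j j<) hub-R  = fwd (E.b₁ ≤j j<)
link⇒edge of-c (of-2 ≤j)    hub-R  = fwd (E.c₂ ≤j)
link⇒edge of-u (of-0 j<)    anti-R = fwd (E.u₀ j<)
link⇒edge of-v (of-1 ≤j j<) anti-R = fwd (E.v₁ ≤j j<)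
link⇒edge of-w (of-2 ≤j)    anti-R = fwd (E.w₂ ≤j)
link⇒edge of-x of-a X-hub          = fwd E.xa
link⇒edge of-x of-b X-hub          = fwd E.xb
link⇒edge of-x of-c X-hub          = fwd E.xc
link⇒edge of-y of-u Y-anti         = fwd E.yu
link⇒edge of-y of-v Y-anti         = fwd E.yv
link⇒edge of-y of-w Y-anti         = fwd E.yw
link⇒edge of-x of-y X-Y            = fwd E.xy

edge⇒link : ∀ {i p q C D} → Of i p C → Of i q D → VegaEdge i p q →
            SymClosure Link C D ⊎ ∃[ j ] ∃[ m ] (p ≡ V.res j × q ≡ V.res m × ΓEdge i j m)
edge⇒link _ _ (E.Γ e) = inj₂ (_ , _ , refl , refl , e)
edge⇒link of-a of-v E.av = inj₁ (fwd (hub-anti λ ()))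
edge⇒link of-v of-c E.vc = inj₁ (bwd (hub-anti λ ()))
edge⇒link of-c of-u E.cu = inj₁ (fwd (hub-anti λ ()))
edge⇒link of-u of-b E.ub = inj₁ (bwd (hub-anti λ ()))
edge⇒link of-b of-w E.bw = inj₁ (fwd (hub-anti λ ()))
edge⇒link of-w of-a E.wa = inj₁ (bwd (hub-anti λ ()))
edge⇒link of-a (of-0 _) (E.a₀ _) = inj₁ (fwd hub-R)
edge⇒link of-u (of-0 _) (E.u₀ _) = inj₁ (fwd anti-R)
edge⇒link of-b (of-1 _ _) (E.b₁ _ _) = inj₁ (fwd hub-R)
edge⇒link of-v (of-1 _ _) (E.v₁ _ _) = inj₁ (fwd anti-R)
edge⇒link of-c (of-2 _) (E.c₂ _) = inj₁ (fwd hub-R)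
edge⇒link of-w (of-2 _) (E.w₂ _) = inj₁ (fwd anti-R)
edge⇒link of-a (of-1 ≤j _) (E.a₀ j<) = ⊥-elim (<⇒≱ j< ≤j)
edge⇒link {i} of-a (of-2 ≤j) (E.a₀ j<) = ⊥-elim (<⇒≱ j< (≤-trans (i≤2i i) ≤j))
edge⇒link of-u (of-1 ≤j _) (E.u₀ j<) = ⊥-elim (<⇒≱ j< ≤j)
edge⇒link {i} of-u (of-2 ≤j) (E.u₀ j<) = ⊥-elim (<⇒≱ j< (≤-trans (i≤2i i) ≤j))
edge⇒link of-b (of-0 j<) (E.b₁ ≤j _) = ⊥-elim (<⇒≱ j< ≤j)
edge⇒link of-b (of-2 ≤j) (E.b₁ _ j<) = ⊥-elim (<⇒≱ j< ≤j)
edge⇒link of-v (of-0 j<) (E.v₁ ≤j _) = ⊥-elim (<⇒≱ j< ≤j)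
edge⇒link of-v (of-2 ≤j) (E.v₁ _ j<) = ⊥-elim (<⇒≱ j< ≤j)
edge⇒link {i} of-c (of-0 j<) (E.c₂ ≤j) = ⊥-elim (<⇒≱ j< (≤-trans (i≤2i i) ≤j))
edge⇒link of-c (of-1 _ j<) (E.c₂ ≤j) = ⊥-elim (<⇒≱ j< ≤j)
edge⇒link {i} of-w (of-0 j<) (E.w₂ ≤j) = ⊥-elim (<⇒≱ j< (≤-trans (i≤2i i) ≤j))
edge⇒link of-w (of-1 _ j<) (E.w₂ ≤j) = ⊥-elim (<⇒≱ j< ≤j)
edge⇒link of-x of-a E.xa = inj₁ (fwd X-hub)
edge⇒link of-x of-b E.xb = inj₁ (fwd X-hub)
edge⇒link of-x of-c E.xc = inj₁ (fwd X-hub)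
edge⇒link of-y of-u E.yu = inj₁ (fwd Y-anti)
edge⇒link of-y of-v E.yv = inj₁ (fwd Y-anti)
edge⇒link of-y of-w E.yw = inj₁ (fwd Y-anti)
edge⇒link of-x of-y E.xy = inj₁ (fwd X-Y)

-- The blow-up map

Y? : ∀ C → Dec (C ≡ Y)
Y? (hub _)  = no λ ()
Y? (anti _) = no λ ()
Y? (R _)    = no λ ()
Y? X        = no λ ()
Y? Y        = yes refl

private
  suc-lev< : ∀ {L s} k → L ≡ lev s k → k ≢ 2₃ → suc L < 3 * suc s
  suc-lev< {s = s} 0₃ refl _  = subst (suc (suc (3 * s)) ≤_) (sym (*-suc 3 s)) (n≤1+n _)
  suc-lev< {s = s} 1₃ refl _  = ≤-reflexive (sym (*-suc 3 s))
  suc-lev<         2₃ refl ne = ⊥-elim (ne refl)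

  lev-pos : ∀ {s} k → 3 ≤ lev s k → 1 ≤ s
  lev-pos {suc _} k  _ = s≤s z≤n
  lev-pos {zero}  0₃ ()
  lev-pos {zero}  1₃ (s≤s ())
  lev-pos {zero}  2₃ (s≤s (s≤s ()))

  lev≤⇒< : ∀ {L i} s k → suc L < 3 * i → lev s k ≤ L → s < i
  lev≤⇒< {L} {i} s k L< le =
      *-cancelˡ-< 3 s i (≤-<-trans (≤-trans (m≤n+m (3 * s) (toℕ₃ k)) le) (<-trans (n<1+n L) L<))

  -- The bound on `L` is critical in the third interval: level `3 i - 1` would receive the number
  -- `3 i - 1`, which is not among the residues.
  resid< : ∀ {L i₀} s k → suc L < 3 * suc i₀ → lev s k ≤ L → resid (suc i₀) s k < order (suc i₀)
  resid< {L} {i₀} s k L< le = subst (resid (suc i₀) s k <_) (sym (order-suc i₀)) (go k le)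
    where
    go : ∀ k → lev s k ≤ L → resid (suc i₀) s k < suc i₀ + (suc i₀ + i₀)
    go 0₃ le = ≤-trans (lev≤⇒< s 0₃ L< le) (m≤m+n (suc i₀) (suc i₀ + i₀))
    go 1₃ le =
        <-≤-trans (+-monoˡ-< (suc i₀) (lev≤⇒< {i = suc i₀} s 1₃ L< le)) (+-monoʳ-≤ (suc i₀) (m≤m+n (suc i₀) i₀))
    go 2₃ le = ≤-trans (+-monoˡ-< (suc i₀ + suc i₀) s<) (≤-reflexive (rearrange i₀))
      where
      s< : s < i₀
      s< =
          ≤-pred
            (*-cancelˡ-< 3 (suc s) (suc i₀) (≤-<-trans (≤-trans (≤-reflexive (*-suc 3 s)) (s≤s le)) L<))
      rearrange : ∀ t → t + (suc t + suc t) ≡ suc t + (suc t + t)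
      rearrange = solve-∀

  -- The third interval is shorter than the others by one residue, hence the sharper bound on `s`
  -- there.
  unresid : ∀ {i₀ j} → j < order (suc i₀) →
            ∃[ s ] ∃[ k ] (j ≡ resid (suc i₀) s k × s ≤ i₀ × (k ≡ 2₃ → s < i₀))
  unresid {i₀} {j} j< with j <? suc i₀ | j <? suc i₀ + suc i₀
  ... | yes lt | _      = j , 0₃ , refl , ≤-pred lt , λ ()
  ... | no ≥i  | yes lt =
      j ∸ suc i₀ , 1₃ , sym e , ≤-pred
        (+-cancelʳ-< (suc i₀) _ _ (subst (_< suc i₀ + suc i₀) (sym e) lt)) , λ ()
    where
    e : j ∸ suc i₀ + suc i₀ ≡ j
    e = m∸n+n≡m (≮⇒≥ ≥i)
  ... | no _   | no ≥2i = j ∸ (suc i₀ + suc i₀) , 2₃ , sym e , <⇒≤ s< , λ _ → s<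
    where
    e : j ∸ (suc i₀ + suc i₀) + (suc i₀ + suc i₀) ≡ j
    e = m∸n+n≡m (≮⇒≥ ≥2i)
    rearrange : ∀ t → suc t + (suc t + t) ≡ t + (suc t + suc t)
    rearrange = solve-∀
    s< : j ∸ (suc i₀ + suc i₀) < i₀
    s< = +-cancelʳ-< (suc i₀ + suc i₀) _ _ (subst₂ _<_ (sym e) (trans (order-suc i₀) (rearrange i₀)) j<)

  of-res : ∀ {i s} k {j : Fin (order i)} → s < i → toℕ j ≡ resid i s k → Of i (V.res j) (R k)
  of-res {i} {s} 0₃ s< e = of-0 (subst (_< i) (sym e) s<)
  of-res {i} {s} 1₃ s< e = of-1 (subst (i ≤_) (sym e) (m≤n+m i s))
    (subst₂ _<_ (sym e) (cong (i +_) (sym (+-identityʳ i))) (+-monoˡ-< i s<))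
  of-res {i} {s} 2₃ s< e = of-2 (subst₂ _≤_ (cong (i +_) (sym (+-identityʳ i))) (sym e) (m≤n+m (i + i) s))

-- The last level determines the Vega graph. With `i - 1` the quotient of `L` by 3, the levels up to
-- `L` exhaust the residues if `L = 3 i - 2` and omit one if `L = 3 i - 3`; a last level `3 i - 1`
-- would have no residue, whence `k₀≢2`. The bound `3≤L` yields `2 ≤ i`.
module Embed {n} (G : Graph (Fin n)) (cls : Fin n → Class) (S : Structured G cls) (level : Fin n → ℕ)
  (step⇒< : ∀ {x y} → Adj G x y → Step (cls x) (cls y) → level x < level y)
  (<⇒adj : ∀ {x y} → Step (cls x) (cls y) → level x < level y → Adj G x y)
  (label : ∀ {x k} → cls x ≡ R k → k ≡ lab (level x))
  (L s₀ : ℕ) (k₀ : ℤ₃) (L≡ : L ≡ lev s₀ k₀) (k₀≢2 : k₀ ≢ 2₃) (3≤L : 3 ≤ L)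
  (≤L : ∀ x → level x ≤ L)
  (at-level : ∀ {m} → m ≤ L → ∃[ x ] ∃[ k ] (cls x ≡ R k × level x ≡ m)) where

  open Structured S

  private
    i : ℕ
    i = suc s₀

    L< : suc L < 3 * i
    L< = suc-lev< k₀ L≡ k₀≢2

    sᵥ : Fin n → ℕ
    sᵥ x = proj₁ (split₃ (level x))

    kᵥ : Fin n → ℤ₃
    kᵥ x = proj₁ (proj₂ (split₃ (level x)))

    level≡ : ∀ x → level x ≡ lev (sᵥ x) (kᵥ x)
    level≡ x = proj₂ (proj₂ (split₃ (level x)))

    kᵥ≡ : ∀ {x k} → cls x ≡ R k → kᵥ x ≡ k
    kᵥ≡ {x} c = sym (trans (label c) (trans (cong lab (level≡ x)) (lab-lev (sᵥ x) (kᵥ x))))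

    lev≤L : ∀ x → lev (sᵥ x) (kᵥ x) ≤ L
    lev≤L x = subst (_≤ L) (level≡ x) (≤L x)

    sᵥ< : ∀ x → sᵥ x < i
    sᵥ< x = lev≤⇒< (sᵥ x) (kᵥ x) L< (lev≤L x)

    idx : Fin n → Fin (order i)
    idx x = fromℕ< (resid< (sᵥ x) (kᵥ x) L< (lev≤L x))

    toℕ-idx : ∀ {x k} → cls x ≡ R k → toℕ (idx x) ≡ resid i (sᵥ x) k
    toℕ-idx {x} c = trans (toℕ-fromℕ< _) (cong (resid i (sᵥ x)) (kᵥ≡ c))

    level-R : ∀ {x k} → cls x ≡ R k → level x ≡ lev (sᵥ x) k
    level-R {x} c = trans (level≡ x) (cong (lev (sᵥ x)) (kᵥ≡ c))

    vtx : Class → Fin n → VegaVertex i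
    vtx (hub 0₃)  _ = V.a
    vtx (hub 1₃)  _ = V.b
    vtx (hub 2₃)  _ = V.c
    vtx (anti 0₃) _ = V.u
    vtx (anti 1₃) _ = V.v
    vtx (anti 2₃) _ = V.w
    vtx X         _ = V.x
    vtx Y         _ = V.y
    vtx (R _)     x = V.res (idx x)

    F : Fin n → VegaVertex i
    F x = vtx (cls x) x

    of-vtx : ∀ C x → cls x ≡ C → Of i (vtx C x) C
    of-vtx (hub 0₃)  x _ = of-a
    of-vtx (hub 1₃)  x _ = of-b
    of-vtx (hub 2₃)  x _ = of-c
    of-vtx (anti 0₃) x _ = of-u
    of-vtx (anti 1₃) x _ = of-v
    of-vtx (anti 2₃) x _ = of-w
    of-vtx X         x _ = of-x
    of-vtx Y         x _ = of-y
    of-vtx (R k)     x c = of-res k (sᵥ< x) (toℕ-idx c)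

    of : ∀ x → Of i (F x) (cls x)
    of x = of-vtx (cls x) x refl

    F-R : ∀ {x k} → cls x ≡ R k → F x ≡ V.res (idx x)
    F-R {x} c = cong (λ C → vtx C x) c

    R-of : ∀ {x j} → F x ≡ V.res j → ∃[ k ] cls x ≡ R k
    R-of {x} {j} e = go (cls x) refl (subst (λ p → Of i p (cls x)) e (of x))
      where
      go : ∀ C → cls x ≡ C → Of i (V.res j) (cls x) → ∃[ k ] cls x ≡ R k
      go (R k)    c o = k , c
      go (hub _)  c o with subst (Of i (V.res j)) c o
      ... | ()
      go (anti _) c o with subst (Of i (V.res j)) c o
      ... | ()
      go X        c o with subst (Of i (V.res j)) c o
      ... | ()
      go Y        c o with subst (Of i (V.res j)) c o
      ... | ()

    near-idx : ∀ {x y k l} → cls x ≡ R k → cls y ≡ R l →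
               Near i (toℕ (idx x)) (toℕ (idx y)) → Near i (resid i (sᵥ x) k) (resid i (sᵥ y) l)
    near-idx cx cy = subst₂ (Near i) (toℕ-idx cx) (toℕ-idx cy)

    near-sym : ∀ {j m} → Near i j m → Near i m j
    near-sym (inj₁ p) = inj₂ p
    near-sym (inj₂ p) = inj₁ p

    near⇒adj : ∀ {x y k l} → cls x ≡ R k → cls y ≡ R l → Near i (toℕ (idx x)) (toℕ (idx y)) → Adj G x y
    near⇒adj {x} {y} {k} {l} cx cy nr with compare₃ k l
    ... | inj₁ refl        = ⊥-elim (near-same k (sᵥ< x) (sᵥ< y) (near-idx cx cy nr))
    ... | inj₂ (inj₁ refl) = <⇒adj (subst₂ Step (sym cx) (sym cy) step)
                               (subst₂ _<_ (sym (level-R cx)) (sym (level-R cy))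
                                 (near-next⁻ k (sᵥ< x) (sᵥ< y) (near-idx cx cy nr)))
    ... | inj₂ (inj₂ refl) = adj-sym G (<⇒adj (subst₂ Step (sym cy) (sym cx) step)
                               (subst₂ _<_ (sym (level-R cy)) (sym (level-R cx))
                                 (near-next⁻ l (sᵥ< y) (sᵥ< x) (near-idx cy cx (near-sym nr)))))

    edge⇒adj : ∀ {x y} → VegaEdge i (F x) (F y) → Adj G x y
    edge⇒adj {x} {y} e with edge⇒link (of x) (of y) e
    ... | inj₁ (fwd l) = link⇒ l
    ... | inj₁ (bwd l) = adj-sym G (link⇒ l)
    ... | inj₂ (j , m , ex , ey , γ) with R-of ex | R-of ey
    ... | k , cx | l , cy with trans (sym (F-R cx)) ex | trans (sym (F-R cy)) ey
    ... | refl | refl = near⇒adj cx cy (Γ⇒Near s₀ γ)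

    compat⇒edge : ∀ {x y} → Adj G x y → Compat (cls x) (cls y) → SymClosure (VegaEdge i) (F x) (F y)
    compat⇒edge {x} {y} e (link l) = link⇒edge (of x) (of y) l
    compat⇒edge {x} {y} e (step s) with labels s
    ... | k , cx , cy = subst₂ (SymClosure (VegaEdge i)) (sym (F-R cx)) (sym (F-R cy))
      (fwd (E.Γ (Near⇒Γ s₀ (subst₂ (Near i) (sym (toℕ-idx cx)) (sym (toℕ-idx cy))
        (near-next k (sᵥ< x) (sᵥ< y) (subst₂ _<_ (level-R cx) (level-R cy) (step⇒< e s)))))))

    adj⇒edge : ∀ {x y} → Adj G x y → SymClosure (VegaEdge i) (F x) (F y)
    adj⇒edge {x} {y} e with adj⇒ e
    ... | fwd p = compat⇒edge e p
    ... | bwd p = symmetric _ (compat⇒edge (adj-sym G e) p)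

    edge⇔ : ∀ {x y} → SymClosure (VegaEdge i) (F x) (F y) → Adj G x y
    edge⇔ (fwd e) = edge⇒adj e
    edge⇔ (bwd e) = adj-sym G (edge⇒adj e)

    -- The last level is 3 (i − 1) + toℕ₃ k₀, and 2 i − 1 is the residue of level 3 i − 2.
    ν-of : ℤ₃ → Fin 2
    ν-of 1₃ = zero
    ν-of _  = suc zero

    ν : Fin 2
    ν = ν-of k₀

    no-2i-1 : ν ≡ suc zero → ∀ x {k} → cls x ≡ R k → toℕ (idx x) ≢ 2 * i ∸ 1
    no-2i-1 eν x {k} c e =
        go k k₀ L≡ k₀≢2 eν (trans (sym (toℕ-idx c)) (trans e (2i∸1 s₀))) (subst (_≤ L) (level-R c) (≤L x))
      where
      go : ∀ k k₀ → L ≡ lev s₀ k₀ → k₀ ≢ 2₃ → ν-of k₀ ≡ suc zero → resid i (sᵥ x) k ≡ i + s₀ →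
          lev (sᵥ x) k ≤ L → ⊥
      go k  1₃ _ _ () _ _
      go k  2₃ _ ne _ _ _ = ne refl
      go 0₃ 0₃ _ _ _ r _ = <⇒≱ (sᵥ< x) (subst (i ≤_) (sym r) (m≤m+n i s₀))
      -- The residue `2 i - 1` belongs to level `3 s₀ + 1`, one above the last.
      go 1₃ 0₃ eL _ _ r le =
          <⇒≱ (≤-trans le (≤-reflexive eL))
            (*-monoʳ-≤ 3 (≤-reflexive (sym (+-cancelʳ-≡ i (sᵥ x) s₀ (trans r (+-comm i s₀))))))
      go 2₃ 0₃ _ _ _ r _ =
          <⇒≱ (n<1+n s₀)
            (≤-trans (m≤n+m i (sᵥ x)) (≤-reflexive (+-cancelʳ-≡ i (sᵥ x + i) s₀ (trans (+-assoc (sᵥ x) i i) (trans r (+-comm i s₀))))))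

    level-in : ∀ {s k} → s ≤ s₀ → (k ≡ 2₃ → s < s₀) → ¬ (ν ≡ suc zero × resid i s k ≡ 2 * i ∸ 1) →
        lev s k ≤ L
    level-in {s} {k} s≤ s<₂ nd = subst (lev s k ≤_) (sym L≡) (go k k₀ k₀≢2 s<₂ nd)
      where
      go : ∀ k k₀ → k₀ ≢ 2₃ → (k ≡ 2₃ → s < s₀) → ¬ (ν-of k₀ ≡ suc zero × resid i s k ≡ 2 * i ∸ 1) →
          lev s k ≤ lev s₀ k₀
      go k  2₃ ne _ _ = ⊥-elim (ne refl)
      go 0₃ 0₃ _ _ _ = *-monoʳ-≤ 3 s≤
      go 0₃ 1₃ _ _ _ = m≤n⇒m≤1+n (*-monoʳ-≤ 3 s≤)
      go 1₃ 1₃ _ _ _ = s≤s (*-monoʳ-≤ 3 s≤)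
      go 1₃ 0₃ _ _ nd with s ≟ s₀
      ... | yes refl = ⊥-elim (nd (refl , trans (+-comm s i) (sym (2i∸1 s))))
      ... | no ≢     =
          ≤-trans (m≤n+m (1 + 3 * s) 2) (subst (_≤ 3 * s₀) (*-suc 3 s) (*-monoʳ-≤ 3 (≤∧≢⇒< s≤ ≢)))
      go 2₃ 0₃ _ lt _ = ≤-trans (n≤1+n _) (subst (_≤ 3 * s₀) (*-suc 3 s) (*-monoʳ-≤ 3 (lt refl)))
      go 2₃ 1₃ _ lt _ =
          m≤n⇒m≤1+n (≤-trans (n≤1+n _) (subst (_≤ 3 * s₀) (*-suc 3 s) (*-monoʳ-≤ 3 (lt refl))))

    onto-res : ∀ j → ¬ (ν ≡ suc zero × toℕ j ≡ 2 * i ∸ 1) → ∃[ x ] F x ≡ V.res j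
    onto-res j nd with unresid (toℕ<n j)
    ... | s , k , ej , s≤ , s<₂ with at-level (level-in {s} {k} s≤ s<₂ λ (eν , e) → nd (eν , trans ej e))
    ... | x , l , c , lx with lev-injective {sᵥ x} {kᵥ x} {s} {k} (trans (sym (level≡ x)) lx)
    ... | es , ek = x , trans (F-R c) (cong V.res (toℕ-injective
          (trans (toℕ-fromℕ< _) (trans (cong₂ (resid i) es ek) (sym ej)))))

    μ : Dec (∃[ x ] cls x ≡ Y) → Fin 2
    μ (yes _) = zero
    μ (no _)  = suc zero

    alive : ∀ d x → ¬ Deleted i (μ d) ν (F x)
    alive d x del = go (cls x) refl del
      where
      go₂ : ∀ d {k} → cls x ≡ R k → ¬ Deleted i (μ d) ν (V.res (idx x))
      go₂ d c del = go₃ refl del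
        where
        go₃ : ∀ {ν′} → ν′ ≡ ν → ¬ Deleted i (μ d) ν′ (V.res (idx x))
        go₃ eν (Deleted.del-2i-1 e) = no-2i-1 (sym eν) x c e
      goY : ∀ d → cls x ≡ Y → ¬ Deleted i (μ d) ν V.y
      goY (yes _) c ()
      goY (no ¬y) c _ = ¬y (x , c)
      go : ∀ C → cls x ≡ C → ¬ Deleted i (μ d) ν (vtx C x)
      go (R k) c = go₂ d c
      go Y     c = goY d c
      go (hub 0₃)  _ ()
      go (hub 1₃)  _ ()
      go (hub 2₃)  _ ()
      go (anti 0₃) _ ()
      go (anti 1₃) _ ()
      go (anti 2₃) _ ()
      go X         _ ()

    at : ∀ {C} → (∃[ x ] cls x ≡ C) → ∃[ x ] F x ≡ vtx C x
    at (x , c) = x , cong (λ D → vtx D x) c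

    onto : ∀ d p → .(¬ Deleted i (μ d) ν p) → ∃[ x ] F x ≡ p
    onto d V.a _ = at (hubs 0₃)
    onto d V.b _ = at (hubs 1₃)
    onto d V.c _ = at (hubs 2₃)
    onto d V.u _ = at (antis 0₃)
    onto d V.v _ = at (antis 1₃)
    onto d V.w _ = at (antis 2₃)
    onto d V.x _ = at anX
    onto (yes p) V.y _ = at p
    onto (no _)  V.y nd = ⊥-elim-irr (nd Deleted.del-y)
    onto d (V.res j) nd =
        onto-res j λ (eν , e) → ⊥-elim-irr (nd (subst (λ t → Deleted i (μ d) t (V.res j)) (sym eν) (Deleted.del-2i-1 e)))

  blow-up : ∃[ i ] ∃[ μ ] ∃[ ν ] (2 ≤ i × G IsBlowUpOf Vega i μ ν)
  blow-up = i , μ d , ν , s≤s (lev-pos k₀ (subst (3 ≤_) L≡ 3≤L))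
    , (λ x → F x , Irrelevant.[ alive d x ])
    , (λ { (p , Irrelevant.[ nd ]) → let x , e = onto d p nd in x , ext e })
    , λ x y → mk⇔ adj⇒edge edge⇔
    where
    d : Dec (∃[ x ] cls x ≡ Y)
    d = any? (λ x → Y? (cls x))
    ext : ∀ {P : VegaVertex i → Set} {p q} .{u : P p} .{v : P q} → p ≡ q →
          _≡_ {A = Refinement (VegaVertex i) P} (p , Irrelevant.[ u ]) (q , Irrelevant.[ v ])
    ext refl = refl

-- Rotation of the labels and assembly

-- All relations between classes are invariant under this relabelling, which serves to give the
-- sources the label of the first interval.
rot : Class → Class
rot (hub k)  = hub (next k)
rot (anti k) = anti (next k)
rot (R k)    = R (next k)
rot X        = X
rot Y        = Y

rot-step : ∀ {C D} → Step C D → Step (rot C) (rot D)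
rot-step step = step

rot-step⁻ : ∀ {C D} → Step (rot C) (rot D) → Step C D
rot-step⁻ {C} {D} s with labels s
rot-step⁻ {R k} {R l} s | _ , refl , e =
    subst (λ m → Step (R k) (R m)) (sym (next-injective (R-injective e))) step

rot-compat : ∀ {C D} → Compat C D → Compat (rot C) (rot D)
rot-compat (link (hub-anti k≢l)) = link (hub-anti λ e → k≢l (next-injective e))
rot-compat (link hub-R)  = link hub-R
rot-compat (link anti-R) = link anti-R
rot-compat (link X-hub)  = link X-hub
rot-compat (link Y-anti) = link Y-anti
rot-compat (link X-Y)    = link X-Y
rot-compat (step s)      = step (rot-step s)

rot-link⁻ : ∀ C D → Link (rot C) (rot D) → Link C D
rot-link⁻ (hub k)  (anti l) (hub-anti k≢l) = hub-anti λ e → k≢l (cong next e)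
rot-link⁻ (hub k)  (R l) h = go refl h
  where
  go : ∀ {m} → m ≡ next l → Link (hub (next k)) (R m) → Link (hub k) (R l)
  go e hub-R = subst (λ m → Link (hub k) (R m)) (next-injective e) hub-R
rot-link⁻ (anti k) (R l) h = go refl h
  where
  go : ∀ {m} → m ≡ next l → Link (anti (next k)) (R m) → Link (anti k) (R l)
  go e anti-R = subst (λ m → Link (anti k) (R m)) (next-injective e) anti-R
rot-link⁻ X (hub _)  X-hub  = X-hub
rot-link⁻ Y (anti _) Y-anti = Y-anti
rot-link⁻ X Y X-Y = X-Y

rot-structured : ∀ {n} {G : Graph (Fin n)} {cls} → Structured G cls → Structured G (λ x → rot (cls x))
rot-structured {cls = cls} S = record
  { adj⇒  = λ e → gmap rot rot-compat (adj⇒ e)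
  ; link⇒ = λ l → link⇒ (rot-link⁻ _ _ l)
  ; hubs  =
      λ k → proj₁ (hubs (next (next k))) , trans (cong rot (proj₂ (hubs (next (next k))))) (cong hub (next³ k))
  ; antis =
      λ k → proj₁ (antis (next (next k))) , trans (cong rot (proj₂ (antis (next (next k))))) (cong anti (next³ k))
  ; anX   = proj₁ anX , cong rot (proj₂ anX)
  }
  where open Structured S

module Assemble {n} (G : Graph (Fin n)) (_~?_ : Decidable (Adj G))
  (triangle-free : ∀ {x y z} → Adj G x y → Adj G y z → Adj G z x → ⊥)
  (common : ∀ {x y} → ¬ Adj G x y → ∃[ z ] (Adj G x z × Adj G z y))
  (𝒟₂ : (xs : Vec (Fin n) 6) → ∃[ y ] 3 ≤ count (λ x → x ~? y) xs) where

  Arrow : (Fin n → Class) → Fin n → Fin n → Set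
  Arrow cls x y = Adj G x y × Step (cls x) (cls y)

  -- Three consecutive arrows force the last level to be at least 3, which excludes `i = 1`.
  Chain : (Fin n → Class) → Set
  Chain cls = ∃[ p ] ∃[ q ] ∃[ r ] ∃[ s ] (Arrow cls p q × Arrow cls q r × Arrow cls r s)

  Source : (Fin n → Class) → ℤ₃ → Set
  Source cls k = ∃[ x ] (cls x ≡ R k × (∀ y → ¬ Arrow cls y x))

  rot-arrow : ∀ {cls x y} → Arrow cls x y → Arrow (λ z → rot (cls z)) x y
  rot-arrow (e , s) = e , rot-step s

  rot-chain : ∀ {cls} → Chain cls → Chain (λ z → rot (cls z))
  rot-chain {cls} (p , q , r , s , pq , qr , rs) =
      p , q , r , s , rot-arrow {cls} pq , rot-arrow {cls} qr , rot-arrow {cls} rs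

  rot-source : ∀ {cls k} → Source cls k → Source (λ z → rot (cls z)) (next k)
  rot-source (x , c , src) = x , cong rot c , λ y (e , s) → src y (e , rot-step⁻ s)

  source-exists : ∀ {cls} → Structured G cls → Chain cls → ∃[ k ] Source cls k
  source-exists {cls} S (p , q , _ , _ , pq , _)
    with attained-R q (≤-trans (s≤s z≤n) (⟶⇒< pq)) z≤n
    where open Order G _~?_ triangle-free common 𝒟₂ cls S
  ... | x , k , cx , lx = k , x , cx , λ _ → source lx
    where open Order G _~?_ triangle-free common 𝒟₂ cls S

  rooted-blow-up : ∀ {cls} → Structured G cls → Chain cls → Source cls 0₃ →
                   ∃[ i ] ∃[ μ ] ∃[ ν ] (2 ≤ i × G IsBlowUpOf Vega i μ ν)
  rooted-blow-up {cls} S (_ , _ , _ , t , pq , qr , rt) (x , cx , src) =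
    Embed.blow-up G cls S level (λ e s → ⟶⇒< (e , s)) (λ s lt → proj₁ (<⇒⟶ s lt)) (label-level root refl)
      L (proj₁ (split₃ L)) (proj₁ (proj₂ (split₃ L))) (proj₂ (proj₂ (split₃ L))) k₀≢2 3≤L ≤L at-level
    where
    open Order G _~?_ triangle-free common 𝒟₂ cls S
    L : ℕ
    L = level (proj₁ top)
    ≤L : ∀ y → level y ≤ L
    ≤L = proj₂ top
    3≤L : 3 ≤ L
    3≤L = ≤-trans (level-max (((start ▻ pq) ▻ qr) ▻ rt)) (≤L t)
    level-x : level x ≡ 0
    level-x with level x in e
    ... | zero  = refl
    ... | suc _ = ⊥-elim (src _ (proj₁ (proj₂ (level-pred e))))
    root : Rooted
    root c e = sources-agree c cx e level-x
    at-level : ∀ {m} → m ≤ L → ∃[ y ] ∃[ k ] (cls y ≡ R k × level y ≡ m)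
    at-level = attained-R (proj₁ top) (≤-trans (s≤s z≤n) 3≤L)
    k₀≢2 : proj₁ (proj₂ (split₃ L)) ≢ 2₃
    k₀≢2 e with at-level {L} ≤-refl
    ... | q , l , cq , lq = top-label cx (λ {y} → src y) last (trans cq (cong R l≡))
      where
      last : ∀ {y} → ¬ q ⟶ y
      last {y} qy = <⇒≱ (⟶⇒< qy) (≤-trans (≤L y) (≤-reflexive (sym lq)))
      l≡ : l ≡ 2₃
      l≡ =
          trans (label-level root lq cq)
            (trans (cong lab (proj₂ (proj₂ (split₃ L)))) (trans (lab-lev (proj₁ (split₃ L)) _) e))

  structured⇒blow-up : ∀ {cls} → Structured G cls → Chain cls →
                       ∃[ i ] ∃[ μ ] ∃[ ν ] (2 ≤ i × G IsBlowUpOf Vega i μ ν)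
  structured⇒blow-up {cls} S ch with source-exists S ch
  ... | 0₃ , src = rooted-blow-up S ch src
  ... | 1₃ , src =
      rooted-blow-up (rot-structured (rot-structured S)) (rot-chain {λ x → rot (cls x)} (rot-chain {cls} ch)) (rot-source {λ x → rot (cls x)} (rot-source {cls} src))
  ... | 2₃ , src = rooted-blow-up (rot-structured S) (rot-chain {cls} ch) (rot-source {cls} src)

-- Refutation trees and their checker

data Fact : Set where
  ？ ＋ － : Fact

-- A state lists, for each vertex of a configuration (newest first), what is
-- known about its adjacency to the older ones; vertices are de Bruijn indices.
Row State : Set
Row   = List Fact
State = List Row

nthF : Row → ℕ → Fact
nthF []      _       = ？
nthF (f ∷ _) zero    = f
nthF (_ ∷ r) (suc j) = nthF r j

fact : State → ℕ → ℕ → Fact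
fact []      _       _       = ？
fact (_ ∷ _) zero    zero    = －
fact (r ∷ _) zero    (suc j) = nthF r j
fact (r ∷ _) (suc i) zero    = nthF r i
fact (_ ∷ s) (suc i) (suc j) = fact s i j

upd : Row → ℕ → Fact → Row
upd []      zero    f = f ∷ []
upd []      (suc j) f = ？ ∷ upd [] j f
upd (_ ∷ r) zero    f = f ∷ r
upd (g ∷ r) (suc j) f = g ∷ upd r j f

set : State → ℕ → ℕ → Fact → State
set []      _       _       _ = []
set (r ∷ s) zero    zero    _ = r ∷ s
set (r ∷ s) zero    (suc j) f = upd r j f ∷ s
set (r ∷ s) (suc i) zero    f = upd r i f ∷ s
set (r ∷ s) (suc i) (suc j) f = r ∷ set s i j f

is＋ is－ : Fact → Bool
is＋ ＋ = true
is＋ _  = false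
is－ － = true
is－ _  = false

common? : State → ℕ → ℕ → ℕ → Bool
common? s i j zero    = false
common? s i j (suc r) = (is＋ (fact s i r) ∧ is＋ (fact s j r)) ∨ common? s i j r

adj? non? : State → ℕ → ℕ → Bool
adj? s i j = is＋ (fact s i j)
non? s i j = is－ (fact s i j) ∨ common? s i j (length s)

holds : State → Fact → ℕ → ℕ → Bool
holds s ？ i j = true
holds s ＋ i j = adj? s i j
holds s － i j = non? s i j

refutes : State → Fact → ℕ → ℕ → Bool
refutes s ？ i j = false
refutes s ＋ i j = non? s i j
refutes s － i j = adj? s i j

holdsRow : State → Row → ℕ → List ℕ → Bool
holdsRow s []      p qs       = true
holdsRow s (f ∷ r) p []       = false
holdsRow s (f ∷ r) p (q ∷ qs) = holds s f p q ∧ holdsRow s r p qs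

-- The configuration l occurs in s at the given vertices.
occurs : State → State → List ℕ → Bool
occurs s []      []       = true
occurs s []      (_ ∷ _)  = false
occurs s (_ ∷ _) []       = false
occurs s (r ∷ l) (p ∷ ps) = holdsRow s r p ps ∧ occurs s l ps

refutesRow : State → Row → ℕ → List ℕ → Bool
refutesRow s (f ∷ r) p (q ∷ qs) = refutes s f p q ∨ refutesRow s r p qs
refutesRow s _       p _        = false

-- Refutations of states: a case distinction on an edge; a common neighbour of two
-- non-adjacent vertices; a vertex joined to more than weight m of a total weight 3m,
-- with a case for each possible set of neighbours; a vertex without a possible
-- neighbourhood in a copy of Υ; an instance of a known refutation. The last two
-- are given the copy of Υ as a function of the number of vertices.
data Tree : Set where
  split  : ℕ → ℕ → Tree → Tree → Tree
  common : ℕ → ℕ → Tree → Tree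
  dense  : ℕ → List (ℕ × ℕ) → List (List ℕ × Tree) → Tree
  type   : (ℕ → List ℕ) → ℕ → Tree
  use    : ℕ → ℕ → ℕ → (ℕ → List ℕ) → Tree
  done   : Tree

subset : List ℕ → List ℕ → Bool
subset xs ys = all (λ x → any (x ≡ᵇ_) ys) xs

weight : List (ℕ × ℕ) → ℕ
weight []             = 0
weight ((_ , k) ∷ ws) = k + weight ws

-- Every independent set of weight more than m contains one of rs; acc is the part
-- chosen so far, of weight k.
covers : State → ℕ → List (List ℕ) → List ℕ → ℕ → List (ℕ × ℕ) → Bool
covers s m rs acc k []             = any (λ r → subset r acc) rs ∨ (k ≤ᵇ m)
covers s m rs acc k ((v , w) ∷ ws) =
  any (λ r → subset r acc) rs ∨ (k + (w + weight ws) ≤ᵇ m) ∨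
  ((any (adj? s v) acc ∨ covers s m rs (v ∷ acc) (k + w) ws) ∧ covers s m rs acc k ws)

nth : List State → ℕ → State
nth []      _       = []
nth (s ∷ _) zero    = s
nth (_ ∷ l) (suc k) = nth l k

module _ (Υs : State) (Ts : List Row) (known : List State) where
  check    : State → Tree → Bool
  checkNew : State → List ℕ → Tree → Bool
  checkAll : State → List (List ℕ × Tree) → Bool

  check s (split i j t₁ t₂) =
    (non? s i j ∨ check (set s i j ＋) t₁) ∧ (adj? s i j ∨ check (set s i j －) t₂)
  check s (common i j t) = non? s i j ∧ checkNew ([] ∷ s) (suc i ∷ suc j ∷ []) t
  check s (dense m ws kids) =
    (1 ≤ᵇ m) ∧ (m ≤ᵇ 4) ∧ (weight ws ≡ᵇ 3 * m) ∧ covers s m (map proj₁ kids) [] 0 ws ∧ checkAll s kids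
  check s (type e z) = occurs s Υs (e (length s)) ∧ all (λ τ → refutesRow s τ z (e (length s))) Ts
  check s (use k i j e) = (k <ᵇ length known) ∧ occurs s (nth known k) (i ∷ j ∷ e (length s))
  check s done = false

  checkNew s []       t = check s t
  -- The edges at the new vertex 0 are entered one by one, and the state is refuted as soon as an
  -- edge contradicts the facts entered so far.
  checkNew s (r ∷ rs) t = non? s 0 r ∨ checkNew (set s 0 r ＋) rs t

  checkAll s []               = true
  checkAll s ((r , t) ∷ kids) = checkNew ([] ∷ s) (map suc r) t ∧ checkAll s kids

-- Soundness of the checker

nthF-upd : ∀ r j f k → (k ≡ j × nthF (upd r j f) k ≡ f) ⊎ nthF (upd r j f) k ≡ nthF r k
nthF-upd []      zero    f zero    = inj₁ (refl , refl)
nthF-upd []      zero    f (suc k) = inj₂ refl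
nthF-upd []      (suc j) f zero    = inj₂ refl
nthF-upd []      (suc j) f (suc k) with nthF-upd [] j f k
... | inj₁ (refl , e) = inj₁ (refl , e)
... | inj₂ e          = inj₂ e
nthF-upd (_ ∷ r) zero    f zero    = inj₁ (refl , refl)
nthF-upd (_ ∷ r) zero    f (suc k) = inj₂ refl
nthF-upd (_ ∷ r) (suc j) f zero    = inj₂ refl
nthF-upd (_ ∷ r) (suc j) f (suc k) with nthF-upd r j f k
... | inj₁ (refl , e) = inj₁ (refl , e)
... | inj₂ e          = inj₂ e

∧-true : ∀ {x y} → x ∧ y ≡ true → x ≡ true × y ≡ true
∧-true {true} e = refl , e

∨-true : ∀ {x y} → x ∨ y ≡ true → x ≡ true ⊎ y ≡ true
∨-true {true}  e = inj₁ refl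
∨-true {false} e = inj₂ e

≤ᵇ-true : ∀ {m n} → (m ≤ᵇ n) ≡ true → m ≤ n
≤ᵇ-true {m} {n} e = ≤ᵇ⇒≤ m n (subst T (sym e) tt)

≡ᵇ-true : ∀ {m n} → (m ≡ᵇ n) ≡ true → m ≡ n
≡ᵇ-true {m} {n} e = ≡ᵇ⇒≡ m n (subst T (sym e) tt)

module Soundness {V : Set} (_~_ : V → V → Set) (_~?_ : Decidable _~_)
  (~sym : ∀ {x y} → x ~ y → y ~ x)
  (triangle-free : ∀ {x y z} → x ~ y → y ~ z → z ~ x → ⊥)
  (commonN : ∀ {x y} → ¬ x ~ y → ∃[ z ] (x ~ z × z ~ y)) (v₀ : V)
  where

  wsum : V → List (V × ℕ) → ℕ
  wsum y []             = 0
  wsum y ((v , k) ∷ ws) = (if does (v ~? y) then k else 0) + wsum y ws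

  -- Every index out of range denotes `v₀`, consistently in all lookups, so a recorded fact always
  -- speaks about definite vertices.
  ver : List V → ℕ → V
  ver []       _       = v₀
  ver (v ∷ _)  zero    = v
  ver (_ ∷ vs) (suc i) = ver vs i

  Holds : Fact → V → V → Set
  Holds ？ x y = ⊤
  Holds ＋ x y = x ~ y
  Holds － x y = ¬ x ~ y

  RowOK : V → Row → List V → Set
  RowOK v r vs = ∀ j → Holds (nthF r j) v (ver vs j)

  data OK : State → List V → Set where
    []  : OK [] []
    _∷_ : ∀ {r s v vs} → RowOK v r vs → OK s vs → OK (r ∷ s) (v ∷ vs)

  ~irrefl : ∀ {x} → ¬ x ~ x
  ~irrefl e = triangle-free e e e

  Holds-sym : ∀ f {x y} → Holds f x y → Holds f y x
  Holds-sym ？ _ = tt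
  Holds-sym ＋ e = ~sym e
  Holds-sym － n = λ e → n (~sym e)

  fact-ok : ∀ {s vs} → OK s vs → ∀ i j → Holds (fact s i j) (ver vs i) (ver vs j)
  fact-ok []       i j = tt
  fact-ok (_ ∷ _) zero zero = ~irrefl
  fact-ok (r ∷ _) zero (suc j) = r j
  fact-ok (_∷_ {r = r} p _) (suc i) zero = Holds-sym (nthF r i) (p i)
  fact-ok (_ ∷ s) (suc i) (suc j) = fact-ok s i j

  upd-ok : ∀ {v vs f} r j → RowOK v r vs → Holds f v (ver vs j) → RowOK v (upd r j f) vs
  upd-ok {v} {vs} {f} r j ok h k with nthF-upd r j f k
  ... | inj₁ (refl , e) = subst (λ g → Holds g v (ver vs k)) (sym e) h
  ... | inj₂ e          = subst (λ g → Holds g v (ver vs k)) (sym e) (ok k)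

  set-ok : ∀ {s vs f} i j → OK s vs → Holds f (ver vs i) (ver vs j) → OK (set s i j f) vs
  set-ok i j [] h = []
  set-ok zero zero (p ∷ o) h = p ∷ o
  set-ok zero (suc j) (_∷_ {r = r} {vs = vs} p o) h = upd-ok {vs = vs} r j p h ∷ o
  set-ok {f = f} (suc i) zero (_∷_ {r = r} {vs = vs} p o) h = upd-ok {vs = vs} r i p (Holds-sym f h) ∷ o
  set-ok (suc i) (suc j) (p ∷ o) h = p ∷ set-ok i j o h

  is＋-holds : ∀ f {x y} → is＋ f ≡ true → Holds f x y → x ~ y
  is＋-holds ＋ _ h = h

  is－-holds : ∀ f {x y} → is－ f ≡ true → Holds f x y → ¬ x ~ y
  is－-holds － _ h = h

  adj?-sound : ∀ {s vs} i j → OK s vs → adj? s i j ≡ true → ver vs i ~ ver vs j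
  adj?-sound {s} i j o e = is＋-holds (fact s i j) e (fact-ok o i j)

  common?-sound : ∀ {s vs} i j n → OK s vs → common? s i j n ≡ true → ¬ ver vs i ~ ver vs j
  common?-sound {s} i j (suc r) o e with ∨-true {is＋ (fact s i r) ∧ is＋ (fact s j r)} e
  ... | inj₂ e₂ = common?-sound i j r o e₂
  ... | inj₁ e₁ with ∧-true e₁
  ... | p , q = λ ij → triangle-free ij (adj?-sound j r o q) (~sym (adj?-sound i r o p))

  non?-sound : ∀ {s vs} i j → OK s vs → non? s i j ≡ true → ¬ ver vs i ~ ver vs j
  non?-sound {s} i j o e with ∨-true {is－ (fact s i j)} e
  ... | inj₁ e₁ = is－-holds (fact s i j) e₁ (fact-ok o i j)
  ... | inj₂ e₂ = common?-sound i j (length s) o e₂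

  holds-sound : ∀ {s vs} f i j → OK s vs → holds s f i j ≡ true → Holds f (ver vs i) (ver vs j)
  holds-sound ？ i j o e = tt
  holds-sound ＋ i j o e = adj?-sound i j o e
  holds-sound － i j o e = non?-sound i j o e

  refutes-sound : ∀ {s vs} f i j → OK s vs → refutes s f i j ≡ true → ¬ Holds f (ver vs i) (ver vs j)
  refutes-sound ＋ i j o e = non?-sound i j o e
  refutes-sound － i j o e = λ n → n (adj?-sound i j o e)

  vers : List V → List ℕ → List V
  vers vs = map (ver vs)

  holdsRow-sound : ∀ {s vs} r p qs → OK s vs → holdsRow s r p qs ≡ true → RowOK (ver vs p) r (vers vs qs)
  holdsRow-sound []      p qs o e j = tt
  holdsRow-sound {s} (f ∷ r) p (q ∷ qs) o e zero = holds-sound f p q o (proj₁ (∧-true {holds s f p q} e))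
  holdsRow-sound {s} (f ∷ r) p (q ∷ qs) o e (suc j) =
      holdsRow-sound r p qs o (proj₂ (∧-true {holds s f p q} e)) j

  occurs-sound : ∀ {s vs} l ps → OK s vs → occurs s l ps ≡ true → OK l (vers vs ps)
  occurs-sound []      []       o e = []
  occurs-sound {s} (r ∷ l) (p ∷ ps) o e with ∧-true {holdsRow s r p ps} e
  ... | e₁ , e₂ = holdsRow-sound r p ps o e₁ ∷ occurs-sound l ps o e₂

  refutesRow-sound : ∀ {s vs} r p qs → OK s vs → refutesRow s r p qs ≡ true →
      ¬ RowOK (ver vs p) r (vers vs qs)
  refutesRow-sound {s} (f ∷ r) p (q ∷ qs) o e ok with ∨-true {refutes s f p q} e
  ... | inj₁ e₁ = refutes-sound f p q o e₁ (ok 0)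
  ... | inj₂ e₂ = refutesRow-sound r p qs o e₂ (λ j → ok (suc j))

  Refuted : State → Set
  Refuted s = ∀ {vs} → ¬ OK s vs

  TypeThm : State → List Row → Set
  TypeThm Υs Ts = ∀ {vs} z → OK Υs vs → Any (λ τ → RowOK z τ vs) Ts

  Joined : List V → V → List ℕ → Set
  Joined vs z = All (λ i → z ~ ver vs i)

  subset-sound : ∀ {vs z} r acc → subset r acc ≡ true → Joined vs z acc → Joined vs z r
  subset-sound []      acc e js = []
  subset-sound {vs} {z} (i ∷ r) acc e js with ∧-true {any (i ≡ᵇ_) acc} e
  ... | e₁ , e₂ = find acc e₁ js ∷ subset-sound {vs} r acc e₂ js
    where
    find : ∀ acc → any (i ≡ᵇ_) acc ≡ true → Joined vs z acc → z ~ ver vs i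
    find (j ∷ acc) e (p ∷ js) with ∨-true {i ≡ᵇ j} e
    ... | inj₁ i≡j = subst (λ k → z ~ ver vs k) (sym (≡ᵇ-true {i} {j} i≡j)) p
    ... | inj₂ e′  = find acc e′ js

  any-subset-sound : ∀ {vs z} rs acc → any (λ r → subset r acc) rs ≡ true → Joined vs z acc → Any (Joined vs z) rs
  any-subset-sound {vs} (r ∷ rs) acc e js with ∨-true {subset r acc} e
  ... | inj₁ e₁ = here (subset-sound {vs} r acc e₁ js)
  ... | inj₂ e₂ = there (any-subset-sound {vs} rs acc e₂ js)

  weighted : List V → List (ℕ × ℕ) → List (V × ℕ)
  weighted vs = map (λ p → ver vs (proj₁ p) , proj₂ p)

  wsum≤weight : ∀ z vs ws → wsum z (weighted vs ws) ≤ weight ws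
  wsum≤weight z vs [] = z≤n
  wsum≤weight z vs ((i , k) ∷ ws) with ver vs i ~? z
  ... | yes _ = +-monoʳ-≤ k (wsum≤weight z vs ws)
  ... | no _  = ≤-trans (wsum≤weight z vs ws) (m≤n+m _ k)

  disjoint : ∀ {s vs z} v acc → OK s vs → any (adj? s v) acc ≡ true → Joined vs z acc → ¬ ver vs v ~ z
  disjoint {s} v (a ∷ acc) o e (p ∷ js) with ∨-true {adj? s v a} e
  ... | inj₁ e₁ = λ q → triangle-free (adj?-sound v a o e₁) (~sym p) (~sym q)
  ... | inj₂ e₂ = disjoint v acc o e₂ js

  -- Of the branches of the search, follow the one prescribed by the true neighbourhood of `z`, with
  -- `acc` the neighbours met so far. It cannot be cut off: the weight still in reach exceeds `m`,
  -- and a vertex adjacent to a member of `acc` would close a triangle with `z`.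
  covers-sound : ∀ {s vs z m} rs acc k ws → OK s vs → covers s m rs acc k ws ≡ true →
                 Joined vs z acc → m < k + wsum z (weighted vs ws) → Any (Joined vs z) rs
  covers-sound {vs = vs} {m = m} rs acc k [] o e js lt with ∨-true {any (λ r → subset r acc) rs} e
  ... | inj₁ e₁ = any-subset-sound {vs} rs acc e₁ js
  ... | inj₂ e₂ = ⊥-elim (<⇒≱ lt (≤-trans (≤-reflexive (+-identityʳ k)) (≤ᵇ-true {k} {m} e₂)))
  covers-sound {s} {vs} {z} {m} rs acc k ((v , w) ∷ ws) o e js lt
    with ∨-true {any (λ r → subset r acc) rs} e
  ... | inj₁ e₁ = any-subset-sound {vs} rs acc e₁ js
  ... | inj₂ e₂ with ∨-true {k + (w + weight ws) ≤ᵇ m} e₂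
  ...   | inj₁ e₃ =
      ⊥-elim
        (<⇒≱ lt (≤-trans (+-monoʳ-≤ k (wsum≤weight z vs ((v , w) ∷ ws))) (≤ᵇ-true {k + (w + weight ws)} {m} e₃)))
  ...   | inj₂ e₃ with ∧-true {any (adj? s v) acc ∨ covers s m rs (v ∷ acc) (k + w) ws} e₃
  ...     | e₄ , e₅ with ver vs v ~? z
  ...       | no _  = covers-sound rs acc k ws o e₅ js lt
  ...       | yes p with ∨-true {any (adj? s v) acc} e₄
  ...         | inj₁ e₆ = ⊥-elim (disjoint v acc o e₆ js p)
  ...         | inj₂ e₆ =
      covers-sound rs (v ∷ acc) (k + w) ws o e₆ (~sym p ∷ js) (subst (m <_) (sym (+-assoc k w _)) lt)

  -- The sequences of length `3 m`, with repeated vertices recorded as multiplicities.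
  DenseThm : Set
  DenseThm = ∀ m → 1 ≤ m → m ≤ 4 → (ws : List (V × ℕ)) → sum (map proj₂ ws) ≡ 3 * m → ∃[ y ] m < wsum y ws

  module _ (dense-thm : DenseThm)
    {Υs Ts known} (types : TypeThm Υs Ts) (refuted : All Refuted known) where

    weighted-sum : ∀ vs ws → sum (map proj₂ (weighted vs ws)) ≡ weight ws
    weighted-sum vs []             = refl
    weighted-sum vs ((_ , k) ∷ ws) = cong (k +_) (weighted-sum vs ws)

    nth-refuted : ∀ k (ls : List State) → All Refuted ls → (k <ᵇ length ls) ≡ true → Refuted (nth ls k)
    nth-refuted zero    (_ ∷ _)  (r ∷ _)  e = r
    nth-refuted (suc k) (_ ∷ ls) (_ ∷ rs) e = nth-refuted k ls rs e

    all-refuted : ∀ {s vs} e z (τs : List Row) → OK s vs → all (λ τ → refutesRow s τ z e) τs ≡ true →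
                  ¬ Any (λ τ → RowOK (ver vs z) τ (vers vs e)) τs
    all-refuted {s} e z (τ ∷ τs) o eq (here ok) =
        refutesRow-sound τ z e o (proj₁ (∧-true {refutesRow s τ z e} eq)) ok
    all-refuted {s} e z (τ ∷ τs) o eq (there a) =
        all-refuted e z τs o (proj₂ (∧-true {refutesRow s τ z e} eq)) a

    sound    : ∀ {s} t → check Υs Ts known s t ≡ true → Refuted s
    soundNew : ∀ {s vs} rs t → checkNew Υs Ts known s rs t ≡ true → OK s vs → ¬ All (λ i → ver vs 0 ~ ver vs i) rs
    soundAll : ∀ {s vs z} kids → checkAll Υs Ts known s kids ≡ true → OK s vs →
        ¬ Any (Joined vs z) (map proj₁ kids)

    sound {s} (split i j t₁ t₂) e {vs} o with ∧-true {non? s i j ∨ check Υs Ts known (set s i j ＋) t₁} e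
    ... | e₁ , e₂ with ver vs i ~? ver vs j
    ...   | yes p with ∨-true {non? s i j} e₁
    ...     | inj₁ n = non?-sound i j o n p
    ...     | inj₂ c = sound t₁ c (set-ok i j o p)
    sound {s} (split i j t₁ t₂) e {vs} o | e₁ , e₂ | no ¬p with ∨-true {adj? s i j} e₂
    ...     | inj₁ a = ¬p (adj?-sound i j o a)
    ...     | inj₂ c = sound t₂ c (set-ok i j o ¬p)
    sound {s} (common i j t) e {vs} o with ∧-true {non? s i j} e
    ... | e₁ , e₂ with commonN (non?-sound i j o e₁)
    ... | z , iz , zj = soundNew {[] ∷ s} (suc i ∷ suc j ∷ []) t e₂ ((λ _ → tt) ∷ o) (~sym iz ∷ zj ∷ [])
    sound {s} (dense m ws kids) e {vs} o with ∧-true {1 ≤ᵇ m} e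
    ... | e₁ , e with ∧-true {m ≤ᵇ 4} e
    ... | e₂ , e with ∧-true {weight ws ≡ᵇ 3 * m} e
    ... | e₃ , e with ∧-true {covers s m (map proj₁ kids) [] 0 ws} e
    ... | e₄ , e₅ with dense-thm m (≤ᵇ-true {1} e₁) (≤ᵇ-true {m} e₂) (weighted vs ws) (trans (weighted-sum vs ws) (≡ᵇ-true {weight ws} e₃))
    ... | z , lt = soundAll kids e₅ o (covers-sound (map proj₁ kids) [] 0 ws o e₄ [] lt)
    sound {s} (type em z) e {vs} o with ∧-true {occurs s Υs (em (length s))} e
    ... | e₁ , e₂ =
        all-refuted (em (length s)) z Ts o e₂ (types (ver vs z) (occurs-sound Υs (em (length s)) o e₁))
    sound {s} (use k i j em) e o with ∧-true {k <ᵇ length known} e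
    ... | e₁ , e₂ = nth-refuted k known refuted e₁ (occurs-sound (nth known k) (i ∷ j ∷ em (length s)) o e₂)

    soundNew []       t e o _        = sound t e o
    soundNew {s} (r ∷ rs) t e o (p ∷ ps) with ∨-true {non? s 0 r} e
    ... | inj₁ n = non?-sound 0 r o n p
    ... | inj₂ c = soundNew rs t c (set-ok 0 r o p) ps

    soundAll {s} {vs} {z} ((r , t) ∷ kids) e o a with ∧-true {checkNew Υs Ts known ([] ∷ s) (map suc r) t} e
    soundAll {s} {vs} {z} ((r , t) ∷ kids) e o (here js)  | e₁ , _ =
      soundNew {vs = z ∷ vs} (map suc r) t e₁ ((λ _ → tt) ∷ o) (map⁺ js)
    soundAll ((r , t) ∷ kids) e o (there a) | _ , e₂ = soundAll kids e₂ o a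

-- The graph Υ, its automorphisms and the certificate

-- The vertices of Υ, in the order in which they are added to Υs.
α β : ℕ → ℕ
α j = j
β j = 5 + j

γ : ℕ
γ = 10

joinedTo : List ℕ → ℕ → Fact
joinedTo ls ℓ = if any (ℓ ≡ᵇ_) ls then ＋ else ？

-- Newest first, these are c, b₄, ..., b₀, a₄, ..., a₀. Only edges are recorded, as the copy is not
-- assumed to be induced. Its non-edges are found by `non?`: any two non-adjacent vertices of Υ have
-- a common neighbour in Υ.
Υs : State
Υs = map (joinedTo (α 0 ∷ α 1 ∷ α 2 ∷ α 3 ∷ α 4 ∷ [])) (downFrom 10)
   ∷ map (joinedTo (α 1 ∷ α 2 ∷ β 1 ∷ β 2 ∷ [])) (downFrom 9)
   ∷ map (joinedTo (α 0 ∷ α 1 ∷ β 0 ∷ β 1 ∷ [])) (downFrom 8)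
   ∷ map (joinedTo (α 4 ∷ α 0 ∷ β 0 ∷ [])) (downFrom 7)
   ∷ map (joinedTo (α 3 ∷ α 4 ∷ [])) (downFrom 6)
   ∷ map (joinedTo (α 2 ∷ α 3 ∷ [])) (downFrom 5)
   ∷ [] ∷ [] ∷ [] ∷ [] ∷ [] ∷ []

row : List ℕ → Row
row ls = map (λ ℓ → if any (ℓ ≡ᵇ_) ls then ＋ else －) (downFrom 11)

-- The rotations j ↦ j + r, then the reflections j ↦ r - j, with 4 standing for -1 modulo 5. As r
-- descends from 4, the identity is number 4.
dihedral : List (List ℕ)
dihedral = map (λ r → image (λ j → (j + r) % 5)) (downFrom 5)
        ++ map (λ r → image (λ j → (4 * j + r) % 5)) (downFrom 5)
  where
  image : (ℕ → ℕ) → List ℕ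
  image f = γ ∷ map (λ j → β (f j)) (downFrom 5) ++ map (λ j → α (f j)) (downFrom 5)

nthL : List (List ℕ) → ℕ → List ℕ
nthL []      _       = []
nthL (x ∷ _) zero    = x
nthL (_ ∷ l) (suc k) = nthL l k

-- The image of Υ under the p-th automorphism, in a configuration of n vertices.
at : ℕ → ℕ → List ℕ
at p n = map (λ ℓ → n ∸ suc ℓ) (nthL dihedral p)

std : ℕ → List ℕ
std = at 4

-- A vertex joined to all neighbours that some vertex has in the copy can take its place. This
-- produces another copy of Υ, to which everything established about neighbourhoods applies again.
_[_↦_] : (ℕ → List ℕ) → ℕ → ℕ → ℕ → List ℕ
(e [ i ↦ j ]) n = map (λ k → if k ≡ᵇ i then j else k) (e n)

infixr 6 _each_
_each_ : ℕ → List ℕ → List (ℕ × ℕ)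
w each vs = map (λ v → v , w) vs

data Item : Set where
  bad  : List ℕ → Tree → Item
  pair : List ℕ → List ℕ → Fact → Tree → Item

-- In the trees for this state, 0 is the vertex with row `τ`, 1 is c, 2 to 6 are b₄ to b₀, and 7 to
-- 11 are a₄ to a₀. Each further vertex shifts these numbers by one.
one-state : Row → State
one-state τ = τ ∷ Υs

Pair : Set
Pair = Row × Row × Fact

-- The vertex with the second row is 0, the one with the first row is 1, and Υ starts at 2.
-- Accordingly `use k i j` takes `i` for the second row and `j` for the first.
pair-state : Pair → State
pair-state (σ , τ , f) = (f ∷ τ) ∷ σ ∷ Υs

-- Unknown facts are not even equal to themselves, so only completely determined rows are ever
-- identified.
_==_ : Fact → Fact → Bool
＋ == ＋ = true
－ == － = true
_  == _  = false

sameRow : Row → Row → Bool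
sameRow []      []      = true
sameRow (f ∷ r) (g ∷ s) = f == g ∧ sameRow r s
sameRow _       _       = false

along : List ℕ → Row → Row
along e σ = map (nthF σ) e

automorphisms : List (List ℕ)
automorphisms = map (λ p → at p 11) (downFrom 10)

-- Reflections would add nothing to the choice of a labelling: the reflection j ↦ -j fixes a₀ and
-- maps `table` to itself, with the labels `1₃` and `2₃` exchanged. Only the choice of the vertex
-- that plays x matters.
rotations : List (List ℕ)
rotations = map (λ p → at p 11) (0 ∷ 1 ∷ 2 ∷ 3 ∷ 4 ∷ [])

similar : List (List ℕ) → Row → Row → Bool
similar Es τ σ = any (λ e → sameRow (along e σ) τ) Es

typesAfter : List (List ℕ) → List Row → List Item → List Row
typesAfter Es Ts []                  = Ts
typesAfter Es Ts (bad ls _ ∷ is)     = typesAfter Es (filterᵇ (λ σ → not (similar Es (row ls) σ)) Ts) is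
typesAfter Es Ts (pair _ _ _ _ ∷ is) = typesAfter Es Ts is

knownAfter : List Pair → List Item → List Pair
knownAfter Kn []                    = Kn
knownAfter Kn (bad _ _ ∷ is)        = knownAfter Kn is
knownAfter Kn (pair ls ms f _ ∷ is) = knownAfter ((row ls , row ms , f) ∷ Kn) is

-- The order of the items matters. A `bad` item removes a row, with its images under the
-- automorphisms, from those that `type` has to refute; a `pair` becomes available to `use`, the
-- most recent one under number 0. Both take effect for the later items only.
verify : List (List ℕ) → List Row → List Pair → List Item → Bool
verify Es Ts Kn []                    = true
verify Es Ts Kn (bad ls t ∷ is)       =
  check Υs Ts (map pair-state Kn) (one-state (row ls)) t ∧ verify Es (filterᵇ (λ σ → not (similar Es (row ls) σ)) Ts) Kn is
verify Es Ts Kn (pair ls ms f t ∷ is) =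
  check Υs Ts (map pair-state Kn) (pair-state (row ls , row ms , f)) t ∧ verify Es Ts ((row ls , row ms , f) ∷ Kn) is

rows : ℕ → List Row
rows zero    = [] ∷ []
rows (suc n) = cartesianProductWith _∷_ (＋ ∷ － ∷ []) (rows n)

clash : Row → Bool
clash τ = any (λ i → any (λ j → is＋ (nthF τ i) ∧ is＋ (nthF τ j) ∧ adj? Υs i j) (downFrom 11)) (downFrom 11)

unclashing : List Row → List Row
unclashing = filterᵇ (λ τ → not (clash τ))

allTypes : List Row
allTypes = unclashing (rows 11)

-- Found by computer search.
items : List Item
items =
  bad (α 2 ∷ [ α 4 ]) (common 0 8 (dense 4 (1 each (0 ∷ 1 ∷ 2 ∷ 3 ∷ 4 ∷ 5 ∷ 6 ∷ 7 ∷ 8 ∷ 9 ∷ 10 ∷ [ 12 ])) ([ (12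
    ∷ 8 ∷ 7 ∷ 3 ∷ [ 0 ]) , dense 4 (1 each (0 ∷ 1 ∷ 2 ∷ 3 ∷ 4 ∷ 5 ∷ 7 ∷ 8 ∷ 9 ∷ 10 ∷ 11 ∷ [ 12 ])) [] ]))) ∷
  bad (α 2 ∷ α 4 ∷ [ β 3 ]) (common 0 8 (dense 4 (1 each (0 ∷ 1 ∷ 2 ∷ 3 ∷ 4 ∷ 5 ∷ 6 ∷ 7 ∷ 8 ∷ 9 ∷ 10 ∷ [ 12 ]))
    ([ (12 ∷ 8 ∷ 7 ∷ 3 ∷ [ 0 ]) , dense 4 (1 each (0 ∷ 1 ∷ 2 ∷ 3 ∷ 4 ∷ 5 ∷ 7 ∷ 8 ∷ 9 ∷ 10 ∷ 11 ∷ [ 12 ])) []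
    ]))) ∷
  bad (α 1 ∷ α 3 ∷ [ α 4 ]) (common 0 11 (dense 4 (1 each (0 ∷ 1 ∷ 2 ∷ 3 ∷ 4 ∷ 5 ∷ 6 ∷ 7 ∷ 8 ∷ 9 ∷ 11 ∷ [ 12 ]))
    ([ (9 ∷ 8 ∷ 4 ∷ 3 ∷ [ 0 ]) , dense 4 (1 each (0 ∷ 1 ∷ 2 ∷ 3 ∷ 4 ∷ 5 ∷ 6 ∷ 8 ∷ 9 ∷ 11 ∷ 12 ∷ [ 13 ])) [] ])))
    ∷
  bad (α 1 ∷ α 2 ∷ α 3 ∷ [ α 4 ]) (common 0 11 (dense 4 (1 each (0 ∷ 1 ∷ 2 ∷ 3 ∷ 4 ∷ 5 ∷ 6 ∷ 7 ∷ 8 ∷ 9 ∷ 11 ∷ [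
    12 ])) ([ (9 ∷ 8 ∷ 4 ∷ 3 ∷ [ 0 ]) , dense 4 (1 each (0 ∷ 1 ∷ 2 ∷ 3 ∷ 4 ∷ 5 ∷ 6 ∷ 8 ∷ 9 ∷ 11 ∷ 12 ∷ [ 13 ]))
    [] ]))) ∷
  pair (α 0 ∷ α 1 ∷ α 2 ∷ α 3 ∷ [ α 4 ]) (β 0 ∷ β 1 ∷ [ γ ]) － (type (std [ 9 ↦ 0 ]) 1) ∷
  pair (α 0 ∷ α 1 ∷ [ β 0 ]) (α 2 ∷ α 3 ∷ α 4 ∷ [ β 3 ]) ＋ (common 1 6 (dense 4 (1 each (0 ∷ 1 ∷ 2 ∷ 3 ∷ 4 ∷ 5 ∷
    6 ∷ 7 ∷ 9 ∷ 11 ∷ 12 ∷ [ 13 ])) ([ (13 ∷ 12 ∷ 11 ∷ 9 ∷ [ 0 ]) , dense 4 (1 each (0 ∷ 1 ∷ 2 ∷ 3 ∷ 5 ∷ 6 ∷ 7 ∷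
    8 ∷ 9 ∷ 10 ∷ 12 ∷ [ 13 ])) [] ]))) ∷
  pair (α 0 ∷ α 1 ∷ α 4 ∷ [ β 0 ]) (α 2 ∷ β 2 ∷ [ β 3 ]) ＋ (common 0 9 (dense 4 (1 each (0 ∷ 1 ∷ 2 ∷ 3 ∷ 4 ∷ 5 ∷
    7 ∷ 8 ∷ 9 ∷ 10 ∷ 11 ∷ [ 12 ])) ([ (5 ∷ 4 ∷ 3 ∷ 2 ∷ [ 0 ]) , type (std [ 13 ↦ 0 ]) 1 ]))) ∷
  pair (α 0 ∷ α 1 ∷ α 4 ∷ [ β 0 ]) (α 2 ∷ α 3 ∷ β 2 ∷ [ β 3 ]) － (common 0 1 (dense 4 (1 each (0 ∷ 1 ∷ 2 ∷ 3 ∷ 4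
    ∷ 5 ∷ 6 ∷ 7 ∷ 8 ∷ 9 ∷ 10 ∷ [ 12 ])) ([ (10 ∷ 9 ∷ 5 ∷ 4 ∷ [ 0 ]) , dense 4 (1 each (0 ∷ 1 ∷ 2 ∷ 3 ∷ 4 ∷ 5 ∷ 6
    ∷ 7 ∷ 9 ∷ 10 ∷ 12 ∷ [ 13 ])) [] ]))) ∷
  pair (α 0 ∷ α 1 ∷ α 4 ∷ [ β 0 ]) (α 2 ∷ β 2 ∷ [ β 3 ]) － (common 0 9 (dense 4 (1 each (0 ∷ 1 ∷ 2 ∷ 3 ∷ 4 ∷ 5 ∷
    7 ∷ 8 ∷ 9 ∷ 10 ∷ 11 ∷ [ 12 ])) ([ (5 ∷ 4 ∷ 3 ∷ 2 ∷ [ 0 ]) , type (std [ 13 ↦ 0 ]) 1 ]))) ∷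
  pair (α 0 ∷ β 0 ∷ [ β 1 ]) (α 0 ∷ β 0 ∷ [ β 4 ]) － (common 0 8 (dense 3 (1 each (0 ∷ 1 ∷ 3 ∷ 4 ∷ 5 ∷ 7 ∷ 9 ∷
    11 ∷ [ 13 ])) (((5 ∷ 4 ∷ 3 ∷ [ 0 ]) , type (std [ 13 ↦ 0 ]) 1) ∷ ((13 ∷ 11 ∷ 7 ∷ [ 0 ]) , dense 4 (1 each (0
    ∷ 1 ∷ 2 ∷ 4 ∷ 5 ∷ 7 ∷ 8 ∷ 9 ∷ 10 ∷ 11 ∷ 12 ∷ [ 14 ])) []) ∷ [ (11 ∷ 9 ∷ 5 ∷ [ 1 ]) , split 11 0 (split 0 3
    (use 2 3 0 (at 1)) (use 0 3 0 (at 1))) (type std 0) ]))) ∷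
  pair (α 0 ∷ α 1 ∷ [ β 0 ]) (α 2 ∷ β 1 ∷ [ β 2 ]) ＋ (common 1 8 (dense 3 (1 each (0 ∷ 1 ∷ 2 ∷ 3 ∷ 5 ∷ 7 ∷ 9 ∷
    11 ∷ [ 13 ])) (((5 ∷ 3 ∷ 1 ∷ [ 0 ]) , dense 4 (1 each (0 ∷ 1 ∷ 2 ∷ 3 ∷ 4 ∷ 6 ∷ 7 ∷ 8 ∷ 9 ∷ 10 ∷ 11 ∷ [ 14
    ])) []) ∷ ((13 ∷ 11 ∷ 7 ∷ [ 0 ]) , dense 4 (1 each (0 ∷ 1 ∷ 2 ∷ 3 ∷ 4 ∷ 7 ∷ 8 ∷ 9 ∷ 10 ∷ 11 ∷ 12 ∷ [ 14 ]))
    []) ∷ [ (11 ∷ 9 ∷ 5 ∷ [ 2 ]) , split 11 0 (use 4 0 3 std) (type std 0) ]))) ∷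
  pair (α 0 ∷ α 1 ∷ [ β 0 ]) (α 2 ∷ α 3 ∷ α 4 ∷ [ β 3 ]) － (dense 4 (1 each (0 ∷ 1 ∷ 2 ∷ 3 ∷ 4 ∷ 5 ∷ 6 ∷ 7 ∷ 10
    ∷ [ 11 ]) ++ 2 each ([ 8 ])) (((6 ∷ 5 ∷ 2 ∷ 1 ∷ [ 0 ]) , common 2 9 (dense 4 (1 each (0 ∷ 1 ∷ 2 ∷ 3 ∷ 4 ∷ 5
    ∷ 6 ∷ 7 ∷ 9 ∷ 10 ∷ 12 ∷ [ 13 ])) ([ (9 ∷ 5 ∷ 4 ∷ 2 ∷ [ 0 ]) , dense 4 (1 each (0 ∷ 1 ∷ 2 ∷ 4 ∷ 5 ∷ 6 ∷ 7 ∷ 8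
    ∷ 9 ∷ 10 ∷ 11 ∷ [ 14 ])) [] ]))) ∷ ((8 ∷ 4 ∷ 3 ∷ [ 1 ]) , common 1 2 (dense 4 (1 each (0 ∷ 1 ∷ 2 ∷ 3 ∷ 4 ∷ 5
    ∷ 6 ∷ 7 ∷ 9 ∷ 10 ∷ 12 ∷ [ 14 ])) ([ (14 ∷ 10 ∷ 9 ∷ 5 ∷ [ 0 ]) , dense 4 (1 each (0 ∷ 1 ∷ 2 ∷ 3 ∷ 4 ∷ 5 ∷ 6 ∷
    7 ∷ 10 ∷ 11 ∷ 13 ∷ [ 14 ])) [] ]))) ∷ [ (10 ∷ 8 ∷ 4 ∷ [ 1 ]) , split 10 0 (use 5 0 2 std) (type std 0) ])) ∷
  pair (α 0 ∷ α 1 ∷ α 4 ∷ [ β 0 ]) (β 1 ∷ [ γ ]) ＋ (dense 3 (1 each (0 ∷ 2 ∷ 3 ∷ 4 ∷ 5 ∷ 6 ∷ 7 ∷ 10 ∷ [ 12 ]))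
    (((12 ∷ 7 ∷ 3 ∷ [ 0 ]) , common 1 6 (dense 4 (1 each (0 ∷ 2 ∷ 3 ∷ 4 ∷ 5 ∷ 6 ∷ 7 ∷ 8 ∷ 9 ∷ 10 ∷ 12 ∷ [ 13 ]))
    ([ (6 ∷ 5 ∷ 4 ∷ 3 ∷ [ 0 ]) , dense 4 (1 each (0 ∷ 1 ∷ 2 ∷ 3 ∷ 5 ∷ 6 ∷ 7 ∷ 8 ∷ 9 ∷ 10 ∷ 12 ∷ [ 15 ])) [] ])))
    ∷ [ (10 ∷ 5 ∷ 4 ∷ [ 0 ]) , split 10 0 (use 4 0 2 std) (use 3 0 2 std) ])) ∷
  bad (α 2 ∷ α 3 ∷ [ α 4 ]) (dense 4 (1 each (0 ∷ 1 ∷ 2 ∷ 4 ∷ 5 ∷ 6 ∷ 7 ∷ 9 ∷ 10 ∷ [ 11 ]) ++ 2 each ([ 3 ]))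
    (((3 ∷ 2 ∷ 1 ∷ [ 0 ]) , type (std [ 11 ↦ 0 ]) 1) ∷ ((11 ∷ 10 ∷ 6 ∷ 5 ∷ [ 0 ]) , use 5 4 1 (at 1 [ 4 ↦ 0 ]))
    ∷ [ (4 ∷ 3 ∷ 1 ∷ [ 0 ]) , type (std [ 12 ↦ 0 ]) 1 ])) ∷
  pair (α 0 ∷ α 1 ∷ α 2 ∷ α 3 ∷ [ α 4 ]) (β 0 ∷ [ γ ]) － (common 0 1 (dense 4 (1 each (0 ∷ 1 ∷ 4 ∷ 5 ∷ 6 ∷ 7 ∷ 8
    ∷ 9 ∷ 10 ∷ [ 12 ]) ++ 2 each ([ 3 ])) (((10 ∷ 9 ∷ 5 ∷ 4 ∷ [ 0 ]) , dense 4 (1 each (0 ∷ 1 ∷ 2 ∷ 5 ∷ 6 ∷ 7 ∷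
    9 ∷ 11 ∷ 13 ∷ [ 14 ]) ++ 2 each ([ 4 ])) (((9 ∷ 5 ∷ 4 ∷ [ 1 ]) , type (std [ 13 ↦ 0 ]) 4) ∷ ((7 ∷ 6 ∷ 4 ∷ [
    1 ]) , type (std [ 15 ↦ 0 ]) 4) ∷ [ (6 ∷ 5 ∷ 4 ∷ [ 1 ]) , type (std [ 14 ↦ 0 ]) 4 ])) ∷ ((10 ∷ 9 ∷ 5 ∷ 4 ∷ [
    1 ]) , use 8 2 3 (std [ 8 ↦ 0 ])) ∷ ((8 ∷ 7 ∷ 3 ∷ [ 0 ]) , type (std [ 11 ↦ 0 ]) 3) ∷ ((8 ∷ 4 ∷ 3 ∷ [ 0 ]) ,
    type (std [ 12 ↦ 0 ]) 3) ∷ ((7 ∷ 6 ∷ 3 ∷ [ 0 ]) , type (std [ 10 ↦ 0 ]) 3) ∷ ((6 ∷ 5 ∷ 3 ∷ [ 0 ]) , type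
    (std [ 14 ↦ 0 ]) 3) ∷ [ (5 ∷ 4 ∷ 3 ∷ [ 0 ]) , type (std [ 13 ↦ 0 ]) 3 ]))) ∷
  pair (α 0 ∷ α 1 ∷ [ β 0 ]) (α 1 ∷ β 1 ∷ [ β 2 ]) － (common 0 10 (dense 3 (1 each (0 ∷ 1 ∷ 3 ∷ 5 ∷ 6 ∷ 8 ∷ 9 ∷
    11 ∷ [ 12 ])) (((6 ∷ 5 ∷ 3 ∷ [ 0 ]) , type (std [ 14 ↦ 0 ]) 1) ∷ ((12 ∷ 9 ∷ 8 ∷ [ 0 ]) , dense 4 (1 each (0
    ∷ 1 ∷ 2 ∷ 4 ∷ 5 ∷ 7 ∷ 8 ∷ 9 ∷ 10 ∷ 11 ∷ 12 ∷ [ 13 ])) []) ∷ [ (11 ∷ 9 ∷ 5 ∷ [ 1 ]) , split 11 0 (split 0 3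
    (use 8 0 3 std) (use 2 0 3 std)) (type std 0) ]))) ∷
  pair (α 0 ∷ α 1 ∷ [ β 0 ]) (α 2 ∷ α 3 ∷ [ β 3 ]) ＋ (common 1 6 (dense 3 (1 each (0 ∷ 2 ∷ 3 ∷ 5 ∷ 7 ∷ 8 ∷ 9 ∷
    11 ∷ [ 12 ])) (((12 ∷ 11 ∷ 9 ∷ [ 0 ]) , split 14 0 (split 11 0 (split 1 4 (dense 3 (1 each (1 ∷ 3 ∷ 4 ∷ 5 ∷
    7 ∷ 8 ∷ 9 ∷ 11 ∷ [ 13 ])) (((8 ∷ 7 ∷ 4 ∷ [ 3 ]) , use 9 4 3 (at 6 [ 11 ↦ 0 ])) ∷ [ (13 ∷ 11 ∷ 7 ∷ [ 1 ]) ,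
    split 13 0 (use 2 2 0 (at 7)) (type std 0) ])) (split 7 1 (use 10 1 4 (at 3 [ 4 ↦ 0 ])) (use 1 1 4 (at 3 [ 4
    ↦ 0 ])))) (type std 0)) (type std 0)) ∷ ((12 ∷ 9 ∷ 8 ∷ [ 0 ]) , split 14 0 (split 0 2 (use 9 0 2 (at 6))
    (use 3 0 2 (at 6))) (type std 0)) ∷ ((11 ∷ 9 ∷ 5 ∷ [ 2 ]) , split 11 0 (use 9 0 3 std) (type std 0)) ∷ [ (11
    ∷ 9 ∷ 5 ∷ [ 0 ]) , split 11 0 (use 3 0 3 std) (type std 0) ]))) ∷
  pair (α 0 ∷ α 1 ∷ [ β 0 ]) (α 2 ∷ β 2 ∷ [ β 3 ]) ＋ (common 1 6 (dense 3 (1 each (0 ∷ 2 ∷ 3 ∷ 5 ∷ 7 ∷ 8 ∷ 9 ∷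
    11 ∷ [ 12 ])) (((12 ∷ 11 ∷ 9 ∷ [ 0 ]) , split 14 0 (split 11 0 (split 1 4 (dense 3 (1 each (1 ∷ 3 ∷ 4 ∷ 5 ∷
    7 ∷ 8 ∷ 9 ∷ 11 ∷ [ 13 ])) (((8 ∷ 7 ∷ 4 ∷ [ 3 ]) , use 9 3 4 (std [ 11 ↦ 0 ])) ∷ [ (13 ∷ 11 ∷ 7 ∷ [ 1 ]) ,
    split 13 0 (use 3 2 0 (at 7)) (type std 0) ])) (split 7 1 (use 11 1 4 (at 3 [ 4 ↦ 0 ])) (use 2 1 4 (at 3 [ 4
    ↦ 0 ])))) (type std 0)) (type std 0)) ∷ ((12 ∷ 9 ∷ 8 ∷ [ 0 ]) , split 14 0 (split 0 2 (use 9 2 0 std) (use 7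
    2 0 std)) (type std 0)) ∷ ((11 ∷ 9 ∷ 5 ∷ [ 2 ]) , split 11 0 (use 10 0 3 std) (type std 0)) ∷ [ (11 ∷ 9 ∷ 5
    ∷ [ 0 ]) , split 11 0 (use 4 0 3 std) (type std 0) ]))) ∷
  pair (α 0 ∷ α 1 ∷ [ β 0 ]) (α 3 ∷ β 2 ∷ [ β 3 ]) － (common 1 6 (dense 3 (1 each (0 ∷ 2 ∷ 3 ∷ 5 ∷ 7 ∷ 8 ∷ 9 ∷
    11 ∷ [ 12 ])) (((12 ∷ 11 ∷ 9 ∷ [ 0 ]) , split 14 0 (split 11 0 (split 1 4 (dense 3 (1 each (1 ∷ 3 ∷ 4 ∷ 5 ∷
    7 ∷ 8 ∷ 9 ∷ 11 ∷ [ 13 ])) (((8 ∷ 7 ∷ 4 ∷ [ 3 ]) , use 8 3 4 (at 9 [ 11 ↦ 0 ])) ∷ [ (13 ∷ 11 ∷ 7 ∷ [ 1 ]) ,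
    split 13 0 (use 4 2 0 (at 7)) (type std 0) ])) (split 7 1 (use 12 1 4 (at 3 [ 4 ↦ 0 ])) (use 3 1 4 (at 3 [ 4
    ↦ 0 ])))) (type std 0)) (type std 0)) ∷ ((12 ∷ 9 ∷ 8 ∷ [ 0 ]) , split 14 0 (split 0 2 (use 10 2 0 (at 9))
    (use 8 2 0 (at 9))) (type std 0)) ∷ ((11 ∷ 9 ∷ 5 ∷ [ 2 ]) , split 11 0 (use 11 0 3 std) (type std 0)) ∷ [
    (11 ∷ 9 ∷ 5 ∷ [ 0 ]) , split 11 0 (use 5 0 3 std) (type std 0) ]))) ∷
  pair (α 0 ∷ α 1 ∷ [ β 0 ]) (β 1 ∷ [ γ ]) ＋ (dense 3 (1 each (0 ∷ 1 ∷ 2 ∷ 3 ∷ 5 ∷ 6 ∷ 7 ∷ 9 ∷ [ 11 ])) (((6 ∷ 5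
    ∷ 2 ∷ [ 1 ]) , use 5 1 2 (std [ 9 ↦ 0 ])) ∷ [ (11 ∷ 9 ∷ 5 ∷ [ 0 ]) , split 11 0 (use 5 1 0 (at 7)) (type std
    0) ])) ∷
  pair (α 0 ∷ α 1 ∷ α 4 ∷ [ β 0 ]) (α 0 ∷ β 0 ∷ [ β 1 ]) － (dense 3 (1 each (0 ∷ 1 ∷ 2 ∷ 3 ∷ 6 ∷ 7 ∷ 8 ∷ 10 ∷ [
    11 ])) (((3 ∷ 2 ∷ 1 ∷ [ 0 ]) , common 1 12 (dense 4 (1 each (0 ∷ 1 ∷ 2 ∷ 3 ∷ 4 ∷ 5 ∷ 7 ∷ 8 ∷ 9 ∷ 10 ∷ 11 ∷ [
    13 ])) ([ (8 ∷ 7 ∷ 4 ∷ 3 ∷ [ 0 ]) , type (std [ 11 ↦ 0 ]) 1 ]))) ∷ [ (11 ∷ 10 ∷ 8 ∷ [ 0 ]) , type std 0 ]))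
    ∷
  pair (α 0 ∷ β 0 ∷ [ β 1 ]) (α 1 ∷ β 0 ∷ [ β 1 ]) － (common 1 11 (common 1 13 (dense 4 (2 each (0 ∷ 1 ∷ 2 ∷ 3 ∷
    13 ∷ [ 14 ])) (((14 ∷ 2 ∷ [ 1 ]) , dense 4 (1 each (0 ∷ 2 ∷ 3 ∷ 4 ∷ 5 ∷ 7 ∷ 9 ∷ 10 ∷ 11 ∷ 13 ∷ 14 ∷ [ 15 ]))
    (((15 ∷ 13 ∷ 11 ∷ 3 ∷ [ 2 ]) , type std 0) ∷ ((14 ∷ 13 ∷ 11 ∷ 4 ∷ [ 0 ]) , type std 0) ∷ ((13 ∷ 11 ∷ 7 ∷ 4 ∷
    [ 3 ]) , split 13 0 (use 13 5 0 (at 1)) (type std 0)) ∷ ((13 ∷ 11 ∷ 7 ∷ 4 ∷ [ 0 ]) , split 13 0 (use 13 5 0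
    (at 1)) (type std 0)) ∷ [ (13 ∷ 11 ∷ 7 ∷ 3 ∷ [ 2 ]) , split 13 0 (use 11 5 0 (at 1)) (type std 0) ])) ∷ [
    (13 ∷ 3 ∷ [ 0 ]) , dense 4 (1 each (0 ∷ 1 ∷ 3 ∷ 4 ∷ 5 ∷ 7 ∷ 9 ∷ 10 ∷ 11 ∷ 13 ∷ 14 ∷ [ 15 ])) (((15 ∷ 13 ∷ 11
    ∷ 3 ∷ [ 0 ]) , type std 0) ∷ ((14 ∷ 13 ∷ 11 ∷ 4 ∷ [ 1 ]) , type std 0) ∷ ((13 ∷ 11 ∷ 7 ∷ 4 ∷ [ 3 ]) , split
    13 0 (use 13 5 0 (at 1)) (type std 0)) ∷ ((13 ∷ 11 ∷ 7 ∷ 4 ∷ [ 1 ]) , split 13 0 (use 13 5 0 (at 1)) (type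
    std 0)) ∷ [ (13 ∷ 11 ∷ 7 ∷ 3 ∷ [ 0 ]) , split 13 0 (use 11 5 0 (at 1)) (type std 0) ]) ])))) ∷
  pair (α 0 ∷ β 0 ∷ [ β 1 ]) (α 1 ∷ β 1 ∷ [ β 2 ]) － (common 0 10 (dense 3 (1 each (0 ∷ 1 ∷ 3 ∷ 5 ∷ 6 ∷ 8 ∷ 9 ∷
    11 ∷ [ 12 ])) (((6 ∷ 5 ∷ 3 ∷ [ 0 ]) , type (std [ 14 ↦ 0 ]) 1) ∷ ((12 ∷ 9 ∷ 8 ∷ [ 0 ]) , split 14 0 (use 1 3
    0 std) (type std 0)) ∷ [ (11 ∷ 9 ∷ 5 ∷ [ 1 ]) , split 11 0 (split 0 3 (use 14 3 0 (at 1)) (use 12 3 0 (at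
    1))) (type std 0) ]))) ∷
  pair (α 0 ∷ α 1 ∷ [ β 0 ]) (α 0 ∷ α 1 ∷ α 2 ∷ [ β 1 ]) － (dense 3 (1 each (1 ∷ 2 ∷ 3 ∷ 5 ∷ 6 ∷ 7 ∷ 8 ∷ 9 ∷ [
    11 ])) (((9 ∷ 8 ∷ 3 ∷ [ 1 ]) , split 0 1 (common 2 7 (dense 4 (1 each (0 ∷ 1 ∷ 2 ∷ 3 ∷ 4 ∷ 5 ∷ 7 ∷ 8 ∷ 9 ∷
    11 ∷ 12 ∷ [ 14 ])) ([ (9 ∷ 5 ∷ 4 ∷ 2 ∷ [ 0 ]) , dense 4 (1 each (1 ∷ 2 ∷ 3 ∷ 4 ∷ 5 ∷ 8 ∷ 9 ∷ 10 ∷ 11 ∷ 12 ∷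
    13 ∷ [ 15 ])) ([ (15 ∷ 13 ∷ 12 ∷ 11 ∷ [ 1 ]) , type (std [ 14 ↦ 1 ]) 0 ]) ]))) (split 5 0 (use 14 0 1 (at
    3)) (use 10 1 0 (at 5)))) ∷ [ (6 ∷ 5 ∷ 2 ∷ [ 1 ]) , common 2 9 (dense 4 (1 each (0 ∷ 2 ∷ 3 ∷ 4 ∷ 5 ∷ 7 ∷ 8 ∷
    9 ∷ 10 ∷ 11 ∷ 12 ∷ [ 14 ])) (((11 ∷ 10 ∷ 5 ∷ 3 ∷ [ 2 ]) , dense 4 (1 each (0 ∷ 2 ∷ 3 ∷ 4 ∷ 5 ∷ 6 ∷ 8 ∷ 9 ∷
    10 ∷ 12 ∷ 13 ∷ [ 15 ])) []) ∷ [ (9 ∷ 5 ∷ 4 ∷ 2 ∷ [ 0 ]) , split 12 1 (split 7 1 (use 16 1 4 (std [ 13 ↦ 0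
    ])) (type (std [ 13 ↦ 0 ]) 1)) (type (std [ 13 ↦ 0 ]) 1) ])) ])) ∷
  pair (α 0 ∷ α 1 ∷ [ β 0 ]) (α 0 ∷ β 0 ∷ [ β 1 ]) － (common 1 6 (dense 3 (1 each (0 ∷ 2 ∷ 3 ∷ 5 ∷ 7 ∷ 8 ∷ 9 ∷
    11 ∷ [ 12 ])) (((12 ∷ 11 ∷ 9 ∷ [ 0 ]) , split 14 0 (split 11 0 (split 1 4 (split 1 7 (use 3 2 3 (std [ 10 ↦
    1 ])) (use 4 1 3 std)) (split 7 1 (use 18 1 4 (at 3 [ 4 ↦ 0 ])) (use 9 1 4 (at 3 [ 4 ↦ 0 ])))) (type std 0))
    (type std 0)) ∷ ((12 ∷ 9 ∷ 8 ∷ [ 0 ]) , split 14 0 (use 3 2 0 std) (type std 0)) ∷ ((11 ∷ 9 ∷ 5 ∷ [ 2 ]) ,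
    split 11 0 (use 17 0 3 std) (type std 0)) ∷ [ (11 ∷ 9 ∷ 5 ∷ [ 0 ]) , split 11 0 (use 11 0 3 std) (type std
    0) ]))) ∷
  pair (α 0 ∷ α 1 ∷ [ β 0 ]) (α 2 ∷ α 3 ∷ [ β 2 ]) ＋ (common 1 6 (dense 3 (1 each (0 ∷ 2 ∷ 3 ∷ 5 ∷ 7 ∷ 8 ∷ 9 ∷
    11 ∷ [ 12 ])) (((12 ∷ 11 ∷ 9 ∷ [ 0 ]) , split 14 0 (split 11 0 (split 1 4 (split 1 7 (use 18 3 2 (at 2 [ 10
    ↦ 1 ])) (use 5 1 3 std)) (split 7 1 (use 19 1 4 (at 3 [ 4 ↦ 0 ])) (use 10 1 4 (at 3 [ 4 ↦ 0 ])))) (type std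
    0)) (type std 0)) ∷ ((12 ∷ 9 ∷ 8 ∷ [ 0 ]) , split 14 0 (split 0 2 (use 18 0 2 (at 2)) (use 12 0 2 (at 2)))
    (type std 0)) ∷ ((11 ∷ 9 ∷ 5 ∷ [ 2 ]) , split 11 0 (use 18 0 3 std) (type std 0)) ∷ [ (11 ∷ 9 ∷ 5 ∷ [ 0 ]) ,
    split 11 0 (use 12 0 3 std) (type std 0) ]))) ∷
  pair (α 0 ∷ α 1 ∷ [ β 0 ]) (α 2 ∷ α 3 ∷ [ β 2 ]) － (common 0 1 (common 2 7 (dense 3 (1 each (3 ∷ 4 ∷ 5 ∷ 7 ∷ 8
    ∷ 9 ∷ 10 ∷ 11 ∷ [ 13 ])) (((11 ∷ 10 ∷ 5 ∷ [ 3 ]) , dense 3 (1 each (1 ∷ 4 ∷ 5 ∷ 7 ∷ 9 ∷ 10 ∷ 11 ∷ 13 ∷ [ 14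
    ])) (((14 ∷ 13 ∷ 11 ∷ [ 1 ]) , split 16 0 (split 13 0 (split 2 6 (split 2 9 (use 13 5 4 (at 2 [ 12 ↦ 2 ]))
    (use 6 2 5 std)) (split 9 2 (use 20 2 6 (at 3 [ 6 ↦ 0 ])) (use 11 2 6 (at 3 [ 6 ↦ 0 ])))) (type std 0))
    (type std 0)) ∷ ((14 ∷ 11 ∷ 10 ∷ [ 1 ]) , split 16 0 (split 0 4 (use 19 0 4 (at 2)) (use 13 0 4 (at 2)))
    (type std 0)) ∷ ((13 ∷ 11 ∷ 7 ∷ [ 4 ]) , split 13 0 (use 19 0 5 std) (type std 0)) ∷ [ (13 ∷ 11 ∷ 7 ∷ [ 1 ])
    , split 13 0 (use 13 0 5 std) (type std 0) ])) ∷ [ (8 ∷ 7 ∷ 4 ∷ [ 3 ]) , use 13 4 3 (at 2 [ 11 ↦ 0 ]) ]))))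
    ∷
  pair (α 0 ∷ α 1 ∷ [ β 0 ]) (α 2 ∷ β 2 ∷ [ β 3 ]) － (common 1 6 (dense 3 (1 each (0 ∷ 2 ∷ 3 ∷ 5 ∷ 7 ∷ 8 ∷ 9 ∷
    11 ∷ [ 12 ])) (((12 ∷ 11 ∷ 9 ∷ [ 0 ]) , split 14 0 (split 11 0 (split 1 4 (split 1 7 (use 17 2 3 (std [ 10 ↦
    1 ])) (use 7 1 3 std)) (split 7 1 (use 21 1 4 (at 3 [ 4 ↦ 0 ])) (use 12 1 4 (at 3 [ 4 ↦ 0 ])))) (type std
    0)) (type std 0)) ∷ ((12 ∷ 9 ∷ 8 ∷ [ 0 ]) , split 14 0 (split 0 2 (use 19 2 0 std) (use 17 2 0 std)) (type
    std 0)) ∷ ((11 ∷ 9 ∷ 5 ∷ [ 2 ]) , split 11 0 (use 20 0 3 std) (type std 0)) ∷ [ (11 ∷ 9 ∷ 5 ∷ [ 0 ]) , split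
    11 0 (use 14 0 3 std) (type std 0) ]))) ∷
  pair (α 0 ∷ α 1 ∷ [ β 0 ]) (α 3 ∷ β 2 ∷ [ β 3 ]) ＋ (common 0 10 (common 2 7 (dense 3 (1 each (1 ∷ 2 ∷ 4 ∷ 5 ∷
    7 ∷ 8 ∷ 11 ∷ 12 ∷ [ 14 ])) (((8 ∷ 7 ∷ 4 ∷ [ 1 ]) , type (std [ 11 ↦ 0 ]) 2) ∷ ((14 ∷ 11 ∷ 5 ∷ [ 1 ]) , dense
    4 (1 each (0 ∷ 2 ∷ 3 ∷ 5 ∷ 6 ∷ 7 ∷ 8 ∷ 10 ∷ 12 ∷ 13 ∷ 14 ∷ [ 15 ])) []) ∷ [ (14 ∷ 12 ∷ 8 ∷ [ 2 ]) , split 14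
    0 (use 4 0 4 std) (type std 0) ])))) ∷
  pair (α 0 ∷ α 1 ∷ [ β 0 ]) (α 0 ∷ β 0 ∷ [ β 4 ]) － (common 0 8 (dense 4 (1 each (0 ∷ 1 ∷ 3 ∷ 4 ∷ 5 ∷ 6 ∷ 7 ∷ 8
    ∷ 9 ∷ 10 ∷ 12 ∷ [ 13 ])) ([ (13 ∷ 12 ∷ 8 ∷ 7 ∷ [ 0 ]) , dense 3 (1 each (0 ∷ 1 ∷ 2 ∷ 4 ∷ 5 ∷ 8 ∷ 10 ∷ 12 ∷ [
    14 ])) (((14 ∷ 12 ∷ 8 ∷ [ 1 ]) , split 14 0 (use 5 0 4 std) (type std 0)) ∷ [ (12 ∷ 10 ∷ 2 ∷ [ 0 ]) , split
    12 0 (split 7 0 (split 0 4 (use 22 0 4 std) (use 16 0 4 std)) (type std 0)) (type std 0) ]) ]))) ∷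
  pair (α 0 ∷ α 1 ∷ [ β 0 ]) (α 4 ∷ β 3 ∷ [ β 4 ]) ＋ (common 0 9 (dense 3 (1 each (0 ∷ 1 ∷ 3 ∷ 4 ∷ 5 ∷ 7 ∷ 10 ∷
    11 ∷ [ 13 ])) (((5 ∷ 4 ∷ 3 ∷ [ 0 ]) , split 12 1 (split 7 1 (common 3 8 (split 2 14 (dense 4 (1 each (0 ∷ 2
    ∷ 3 ∷ 4 ∷ 5 ∷ 7 ∷ 8 ∷ 9 ∷ 10 ∷ 11 ∷ 12 ∷ [ 14 ])) ([ (14 ∷ 12 ∷ 8 ∷ 3 ∷ [ 0 ]) , split 14 0 (dense 4 (1 each
    (1 ∷ 3 ∷ 4 ∷ 5 ∷ 6 ∷ 8 ∷ 9 ∷ 10 ∷ 11 ∷ 12 ∷ 13 ∷ [ 16 ])) ([ (16 ∷ 12 ∷ 11 ∷ 3 ∷ [ 1 ]) , split 8 0 (use 21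
    0 1 (at 2)) (use 17 1 0 (at 9)) ])) (type std 0) ])) (use 3 2 4 std))) (type (std [ 13 ↦ 0 ]) 1)) (type (std
    [ 13 ↦ 0 ]) 1)) ∷ ((13 ∷ 11 ∷ 10 ∷ [ 1 ]) , type std 0) ∷ ((13 ∷ 11 ∷ 7 ∷ [ 1 ]) , split 13 0 (use 6 0 3
    std) (type std 0)) ∷ [ (13 ∷ 11 ∷ 7 ∷ [ 0 ]) , split 13 0 (use 6 0 3 std) (type std 0) ]))) ∷
  pair (α 0 ∷ β 0 ∷ [ β 1 ]) (α 2 ∷ β 1 ∷ [ β 2 ]) － (common 0 11 (dense 3 (1 each (0 ∷ 1 ∷ 3 ∷ 5 ∷ 7 ∷ 8 ∷ 9 ∷
    11 ∷ [ 12 ])) (((8 ∷ 7 ∷ 3 ∷ [ 0 ]) , type (std [ 11 ↦ 0 ]) 1) ∷ ((12 ∷ 9 ∷ 8 ∷ [ 1 ]) , split 14 0 (use 10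
    3 0 std) (type std 0)) ∷ [ (11 ∷ 9 ∷ 5 ∷ [ 0 ]) , split 11 0 (split 0 3 (use 23 3 0 (at 1)) (use 21 3 0 (at
    1))) (type std 0) ]))) ∷
  pair (α 0 ∷ β 0 ∷ [ β 1 ]) (α 2 ∷ β 2 ∷ [ β 3 ]) ＋ (common 1 11 (common 1 10 (dense 3 (1 each (1 ∷ 3 ∷ 4 ∷ 5 ∷
    7 ∷ 8 ∷ 11 ∷ 13 ∷ [ 14 ])) (((8 ∷ 7 ∷ 4 ∷ [ 1 ]) , type (std [ 11 ↦ 0 ]) 2) ∷ ((14 ∷ 11 ∷ 5 ∷ [ 1 ]) , dense
    4 (1 each (0 ∷ 2 ∷ 4 ∷ 5 ∷ 6 ∷ 7 ∷ 9 ∷ 10 ∷ 12 ∷ 13 ∷ 14 ∷ [ 15 ])) []) ∷ [ (13 ∷ 11 ∷ 7 ∷ [ 3 ]) , split 13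
    0 (use 11 3 0 (at 2)) (type std 0) ])))) ∷
  pair (α 0 ∷ β 0 ∷ [ β 1 ]) (α 2 ∷ β 2 ∷ [ β 3 ]) － (common 1 11 (dense 3 (1 each (0 ∷ 2 ∷ 3 ∷ 5 ∷ 7 ∷ 8 ∷ 9 ∷
    11 ∷ [ 12 ])) (((8 ∷ 7 ∷ 3 ∷ [ 0 ]) , split 12 1 (split 7 1 (split 11 1 (use 12 2 1 (at 2)) (use 3 2 1 (at
    7))) (type (std [ 11 ↦ 0 ]) 1)) (type (std [ 11 ↦ 0 ]) 1)) ∷ ((12 ∷ 11 ∷ 9 ∷ [ 2 ]) , type std 0) ∷ ((11 ∷ 9
    ∷ 5 ∷ [ 2 ]) , split 11 0 (use 25 3 0 (at 1)) (type std 0)) ∷ [ (11 ∷ 9 ∷ 5 ∷ [ 0 ]) , split 11 0 (use 23 3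
    0 (at 1)) (type std 0) ]))) ∷
  pair (α 0 ∷ β 0 ∷ [ β 1 ]) (α 4 ∷ β 3 ∷ [ β 4 ]) ＋ (common 0 9 (common 2 12 (dense 4 (1 each (0 ∷ 1 ∷ 2 ∷ 3 ∷
    4 ∷ 6 ∷ 7 ∷ 8 ∷ 10 ∷ 11 ∷ 13 ∷ [ 14 ])) (((8 ∷ 7 ∷ 4 ∷ 2 ∷ [ 0 ]) , type (std [ 11 ↦ 0 ]) 1) ∷ ((7 ∷ 6 ∷ 4 ∷
    3 ∷ [ 1 ]) , type (std [ 15 ↦ 0 ]) 2) ∷ ((7 ∷ 6 ∷ 4 ∷ 1 ∷ [ 0 ]) , type (std [ 15 ↦ 0 ]) 2) ∷ [ (8 ∷ 7 ∷ 4 ∷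
    1 ∷ [ 0 ]) , type (std [ 11 ↦ 0 ]) 1 ])))) ∷
  pair (α 0 ∷ β 0 ∷ [ β 1 ]) (α 3 ∷ α 4 ∷ β 3 ∷ [ β 4 ]) － (common 0 1 (common 2 12 (dense 3 (1 each (0 ∷ 3 ∷ 4
    ∷ 6 ∷ 8 ∷ 9 ∷ 10 ∷ 12 ∷ [ 13 ])) (((9 ∷ 8 ∷ 4 ∷ [ 0 ]) , split 13 1 (split 8 1 (split 1 12 (dense 4 (1 each
    (1 ∷ 2 ∷ 3 ∷ 4 ∷ 5 ∷ 6 ∷ 7 ∷ 8 ∷ 9 ∷ 12 ∷ 14 ∷ [ 15 ])) ([ (7 ∷ 6 ∷ 5 ∷ 2 ∷ [ 1 ]) , dense 4 (1 each (2 ∷ 3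
    ∷ 4 ∷ 5 ∷ 6 ∷ 8 ∷ 9 ∷ 10 ∷ 12 ∷ 13 ∷ 15 ∷ [ 16 ])) ([ (16 ∷ 15 ∷ 13 ∷ 12 ∷ [ 3 ]) , type (std [ 16 ↦ 1 ]) 0
    ]) ])) (use 23 4 1 (at 7))) (type (std [ 12 ↦ 0 ]) 1)) (type (std [ 12 ↦ 0 ]) 1)) ∷ ((13 ∷ 12 ∷ 10 ∷ [ 3 ])
    , type std 0) ∷ ((12 ∷ 10 ∷ 6 ∷ [ 3 ]) , split 12 0 (use 27 4 0 (at 1)) (type std 0)) ∷ [ (12 ∷ 10 ∷ 6 ∷ [ 0
    ]) , split 12 0 (use 25 4 0 (at 1)) (type std 0) ])))) ∷
  pair (α 0 ∷ β 0 ∷ [ β 1 ]) (β 4 ∷ [ γ ]) ＋ (common 1 11 (common 1 5 (dense 2 (1 each (0 ∷ 1 ∷ 2 ∷ 3 ∷ 6 ∷ [ 13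
    ])) (((6 ∷ 2 ∷ [ 1 ]) , dense 4 (1 each (0 ∷ 2 ∷ 3 ∷ 4 ∷ 5 ∷ 6 ∷ 7 ∷ 8 ∷ 9 ∷ 11 ∷ 14 ∷ [ 15 ])) []) ∷ [ (13
    ∷ 3 ∷ [ 0 ]) , dense 4 (1 each (0 ∷ 1 ∷ 3 ∷ 4 ∷ 5 ∷ 6 ∷ 7 ∷ 8 ∷ 9 ∷ 11 ∷ 14 ∷ [ 15 ])) [] ])))) ∷
  pair (α 0 ∷ α 1 ∷ [ β 0 ]) (α 4 ∷ β 0 ∷ [ β 4 ]) － (common 0 12 (dense 3 (1 each (0 ∷ 1 ∷ 3 ∷ 5 ∷ 7 ∷ 8 ∷ 9 ∷
    11 ∷ [ 13 ])) (((8 ∷ 7 ∷ 3 ∷ [ 0 ]) , type (std [ 11 ↦ 0 ]) 1) ∷ ((13 ∷ 11 ∷ 7 ∷ [ 1 ]) , split 13 0 (use 13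
    0 3 std) (type std 0)) ∷ [ (11 ∷ 9 ∷ 5 ∷ [ 0 ]) , split 11 0 (split 0 3 (use 30 0 3 std) (use 24 0 3 std))
    (type std 0) ]))) ∷
  pair (α 0 ∷ α 1 ∷ [ β 0 ]) (α 3 ∷ α 4 ∷ [ β 4 ]) ＋ (common 0 4 (common 2 7 (dense 4 (2 each (0 ∷ 1 ∷ 2 ∷ 3 ∷ 6
    ∷ [ 8 ])) (((8 ∷ 3 ∷ [ 1 ]) , dense 4 (1 each (0 ∷ 2 ∷ 3 ∷ 4 ∷ 5 ∷ 6 ∷ 7 ∷ 9 ∷ 10 ∷ 12 ∷ 13 ∷ [ 14 ])) []) ∷
    [ (6 ∷ 2 ∷ [ 0 ]) , dense 4 (1 each (0 ∷ 1 ∷ 3 ∷ 4 ∷ 5 ∷ 6 ∷ 7 ∷ 9 ∷ 10 ∷ 11 ∷ 13 ∷ [ 14 ])) [] ])))) ∷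
  pair (α 0 ∷ β 0 ∷ [ β 1 ]) (α 4 ∷ β 3 ∷ [ β 4 ]) － (dense 2 (1 each (0 ∷ 2 ∷ 4 ∷ 7 ∷ 8 ∷ [ 10 ])) (((7 ∷ 2 ∷ [
    0 ]) , split 0 7 (use 3 1 2 (std [ 10 ↦ 0 ])) (use 2 0 1 (at 5))) ∷ [ (10 ∷ 8 ∷ [ 4 ]) , split 10 0 (split 0
    2 (use 31 2 0 (at 1)) (use 29 2 0 (at 1))) (type std 0) ])) ∷
  pair ([ β 4 ]) (α 0 ∷ α 1 ∷ α 2 ∷ α 3 ∷ [ α 4 ]) ＋ (use 25 1 2 (at 0 [ 2 ↦ 0 ])) ∷
  pair ([ β 4 ]) (α 0 ∷ α 1 ∷ α 4 ∷ [ β 0 ]) ＋ (common 1 4 (common 2 3 (dense 4 (1 each (1 ∷ 3 ∷ 4 ∷ 5 ∷ 7 ∷ 8 ∷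
    9 ∷ 10 ∷ 12 ∷ [ 14 ]) ++ 2 each ([ 6 ])) (((14 ∷ 10 ∷ 9 ∷ 5 ∷ [ 1 ]) , dense 4 (1 each (0 ∷ 2 ∷ 3 ∷ 4 ∷ 5 ∷
    6 ∷ 7 ∷ 9 ∷ 10 ∷ 11 ∷ 12 ∷ [ 14 ])) []) ∷ ((12 ∷ 10 ∷ 6 ∷ [ 3 ]) , split 12 0 (dense 4 (1 each (0 ∷ 3 ∷ 7 ∷
    8 ∷ 9 ∷ 10 ∷ 12 ∷ [ 15 ]) ++ 2 each (4 ∷ [ 6 ])) (((15 ∷ 10 ∷ 9 ∷ [ 4 ]) , split 15 0 (use 32 0 1 (at 1))
    (use 31 0 1 (at 1))) ∷ ((15 ∷ 10 ∷ 6 ∷ [ 0 ]) , use 20 0 4 (at 9)) ∷ ((12 ∷ 8 ∷ 7 ∷ [ 4 ]) , split 14 0 (use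
    32 0 4 std) (use 31 0 4 (at 9))) ∷ [ (12 ∷ 7 ∷ 6 ∷ [ 3 ]) , use 20 0 1 (at 1) ])) (type std 0)) ∷ ((12 ∷ 7 ∷
    6 ∷ [ 3 ]) , split 12 0 (use 32 0 3 std) (use 31 0 3 std)) ∷ [ (7 ∷ 6 ∷ 4 ∷ [ 3 ]) , type (std [ 15 ↦ 0 ]) 3
    ])))) ∷
  pair (β 3 ∷ [ β 4 ]) (α 0 ∷ α 1 ∷ α 2 ∷ α 3 ∷ [ α 4 ]) ＋ (use 36 1 2 (at 1 [ 2 ↦ 0 ])) ∷
  pair (β 3 ∷ [ β 4 ]) (α 0 ∷ α 4 ∷ [ β 0 ]) ＋ (dense 3 (1 each (0 ∷ 1 ∷ 2 ∷ 3 ∷ 6 ∷ 7 ∷ 8 ∷ 9 ∷ [ 10 ])) (((7 ∷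
    6 ∷ 2 ∷ [ 1 ]) , use 31 2 1 (at 9 [ 10 ↦ 0 ])) ∷ [ (10 ∷ 9 ∷ 8 ∷ [ 1 ]) , split 13 0 (split 12 0 (use 0 0 2
    std) (type std 0)) (type std 0) ])) ∷
  pair (β 3 ∷ [ β 4 ]) (α 0 ∷ α 1 ∷ α 4 ∷ [ β 0 ]) ＋ (dense 3 (1 each (0 ∷ 1 ∷ 2 ∷ 3 ∷ 6 ∷ 7 ∷ 8 ∷ 9 ∷ [ 10 ]))
    (((7 ∷ 6 ∷ 2 ∷ [ 1 ]) , common 2 10 (dense 4 (1 each (0 ∷ 1 ∷ 2 ∷ 3 ∷ 4 ∷ 5 ∷ 7 ∷ 8 ∷ 9 ∷ 10 ∷ 11 ∷ [ 13 ]))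
    ([ (8 ∷ 7 ∷ 4 ∷ 2 ∷ [ 0 ]) , dense 4 (1 each (0 ∷ 1 ∷ 4 ∷ 5 ∷ 6 ∷ 7 ∷ 8 ∷ 9 ∷ 10 ∷ 12 ∷ 13 ∷ [ 15 ])) ([ (15
    ∷ 13 ∷ 12 ∷ 4 ∷ [ 0 ]) , type (std [ 13 ↦ 3 ]) 0 ]) ]))) ∷ [ (10 ∷ 9 ∷ 8 ∷ [ 1 ]) , split 13 0 (split 12 0
    (use 1 0 2 std) (type std 0)) (type std 0) ])) ∷
  pair (β 3 ∷ [ β 4 ]) (α 0 ∷ α 1 ∷ α 2 ∷ [ β 1 ]) ＋ (dense 4 (1 each (1 ∷ 3 ∷ 4 ∷ 5 ∷ 6 ∷ 7 ∷ 8 ∷ 9 ∷ 10 ∷ [ 12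
    ]) ++ 2 each ([ 2 ])) (((7 ∷ 6 ∷ 2 ∷ [ 1 ]) , use 37 2 1 (at 3 [ 10 ↦ 0 ])) ∷ ((12 ∷ 10 ∷ 9 ∷ 8 ∷ [ 1 ]) ,
    split 12 0 (use 2 0 2 std) (type std 0)) ∷ [ (6 ∷ 5 ∷ 2 ∷ [ 1 ]) , use 37 2 1 (at 8 [ 9 ↦ 0 ]) ])) ∷
  pair (β 3 ∷ [ β 4 ]) (α 0 ∷ α 1 ∷ α 2 ∷ [ β 1 ]) － (dense 4 (1 each (1 ∷ 3 ∷ 4 ∷ 5 ∷ 6 ∷ 7 ∷ 8 ∷ 9 ∷ 10 ∷ [ 12
    ]) ++ 2 each ([ 2 ])) (((6 ∷ 5 ∷ 2 ∷ [ 1 ]) , use 36 2 1 (at 8 [ 9 ↦ 0 ])) ∷ ((7 ∷ 6 ∷ 2 ∷ [ 1 ]) , use 36 2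
    1 (at 3 [ 10 ↦ 0 ])) ∷ [ (12 ∷ 10 ∷ 9 ∷ 8 ∷ [ 1 ]) , split 12 0 (use 3 0 2 std) (type std 0) ])) ∷
  pair (β 3 ∷ [ β 4 ]) (β 0 ∷ β 1 ∷ [ γ ]) ＋ (common 1 9 (dense 3 (1 each (0 ∷ 2 ∷ 3 ∷ 4 ∷ 5 ∷ 7 ∷ 10 ∷ 11 ∷ [
    13 ])) (((5 ∷ 4 ∷ 3 ∷ [ 0 ]) , split 12 1 (split 14 1 (type (std [ 11 ↦ 2 ]) 1) (split 7 1 (split 13 1 (use
    2 1 3 (at 7)) (use 3 1 3 (at 7))) (type (std [ 13 ↦ 0 ]) 1))) (type (std [ 13 ↦ 0 ]) 1)) ∷ ((13 ∷ 11 ∷ 10 ∷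
    [ 2 ]) , type (std [ 11 ↦ 2 ]) 0) ∷ ((13 ∷ 11 ∷ 7 ∷ [ 2 ]) , split 13 0 (use 1 0 3 std) (type std 0)) ∷ [
    (13 ∷ 11 ∷ 7 ∷ [ 0 ]) , split 13 0 (use 0 0 3 std) (type std 0) ]))) ∷
  pair ([ α 4 ]) (α 0 ∷ α 1 ∷ α 2 ∷ [ β 1 ]) ＋ (common 1 3 (dense 4 (1 each (0 ∷ 1 ∷ 2 ∷ 3 ∷ 4 ∷ 5 ∷ 6 ∷ 7 ∷ 8 ∷
    9 ∷ 11 ∷ [ 13 ])) ([ (6 ∷ 5 ∷ 3 ∷ 1 ∷ [ 0 ]) , dense 4 (1 each (1 ∷ 2 ∷ 3 ∷ 4 ∷ 5 ∷ 7 ∷ 8 ∷ 9 ∷ 10 ∷ 11 ∷ 12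
    ∷ [ 14 ])) ([ (14 ∷ 12 ∷ 11 ∷ 10 ∷ [ 1 ]) , type (std [ 15 ↦ 1 ]) 0 ]) ]))) ∷
  pair ([ α 4 ]) (α 0 ∷ β 0 ∷ [ β 4 ]) ＋ (dense 3 (1 each (0 ∷ 1 ∷ 2 ∷ 3 ∷ 5 ∷ 7 ∷ 8 ∷ 9 ∷ [ 11 ])) (((7 ∷ 3 ∷ 2
    ∷ [ 1 ]) , type (std [ 11 ↦ 0 ]) 2) ∷ ((11 ∷ 9 ∷ 8 ∷ [ 0 ]) , type std 0) ∷ ((11 ∷ 9 ∷ 5 ∷ [ 1 ]) , split 11
    0 (use 0 0 2 (at 6)) (type std 0)) ∷ [ (11 ∷ 9 ∷ 5 ∷ [ 0 ]) , split 11 0 (use 41 1 0 (at 7)) (type std 0)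
    ])) ∷
  pair (α 4 ∷ [ β 4 ]) (α 0 ∷ α 1 ∷ α 2 ∷ [ β 1 ]) ＋ (common 1 9 (dense 4 (1 each (0 ∷ 1 ∷ 2 ∷ 3 ∷ 5 ∷ 6 ∷ 7 ∷ 8
    ∷ 9 ∷ 10 ∷ 11 ∷ [ 13 ])) (((6 ∷ 5 ∷ 3 ∷ 1 ∷ [ 0 ]) , type (std [ 14 ↦ 0 ]) 1) ∷ [ (11 ∷ 10 ∷ 6 ∷ 5 ∷ [ 2 ])
    , use 14 9 3 (at 0 [ 9 ↦ 0 ]) ]))) ∷
  pair (α 4 ∷ [ β 4 ]) (α 0 ∷ α 1 ∷ β 0 ∷ [ β 1 ]) ＋ (use 15 4 1 (at 5 [ 4 ↦ 0 ])) ∷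
  pair (α 4 ∷ [ β 3 ]) (α 0 ∷ α 1 ∷ α 2 ∷ [ β 1 ]) ＋ (common 1 9 (dense 4 (1 each (0 ∷ 1 ∷ 2 ∷ 3 ∷ 5 ∷ 6 ∷ 7 ∷ 8
    ∷ 9 ∷ 10 ∷ 11 ∷ [ 13 ])) ([ (6 ∷ 5 ∷ 3 ∷ 1 ∷ [ 0 ]) , type (std [ 14 ↦ 0 ]) 1 ]))) ∷
  pair (α 4 ∷ [ β 3 ]) (α 1 ∷ α 2 ∷ α 3 ∷ [ β 2 ]) ＋ (common 1 3 (dense 4 (1 each (0 ∷ 1 ∷ 2 ∷ 3 ∷ 4 ∷ 5 ∷ 6 ∷ 7
    ∷ 8 ∷ 9 ∷ 10 ∷ [ 12 ])) ([ (8 ∷ 7 ∷ 3 ∷ 1 ∷ [ 0 ]) , dense 4 (1 each (0 ∷ 1 ∷ 3 ∷ 4 ∷ 5 ∷ 6 ∷ 7 ∷ 8 ∷ 9 ∷ 10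
    ∷ 12 ∷ [ 14 ])) [] ]))) ∷
  pair (α 3 ∷ [ α 4 ]) (α 0 ∷ α 1 ∷ α 2 ∷ [ β 1 ]) ＋ (common 1 4 (dense 4 (1 each (0 ∷ 1 ∷ 2 ∷ 3 ∷ 4 ∷ 5 ∷ 6 ∷ 7
    ∷ 8 ∷ 10 ∷ 11 ∷ [ 13 ])) ([ (8 ∷ 4 ∷ 3 ∷ 1 ∷ [ 0 ]) , dense 4 (1 each (1 ∷ 2 ∷ 3 ∷ 4 ∷ 6 ∷ 7 ∷ 8 ∷ 9 ∷ 10 ∷
    11 ∷ 12 ∷ [ 14 ])) ([ (14 ∷ 12 ∷ 11 ∷ 10 ∷ [ 1 ]) , type (std [ 13 ↦ 1 ]) 0 ]) ]))) ∷
  pair (α 3 ∷ [ α 4 ]) (α 2 ∷ β 2 ∷ [ β 3 ]) ＋ (dense 4 (1 each (0 ∷ 1 ∷ 2 ∷ 3 ∷ 4 ∷ 5 ∷ 6 ∷ 7 ∷ 8 ∷ 9 ∷ 10 ∷ [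
    11 ])) ([ (11 ∷ 10 ∷ 6 ∷ 5 ∷ [ 1 ]) , use 43 1 2 (at 5 [ 4 ↦ 0 ]) ])) ∷
  pair (α 3 ∷ [ α 4 ]) (β 2 ∷ β 3 ∷ [ γ ]) ＋ (type (std [ 12 ↦ 0 ]) 1) ∷
  pair (α 3 ∷ [ α 4 ]) (β 3 ∷ β 4 ∷ [ γ ]) ＋ (type (std [ 11 ↦ 0 ]) 1) ∷
  bad (β 3 ∷ [ β 4 ]) (dense 4 (1 each (0 ∷ 2 ∷ 3 ∷ 4 ∷ 5 ∷ 6 ∷ 7 ∷ 8 ∷ 9 ∷ [ 11 ]) ++ 2 each ([ 1 ])) (((11 ∷ 9
    ∷ 8 ∷ 7 ∷ [ 0 ]) , split 11 0 (use 15 0 1 std) (type std 0)) ∷ ((6 ∷ 5 ∷ 1 ∷ [ 0 ]) , use 10 0 1 std) ∷ [ (5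
    ∷ 4 ∷ 1 ∷ [ 0 ]) , use 10 0 1 (at 7) ])) ∷
  bad (α 4 ∷ [ β 3 ]) (common 0 8 (dense 3 (1 each (0 ∷ 1 ∷ 2 ∷ 4 ∷ 5 ∷ 7 ∷ 8 ∷ 9 ∷ [ 11 ])) (((11 ∷ 9 ∷ 5 ∷ [ 1
    ]) , split 11 0 (use 4 0 2 std) (type std 0)) ∷ ((11 ∷ 8 ∷ 7 ∷ [ 0 ]) , split 13 0 (split 11 1 (split 6 1
    (use 51 0 1 (at 2)) (use 3 0 1 (at 0))) (split 6 1 (use 5 0 1 (at 0)) (split 4 1 (use 4 0 1 (at 7)) (use 9 0
    1 (at 0))))) (type std 0)) ∷ [ (5 ∷ 4 ∷ 2 ∷ [ 0 ]) , type (std [ 13 ↦ 0 ]) 1 ]))) ∷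
  bad ([ β 4 ]) (common 0 7 (dense 4 (1 each (0 ∷ 1 ∷ 2 ∷ 3 ∷ 4 ∷ 5 ∷ 6 ∷ 7 ∷ 8 ∷ 9 ∷ 10 ∷ [ 12 ])) (((10 ∷ 9 ∷
    5 ∷ 4 ∷ [ 1 ]) , type (std [ 8 ↦ 0 ]) 2) ∷ ((10 ∷ 9 ∷ 5 ∷ 4 ∷ [ 0 ]) , split 13 1 (dense 3 (1 each (1 ∷ 2 ∷
    3 ∷ 4 ∷ 7 ∷ 8 ∷ 9 ∷ 10 ∷ [ 11 ])) (((8 ∷ 7 ∷ 3 ∷ [ 2 ]) , type (std [ 11 ↦ 0 ]) 3) ∷ ((11 ∷ 10 ∷ 9 ∷ [ 2 ])
    , split 14 0 (split 13 0 (use 17 0 3 std) (type std 0)) (split 6 0 (use 16 0 3 (at 6)) (type std 0))) ∷ ((8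
    ∷ 7 ∷ 3 ∷ [ 1 ]) , type (std [ 11 ↦ 0 ]) 2) ∷ [ (8 ∷ 4 ∷ 3 ∷ [ 1 ]) , type (std [ 12 ↦ 0 ]) 2 ])) (type (std
    [ 8 ↦ 0 ]) 1)) ∷ ((12 ∷ 10 ∷ 9 ∷ 8 ∷ [ 1 ]) , split 12 0 (use 17 0 2 std) (type std 0)) ∷ [ (10 ∷ 9 ∷ 8 ∷ 4
    ∷ [ 1 ]) , use 16 0 2 (at 6) ]))) ∷
  pair (α 0 ∷ α 1 ∷ [ β 0 ]) (α 0 ∷ α 1 ∷ [ β 1 ]) － (common 1 6 (split 0 3 (split 0 6 (use 34 2 1 (at 8 [ 9 ↦ 0
    ])) (use 38 0 2 std)) (split 11 0 (split 6 0 (use 46 0 2 std) (type std 0)) (type std 0)))) ∷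
  pair (α 0 ∷ α 1 ∷ [ β 0 ]) (α 1 ∷ α 2 ∷ [ β 1 ]) － (common 0 5 (split 0 10 (split 5 0 (split 0 2 (use 30 0 2
    std) (use 40 0 2 std)) (type std 0)) (split 3 0 (split 0 5 (split 0 2 (use 35 1 2 (std [ 13 ↦ 0 ])) (type
    (std [ 13 ↦ 0 ]) 2)) (use 39 0 1 (at 3))) (type std 0)))) ∷
  pair (α 0 ∷ α 1 ∷ [ β 0 ]) (α 2 ∷ α 3 ∷ β 2 ∷ [ β 3 ]) － (common 1 6 (split 0 6 (split 11 0 (use 4 0 2 (at 5 [
    8 ↦ 1 ])) (split 3 0 (use 3 0 2 (at 5 [ 8 ↦ 1 ])) (type (std [ 8 ↦ 1 ]) 0))) (split 3 0 (use 40 0 2 std)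
    (type std 0)))) ∷
  pair (α 0 ∷ α 1 ∷ [ β 0 ]) (β 2 ∷ β 3 ∷ [ γ ]) － (type (std [ 12 ↦ 0 ]) 1) ∷
  pair [] (α 0 ∷ α 1 ∷ α 2 ∷ α 3 ∷ [ α 4 ]) ＋ (common 1 2 (split 8 0 (type (std [ 3 ↦ 1 ]) 0) (split 6 0 (type
    (std [ 3 ↦ 1 ]) 0) (dense 4 (1 each (0 ∷ 2 ∷ 4 ∷ 5 ∷ 6 ∷ 7 ∷ 8 ∷ 9 ∷ 10 ∷ [ 12 ]) ++ 2 each ([ 3 ])) (((10 ∷
    9 ∷ 5 ∷ 4 ∷ [ 2 ]) , type (std [ 8 ↦ 0 ]) 3) ∷ ((10 ∷ 9 ∷ 5 ∷ 4 ∷ [ 0 ]) , use 47 1 2 (at 3 [ 8 ↦ 0 ])) ∷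
    ((8 ∷ 7 ∷ 3 ∷ [ 2 ]) , type (std [ 4 ↦ 2 ]) 0) ∷ ((8 ∷ 4 ∷ 3 ∷ [ 2 ]) , type (std [ 4 ↦ 2 ]) 0) ∷ ((7 ∷ 6 ∷
    3 ∷ [ 2 ]) , type (std [ 4 ↦ 2 ]) 0) ∷ ((6 ∷ 5 ∷ 3 ∷ [ 2 ]) , type (std [ 4 ↦ 2 ]) 0) ∷ [ (5 ∷ 4 ∷ 3 ∷ [ 2
    ]) , type (std [ 4 ↦ 2 ]) 0 ]))))) ∷
  pair (α 4 ∷ [ β 4 ]) (α 0 ∷ α 1 ∷ [ β 0 ]) ＋ (dense 3 (1 each (0 ∷ 1 ∷ 2 ∷ 3 ∷ 6 ∷ 7 ∷ 9 ∷ 10 ∷ [ 12 ])) (((7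
    ∷ 6 ∷ 2 ∷ [ 1 ]) , use 24 2 1 (std [ 10 ↦ 0 ])) ∷ ((12 ∷ 10 ∷ 9 ∷ [ 1 ]) , type std 0) ∷ ((12 ∷ 10 ∷ 6 ∷ [ 1
    ]) , split 12 0 (use 12 0 2 std) (type std 0)) ∷ [ (12 ∷ 7 ∷ 6 ∷ [ 1 ]) , split 12 0 (use 11 0 2 std) (use
    38 0 1 std) ])) ∷
  pair (α 4 ∷ [ β 4 ]) (α 0 ∷ α 1 ∷ [ β 1 ]) ＋ (dense 3 (1 each (0 ∷ 2 ∷ 3 ∷ 5 ∷ 6 ∷ 7 ∷ 9 ∷ 10 ∷ [ 12 ])) (((7
    ∷ 3 ∷ 2 ∷ [ 0 ]) , use 13 1 2 (std [ 11 ↦ 0 ])) ∷ [ (10 ∷ 9 ∷ 5 ∷ [ 0 ]) , split 0 5 (use 12 1 2 (std [ 8 ↦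
    0 ])) (use 25 1 0 (at 2)) ])) ∷
  pair (α 4 ∷ [ β 4 ]) (α 0 ∷ α 1 ∷ α 2 ∷ [ β 1 ]) － (dense 3 (1 each (1 ∷ 2 ∷ 3 ∷ 4 ∷ 6 ∷ 7 ∷ 9 ∷ 10 ∷ [ 12 ]))
    (((7 ∷ 6 ∷ 2 ∷ [ 1 ]) , use 52 1 2 (at 5 [ 10 ↦ 0 ])) ∷ ((12 ∷ 7 ∷ 6 ∷ [ 1 ]) , dense 3 (1 each (0 ∷ 2 ∷ 3 ∷
    4 ∷ 5 ∷ 8 ∷ 11 ∷ 12 ∷ [ 13 ])) (((5 ∷ 4 ∷ 3 ∷ [ 0 ]) , use 13 1 3 (std [ 13 ↦ 0 ])) ∷ ((13 ∷ 12 ∷ 11 ∷ [ 2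
    ]) , split 8 0 (use 14 0 3 std) (type std 0)) ∷ [ (13 ∷ 12 ∷ 8 ∷ [ 2 ]) , split 8 0 (use 13 0 3 std) (use 1
    0 3 std) ])) ∷ ((10 ∷ 9 ∷ 4 ∷ [ 1 ]) , split 6 0 (use 13 0 2 (at 6)) (use 1 0 2 (at 6))) ∷ ((12 ∷ 10 ∷ 9 ∷ [
    1 ]) , type std 0) ∷ [ (12 ∷ 10 ∷ 6 ∷ [ 1 ]) , split 12 0 (use 14 0 2 std) (type std 0) ])) ∷
  pair (α 3 ∷ [ α 4 ]) (α 0 ∷ α 1 ∷ α 4 ∷ [ β 0 ]) － (common 1 4 (dense 4 (1 each (0 ∷ 2 ∷ 3 ∷ 4 ∷ 6 ∷ 7 ∷ 8 ∷ 9
    ∷ 11 ∷ [ 13 ]) ++ 2 each ([ 5 ])) (((13 ∷ 9 ∷ 8 ∷ 4 ∷ [ 0 ]) , split 12 1 (use 10 1 3 (std [ 7 ↦ 0 ]))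
    (split 4 1 (use 9 1 3 (std [ 7 ↦ 0 ])) (type (std [ 7 ↦ 0 ]) 1))) ∷ ((11 ∷ 6 ∷ 5 ∷ [ 2 ]) , use 10 0 3 std)
    ∷ ((6 ∷ 5 ∷ 3 ∷ [ 2 ]) , type (std [ 14 ↦ 0 ]) 3) ∷ [ (5 ∷ 4 ∷ 3 ∷ [ 2 ]) , type (std [ 13 ↦ 0 ]) 3 ]))) ∷
  pair (α 3 ∷ [ α 4 ]) (β 3 ∷ [ γ ]) ＋ (dense 3 (1 each (0 ∷ 1 ∷ 2 ∷ 3 ∷ 4 ∷ 5 ∷ 7 ∷ 9 ∷ [ 11 ])) (((11 ∷ 9 ∷ 5
    ∷ [ 0 ]) , split 11 0 (use 0 0 2 (at 7)) (type std 0)) ∷ ((7 ∷ 3 ∷ 2 ∷ [ 1 ]) , type (std [ 11 ↦ 0 ]) 2) ∷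
    ((5 ∷ 4 ∷ 2 ∷ [ 1 ]) , type (std [ 13 ↦ 0 ]) 2) ∷ [ (4 ∷ 3 ∷ 2 ∷ [ 1 ]) , type (std [ 12 ↦ 0 ]) 2 ])) ∷
  bad (α 3 ∷ [ α 4 ]) (common 0 3 (split 5 0 (split 10 0 (use 12 0 1 std) (split 2 0 (use 11 0 1 std) (type std
    0))) (split 3 0 (split 2 0 (use 10 0 1 std) (type std 0)) (split 2 0 (use 0 0 1 std) (type std 0))))) ∷
  bad (α 4 ∷ [ β 4 ]) (common 0 11 (dense 3 (1 each (0 ∷ 1 ∷ 2 ∷ 3 ∷ 5 ∷ 7 ∷ 9 ∷ 11 ∷ [ 12 ])) (((7 ∷ 3 ∷ 2 ∷ [
    0 ]) , split 12 1 (split 7 1 (split 11 1 (use 17 1 2 std) (use 3 1 2 std)) (type std 1)) (type (std [ 11 ↦ 0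
    ]) 1)) ∷ ((12 ∷ 11 ∷ 9 ∷ [ 1 ]) , type std 0) ∷ ((12 ∷ 11 ∷ 7 ∷ [ 1 ]) , split 7 0 (use 16 0 2 std) (use 4 0
    2 std)) ∷ ((11 ∷ 9 ∷ 5 ∷ [ 1 ]) , split 11 0 (use 17 0 2 (at 6)) (type std 0)) ∷ [ (11 ∷ 9 ∷ 5 ∷ [ 0 ]) ,
    split 11 0 (use 2 0 2 (at 6)) (type std 0) ]))) ∷
  bad ([ α 4 ]) (common 0 11 (dense 4 (1 each (0 ∷ 1 ∷ 2 ∷ 3 ∷ 4 ∷ 5 ∷ 6 ∷ 7 ∷ 8 ∷ 10 ∷ 11 ∷ [ 12 ])) (((12 ∷ 11
    ∷ 7 ∷ 6 ∷ [ 1 ]) , type (std [ 5 ↦ 0 ]) 2) ∷ ((11 ∷ 10 ∷ 6 ∷ 5 ∷ [ 0 ]) , split 8 1 (split 4 1 (use 18 1 2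
    std) (type std 1)) (type (std [ 4 ↦ 0 ]) 1)) ∷ ((12 ∷ 11 ∷ 10 ∷ 6 ∷ [ 1 ]) , use 19 0 2 std) ∷ [ (11 ∷ 10 ∷
    6 ∷ 5 ∷ [ 1 ]) , type (std [ 4 ↦ 0 ]) 2 ]))) ∷
  pair (α 0 ∷ α 1 ∷ [ β 0 ]) (α 2 ∷ β 1 ∷ [ β 2 ]) － (common 1 8 (common 2 7 (dense 3 (1 each (0 ∷ 1 ∷ 3 ∷ 4 ∷ 6
    ∷ 8 ∷ 10 ∷ 12 ∷ [ 14 ])) (((14 ∷ 12 ∷ 10 ∷ [ 0 ]) , split 5 1 (split 14 0 (split 12 0 (dense 3 (1 each (2 ∷
    4 ∷ 5 ∷ 6 ∷ 8 ∷ 10 ∷ 11 ∷ 12 ∷ [ 14 ])) (((12 ∷ 11 ∷ 6 ∷ [ 4 ]) , split 0 4 (split 2 9 (split 8 0 (use 33 4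
    0 (at 1 [ 12 ↦ 2 ])) (type (std [ 12 ↦ 2 ]) 0)) (use 48 2 5 std)) (split 8 0 (use 32 0 4 (at 7)) (use 40 4 0
    (at 5)))) ∷ ((10 ∷ 6 ∷ 5 ∷ [ 2 ]) , split 13 3 (split 8 3 (split 14 3 (use 61 3 5 std) (use 42 5 3 (at 1)))
    (type std 3)) (type std 3)) ∷ [ (14 ∷ 12 ∷ 8 ∷ [ 2 ]) , split 8 3 (split 7 3 (use 37 3 5 std) (type std 3))
    (type std 3) ])) (type std 0)) (type std 0)) (type std 1)) ∷ ((14 ∷ 12 ∷ 8 ∷ [ 1 ]) , split 14 0 (use 44 0 4
    std) (type std 0)) ∷ ((14 ∷ 12 ∷ 1 ∷ [ 0 ]) , type std 0) ∷ ((12 ∷ 10 ∷ 6 ∷ [ 3 ]) , split 12 0 (use 61 0 4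
    std) (type std 0)) ∷ ((12 ∷ 10 ∷ 6 ∷ [ 0 ]) , split 12 0 (use 55 0 4 std) (type std 0)) ∷ ((12 ∷ 6 ∷ 1 ∷ [ 0
    ]) , split 12 2 (split 6 2 (use 29 2 4 std) (type std 2)) (type std 2)) ∷ [ (6 ∷ 4 ∷ 1 ∷ [ 0 ]) , split 12 2
    (split 6 2 (use 29 2 4 std) (type std 2)) (type std 2) ])))) ∷
  pair (α 0 ∷ α 1 ∷ [ β 0 ]) (α 2 ∷ α 3 ∷ [ β 3 ]) － (common 0 1 (common 2 9 (dense 3 (1 each (1 ∷ 2 ∷ 3 ∷ 4 ∷ 6
    ∷ 9 ∷ 10 ∷ 12 ∷ [ 13 ])) (((13 ∷ 12 ∷ 10 ∷ [ 1 ]) , split 15 0 (split 12 0 (dense 2 (1 each (1 ∷ 4 ∷ 5 ∷ 10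
    ∷ 11 ∷ [ 13 ])) (((10 ∷ 5 ∷ [ 1 ]) , common 4 12 (dense 3 (1 each (0 ∷ 5 ∷ 7 ∷ 8 ∷ 9 ∷ 11 ∷ 13 ∷ 15 ∷ [ 17
    ])) (((9 ∷ 8 ∷ 7 ∷ [ 0 ]) , split 18 1 (split 13 1 (split 17 1 (use 62 1 6 (at 6)) (use 43 6 1 (at 9)))
    (type std 1)) (type std 1)) ∷ ((17 ∷ 13 ∷ 8 ∷ [ 5 ]) , split 0 13 (use 8 6 7 (std [ 11 ↦ 0 ])) (use 9 7 0
    (at 0))) ∷ [ (17 ∷ 15 ∷ 11 ∷ [ 0 ]) , split 13 1 (split 9 1 (use 31 1 7 std) (type std 1)) (type std 1) ])))
    ∷ [ (13 ∷ 11 ∷ [ 4 ]) , split 13 0 (split 8 0 (use 62 0 5 std) (type std 0)) (type std 0) ])) (type std 0))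
    (type std 0)) ∷ ((13 ∷ 10 ∷ 9 ∷ [ 2 ]) , split 15 0 (use 62 0 3 (at 6)) (type std 0)) ∷ ((13 ∷ 10 ∷ 9 ∷ [ 1
    ]) , split 15 0 (use 56 0 3 (at 6)) (type std 0)) ∷ ((12 ∷ 10 ∷ 6 ∷ [ 3 ]) , split 12 0 (use 62 0 4 std)
    (type std 0)) ∷ [ (12 ∷ 10 ∷ 6 ∷ [ 1 ]) , split 12 0 (use 56 0 4 std) (type std 0) ])))) ∷
  pair (α 0 ∷ α 1 ∷ [ β 0 ]) (β 2 ∷ [ γ ]) － (common 0 1 (common 1 7 (split 0 9 (split 0 14 (split 0 13 (use 8 2
    3 (std [ 6 ↦ 0 ])) (use 45 0 3 std)) (split 13 0 (use 33 2 0 (at 8)) (type std 0))) (split 13 0 (split 14 0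
    (split 12 0 (use 46 0 3 std) (use 11 0 3 std)) (split 12 0 (use 10 0 3 std) (type std 0))) (type std 0)))))
    ∷
  pair (α 0 ∷ α 1 ∷ [ β 0 ]) (β 3 ∷ [ γ ]) － (common 0 1 (dense 4 (1 each (0 ∷ 1 ∷ 2 ∷ 3 ∷ 4 ∷ 5 ∷ 6 ∷ 7 ∷ 8 ∷ 9
    ∷ 11 ∷ [ 13 ])) (((13 ∷ 9 ∷ 8 ∷ 4 ∷ [ 1 ]) , split 12 1 (type (std [ 7 ↦ 0 ]) 1) (use 9 2 3 (std [ 7 ↦ 0
    ]))) ∷ ((13 ∷ 9 ∷ 8 ∷ 4 ∷ [ 0 ]) , split 12 1 (split 7 1 (split 11 1 (use 45 1 3 std) (split 8 1 (use 59 1 3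
    std) (type std 1))) (type std 1)) (type (std [ 7 ↦ 0 ]) 1)) ∷ [ (11 ∷ 7 ∷ 6 ∷ 2 ∷ [ 1 ]) , use 59 0 3 std
    ]))) ∷
  pair (α 0 ∷ α 1 ∷ [ β 0 ]) (β 4 ∷ [ γ ]) ＋ (common 0 4 (split 6 0 (split 11 0 (split 10 0 (use 11 0 2 std)
    (use 44 0 2 std)) (split 10 0 (use 53 0 2 std) (type std 0))) (split 11 0 (split 9 0 (split 10 0 (use 59 0 2
    std) (type std 0)) (split 10 0 (use 2 0 2 std) (type std 0))) (split 10 0 (split 9 0 (use 45 2 0 (at 1))
    (type std 0)) (type std 0))))) ∷
  pair (α 0 ∷ α 1 ∷ α 4 ∷ [ β 0 ]) (β 2 ∷ [ γ ]) － (common 0 1 (dense 4 (1 each (0 ∷ 1 ∷ 2 ∷ 3 ∷ 4 ∷ 5 ∷ 6 ∷ 7 ∷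
    8 ∷ 9 ∷ 11 ∷ [ 12 ])) ([ (12 ∷ 11 ∷ 7 ∷ 6 ∷ [ 0 ]) , split 11 1 (split 6 1 (split 5 1 (use 36 2 1 (at 1))
    (type std 1)) (type std 1)) (type (std [ 5 ↦ 0 ]) 1) ]))) ∷
  pair (α 0 ∷ α 1 ∷ α 4 ∷ [ β 0 ]) (β 1 ∷ [ γ ]) － (common 0 1 (common 1 8 (dense 4 (2 each (0 ∷ 2 ∷ 4 ∷ 6 ∷ 9 ∷
    [ 13 ])) (((6 ∷ 4 ∷ [ 0 ]) , split 1 11 (dense 3 (1 each (1 ∷ 5 ∷ 6 ∷ 7 ∷ 9 ∷ 10 ∷ 11 ∷ 13 ∷ [ 14 ])) (((7 ∷
    6 ∷ 5 ∷ [ 1 ]) , split 16 2 (split 15 2 (use 60 4 2 std) (use 1 4 2 (at 9))) (type std 2)) ∷ [ (14 ∷ 13 ∷ 9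
    ∷ [ 1 ]) , common 4 9 (split 0 16 (split 15 0 (split 14 0 (use 60 5 0 (at 7)) (use 54 5 0 (at 7))) (type std
    0)) (split 0 6 (dense 4 (1 each (0 ∷ 1 ∷ 3 ∷ 5 ∷ 6 ∷ 7 ∷ 9 ∷ 11 ∷ 12 ∷ 13 ∷ 15 ∷ [ 16 ])) ([ (16 ∷ 15 ∷ 11 ∷
    3 ∷ [ 0 ]) , split 15 1 (split 10 1 (use 66 1 7 (at 9)) (type std 1)) (type std 1) ])) (split 15 0 (split 14
    0 (split 9 0 (use 65 0 6 std) (use 61 6 0 (at 2))) (split 9 0 (use 64 0 6 std) (type std 0))) (split 14 0
    (split 9 0 (use 64 0 6 (at 9)) (type std 0)) (type std 0))))) ])) (split 15 1 (split 14 1 (use 54 3 1 std)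
    (split 6 1 (use 37 3 1 (at 9)) (type std 1))) (type std 1))) ∷ [ (13 ∷ 9 ∷ [ 2 ]) , split 15 0 (split 11 0
    (use 60 3 0 std) (use 54 3 0 std)) (type std 0) ])))) ∷
  pair (α 0 ∷ β 0 ∷ [ β 1 ]) (β 2 ∷ [ γ ]) ＋ (common 0 4 (split 4 0 (split 10 0 (split 9 0 (use 39 0 2 std) (use
    41 2 0 (at 1))) (split 9 0 (use 35 0 2 std) (type std 0))) (split 11 0 (split 9 0 (split 10 0 (use 65 2 0
    (at 1)) (type std 0)) (split 10 0 (use 56 2 0 (at 6)) (type std 0))) (split 10 0 (split 9 0 (use 47 2 0 (at
    1)) (type std 0)) (type std 0))))) ∷
  pair (α 0 ∷ β 0 ∷ [ β 1 ]) (β 1 ∷ [ γ ]) － (common 1 11 (split 11 0 (split 6 0 (dense 1 (1 each (0 ∷ 2 ∷ [ 12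
    ])) ([ (12 ∷ [ 2 ]) , split 12 0 (split 7 0 (split 0 2 (split 11 0 (use 62 2 0 (at 7)) (use 56 2 0 (at 7)))
    (split 11 0 (use 1 2 0 (at 7)) (use 64 3 0 (at 7)))) (type std 0)) (type std 0) ])) (type std 0)) (type std
    0))) ∷
  pair (α 0 ∷ β 0 ∷ [ β 1 ]) (β 2 ∷ [ γ ]) － (common 0 1 (common 2 12 (split 12 0 (split 7 0 (dense 3 (1 each (0
    ∷ 3 ∷ 4 ∷ 5 ∷ 7 ∷ 8 ∷ 10 ∷ 12 ∷ [ 14 ])) ([ (14 ∷ 10 ∷ 5 ∷ [ 0 ]) , dense 3 (1 each (1 ∷ 5 ∷ 7 ∷ 8 ∷ 9 ∷ 10
    ∷ 11 ∷ 12 ∷ [ 14 ])) (((10 ∷ 9 ∷ 5 ∷ [ 1 ]) , common 4 8 (split 0 6 (split 0 1 (split 0 8 (common 5 11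
    (dense 4 (1 each (0 ∷ 1 ∷ 2 ∷ 4 ∷ 6 ∷ 7 ∷ 8 ∷ 9 ∷ 11 ∷ 12 ∷ 17 ∷ [ 18 ])) ([ (17 ∷ 11 ∷ 7 ∷ 2 ∷ [ 0 ]) ,
    split 19 1 (split 14 1 (use 1 7 1 std) (type std 1)) (type std 1) ]))) (split 14 0 (split 15 0 (split 13 0
    (use 69 6 0 (at 1)) (use 48 6 0 (at 6))) (split 13 0 (use 59 6 0 (at 1)) (type std 0))) (type std 0)))
    (split 13 0 (split 8 0 (use 42 0 6 (std [ 14 ↦ 1 ])) (type (std [ 14 ↦ 1 ]) 0)) (type (std [ 14 ↦ 1 ]) 0)))
    (split 8 0 (split 14 0 (split 13 0 (use 41 0 6 std) (use 43 6 0 (at 1))) (split 13 0 (use 37 0 6 std) (type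
    std 0))) (split 15 0 (split 13 0 (split 14 0 (use 67 6 0 (at 1)) (type std 0)) (split 14 0 (use 58 6 0 (at
    6)) (type std 0))) (split 14 0 (split 13 0 (use 49 6 0 (at 1)) (type std 0)) (type std 0)))))) ∷ [ (12 ∷ 11
    ∷ 7 ∷ [ 1 ]) , use 65 5 2 (at 7) ]) ])) (type std 0)) (type std 0)))) ∷
  pair (α 0 ∷ β 0 ∷ [ β 1 ]) (β 3 ∷ [ γ ]) － (common 0 1 (common 2 12 (split 12 0 (split 7 0 (split 0 2 (split
    11 0 (use 64 2 0 (at 2)) (use 5 2 0 (at 7))) (split 0 11 (use 3 2 0 (at 2)) (use 66 3 0 (at 7)))) (type std
    0)) (type std 0)))) ∷
  pair (α 0 ∷ α 1 ∷ β 0 ∷ [ β 1 ]) (β 3 ∷ [ γ ]) － (common 0 1 (split 0 10 (split 11 0 (split 6 0 (use 59 1 0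
    (at 2)) (type std 0)) (split 9 0 (split 4 0 (use 59 1 0 (at 5)) (type std 0)) (type std 0))) (split 11 0
    (type std 0) (split 9 0 (type std 0) (type (std [ 5 ↦ 2 ]) 0))))) ∷
  pair [] (α 0 ∷ β 0 ∷ [ β 1 ]) ＋ (common 1 4 (common 1 12 (split 12 0 (split 7 0 (dense 3 (1 each (1 ∷ 2 ∷ 3 ∷
    4 ∷ 6 ∷ 8 ∷ 9 ∷ 10 ∷ [ 12 ])) (((9 ∷ 8 ∷ 4 ∷ [ 3 ]) , type (std [ 12 ↦ 0 ]) 4) ∷ ((9 ∷ 8 ∷ 4 ∷ [ 1 ]) ,
    dense 4 (1 each (0 ∷ 1 ∷ 2 ∷ 3 ∷ 4 ∷ 5 ∷ 7 ∷ 8 ∷ 9 ∷ 11 ∷ 14 ∷ [ 15 ])) (((15 ∷ 14 ∷ 11 ∷ 4 ∷ [ 0 ]) , split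
    14 0 (split 13 0 (use 17 0 5 std) (type std 0)) (type std 0)) ∷ ((15 ∷ 11 ∷ 4 ∷ 1 ∷ [ 0 ]) , split 7 0
    (split 13 0 (use 73 0 2 (at 7)) (split 13 2 (use 73 2 0 (at 0)) (use 63 2 0 (at 0)))) (type std 0)) ∷ [ (11
    ∷ 7 ∷ 4 ∷ 1 ∷ [ 0 ]) , split 13 0 (split 7 0 (use 44 0 4 std) (use 52 4 0 (at 1))) (split 7 0 (use 40 0 4
    std) (type std 0)) ])) ∷ ((12 ∷ 10 ∷ 6 ∷ [ 3 ]) , split 12 0 (use 70 3 0 (at 1)) (type std 0)) ∷ ((12 ∷ 10 ∷
    6 ∷ [ 2 ]) , split 12 0 (use 72 3 0 (at 1)) (type std 0)) ∷ [ (12 ∷ 10 ∷ 2 ∷ [ 1 ]) , type std 0 ])) (type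
    std 0)) (type std 0)))) ∷
  pair [] (α 0 ∷ α 1 ∷ β 0 ∷ [ β 1 ]) ＋ (type (std [ 4 ↦ 0 ]) 1) ∷
  pair [] (β 0 ∷ β 1 ∷ [ γ ]) ＋ (type (std [ 9 ↦ 0 ]) 1) ∷
  pair ([ γ ]) (α 0 ∷ β 0 ∷ [ β 1 ]) ＋ (common 1 4 (common 1 12 (split 12 0 (split 7 0 (dense 4 (1 each (0 ∷ 1 ∷
    2 ∷ 3 ∷ 4 ∷ 5 ∷ 6 ∷ 7 ∷ 8 ∷ 11 ∷ 13 ∷ [ 14 ])) (((13 ∷ 11 ∷ 7 ∷ 2 ∷ [ 1 ]) , split 11 2 (split 6 2 (use 43 2
    3 std) (type std 2)) (type std 2)) ∷ ((14 ∷ 11 ∷ 5 ∷ 3 ∷ [ 0 ]) , use 71 3 1 (at 7)) ∷ ((14 ∷ 11 ∷ 5 ∷ 1 ∷ [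
    0 ]) , split 13 2 (split 8 2 (use 49 2 3 std) (type std 2)) (type std 2)) ∷ [ (11 ∷ 6 ∷ 5 ∷ 3 ∷ [ 0 ]) , use
    71 3 1 (at 7) ])) (type std 0)) (type std 0)))) ∷
  pair ([ γ ]) (α 0 ∷ α 1 ∷ β 0 ∷ [ β 1 ]) ＋ (use 4 1 4 (std [ 4 ↦ 0 ])) ∷
  bad ([ γ ]) (dense 2 (1 each (0 ∷ 2 ∷ 3 ∷ 4 ∷ 5 ∷ [ 6 ])) (((6 ∷ 5 ∷ [ 0 ]) , split 12 0 (split 11 0 (use 0 0
    1 std) (use 1 0 1 std)) (split 11 0 (use 1 0 1 (at 8)) (type std 0))) ∷ ((6 ∷ 2 ∷ [ 0 ]) , split 12 0 (split
    8 0 (use 0 0 1 (at 0)) (use 1 0 1 (at 9))) (split 8 0 (use 1 0 1 (at 0)) (type std 0))) ∷ ((5 ∷ 4 ∷ [ 0 ]) ,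
    split 11 0 (split 10 0 (use 0 0 1 (at 3)) (use 1 0 1 (at 3))) (split 10 0 (use 1 0 1 (at 7)) (type std 0)))
    ∷ ((4 ∷ 3 ∷ [ 0 ]) , split 10 0 (split 9 0 (use 0 0 1 (at 2)) (use 1 0 1 (at 2))) (split 9 0 (use 1 0 1 (at
    6)) (type std 0))) ∷ [ (3 ∷ 2 ∷ [ 0 ]) , split 9 0 (split 8 0 (use 0 0 1 (at 1)) (use 1 0 1 (at 1))) (split
    8 0 (use 1 0 1 (at 5)) (type std 0)) ])) ∷
  bad [] (dense 2 (1 each (0 ∷ 2 ∷ 3 ∷ 4 ∷ 5 ∷ [ 6 ])) (((6 ∷ 5 ∷ [ 0 ]) , split 12 0 (split 11 0 (use 3 0 1
    std) (use 4 0 1 std)) (split 11 0 (use 4 0 1 (at 8)) (split 2 0 (use 2 0 1 std) (type std 0)))) ∷ ((6 ∷ 2 ∷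
    [ 0 ]) , split 12 0 (split 8 0 (use 3 0 1 (at 0)) (use 4 0 1 (at 9))) (split 8 0 (use 4 0 1 (at 0)) (split 2
    0 (use 2 0 1 (at 0)) (type std 0)))) ∷ ((5 ∷ 4 ∷ [ 0 ]) , split 11 0 (split 10 0 (use 3 0 1 (at 3)) (use 4 0
    1 (at 3))) (split 10 0 (use 4 0 1 (at 7)) (split 2 0 (use 2 0 1 (at 3)) (type std 0)))) ∷ ((4 ∷ 3 ∷ [ 0 ]) ,
    split 10 0 (split 9 0 (use 3 0 1 (at 2)) (use 4 0 1 (at 2))) (split 9 0 (use 4 0 1 (at 6)) (split 2 0 (use 2
    0 1 (at 2)) (type std 0)))) ∷ [ (3 ∷ 2 ∷ [ 0 ]) , split 9 0 (split 8 0 (use 3 0 1 (at 1)) (use 4 0 1 (at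
    1))) (split 8 0 (use 4 0 1 (at 5)) (split 2 0 (use 2 0 1 (at 1)) (type std 0))) ])) ∷
  pair (α 0 ∷ α 1 ∷ [ β 0 ]) (α 0 ∷ α 4 ∷ [ β 0 ]) － (common 1 8 (common 2 7 (dense 3 (1 each (0 ∷ 3 ∷ 4 ∷ 5 ∷ 7
    ∷ 8 ∷ 9 ∷ 11 ∷ [ 13 ])) (((9 ∷ 5 ∷ 4 ∷ [ 0 ]) , split 13 1 (split 8 1 (use 73 1 4 std) (type std 1)) (type
    std 1)) ∷ ((8 ∷ 7 ∷ 4 ∷ [ 3 ]) , split 0 3 (split 12 2 (split 7 2 (split 13 2 (use 58 2 3 (at 9 [ 11 ↦ 0 ]))
    (split 6 2 (use 16 2 3 (at 9 [ 11 ↦ 0 ])) (type (std [ 11 ↦ 0 ]) 2))) (type (std [ 11 ↦ 0 ]) 2)) (type (std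
    [ 11 ↦ 0 ]) 2)) (type (std [ 11 ↦ 0 ]) 3)) ∷ [ (13 ∷ 11 ∷ 7 ∷ [ 0 ]) , split 5 1 (use 65 1 4 std) (type std
    1) ])))) ∷
  pair (α 0 ∷ α 1 ∷ [ β 0 ]) (α 4 ∷ β 3 ∷ [ β 4 ]) － (dense 3 (1 each (1 ∷ 2 ∷ 3 ∷ 5 ∷ 6 ∷ 7 ∷ 8 ∷ 9 ∷ [ 11 ]))
    (((9 ∷ 8 ∷ 3 ∷ [ 1 ]) , split 0 5 (use 50 2 1 (at 5 [ 7 ↦ 0 ])) (use 47 0 2 std)) ∷ [ (6 ∷ 5 ∷ 2 ∷ [ 1 ]) ,
    split 0 1 (common 2 9 (split 11 0 (split 6 0 (split 12 0 (use 48 2 0 (at 6 [ 10 ↦ 1 ])) (split 5 0 (use 64 2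
    0 (at 1 [ 10 ↦ 1 ])) (type (std [ 10 ↦ 1 ]) 0))) (type (std [ 10 ↦ 1 ]) 0)) (type (std [ 10 ↦ 1 ]) 0)))
    (type (std [ 9 ↦ 0 ]) 1) ])) ∷
  pair (α 0 ∷ α 1 ∷ [ β 0 ]) (β 1 ∷ [ γ ]) － (dense 3 (1 each (1 ∷ 2 ∷ 3 ∷ 5 ∷ 6 ∷ 7 ∷ 8 ∷ 9 ∷ [ 11 ])) (((9 ∷ 8
    ∷ 3 ∷ [ 1 ]) , common 2 7 (split 1 6 (split 7 0 (split 4 0 (use 12 2 3 (std [ 10 ↦ 0 ])) (type (std [ 8 ↦ 1
    ]) 0)) (type (std [ 8 ↦ 1 ]) 0)) (use 48 1 3 std))) ∷ [ (6 ∷ 5 ∷ 2 ∷ [ 1 ]) , use 12 1 2 (std [ 9 ↦ 0 ]) ]))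
    ∷
  pair (α 0 ∷ α 1 ∷ [ β 0 ]) (β 0 ∷ [ γ ]) － (common 1 8 (common 2 7 (dense 2 (1 each (0 ∷ 4 ∷ 6 ∷ 8 ∷ 12 ∷ [ 14
    ])) (((14 ∷ 12 ∷ [ 0 ]) , split 5 1 (split 14 0 (split 12 0 (split 11 0 (split 2 6 (split 1 8 (split 12 2
    (split 7 2 (split 2 3 (use 12 3 2 (at 1 [ 11 ↦ 1 ])) (use 10 3 2 (at 1 [ 11 ↦ 1 ]))) (type (std [ 11 ↦ 1 ])
    2)) (type (std [ 11 ↦ 1 ]) 2)) (use 68 1 4 std)) (split 12 2 (split 7 2 (split 13 2 (use 81 2 4 std) (use 62
    4 2 (at 1))) (type std 2)) (type std 2))) (type std 0)) (type std 0)) (type std 0)) (type std 1)) ∷ ((14 ∷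
    12 ∷ [ 8 ]) , split 14 0 (use 64 0 4 std) (type std 0)) ∷ ((12 ∷ 6 ∷ [ 0 ]) , split 8 0 (split 12 0 (use 27
    0 4 std) (use 60 0 4 std)) (split 11 0 (split 12 0 (use 75 0 4 std) (type std 0)) (split 12 0 (use 18 0 4
    std) (type std 0)))) ∷ [ (6 ∷ 4 ∷ [ 0 ]) , split 13 1 (split 8 1 (use 76 1 4 std) (type std 1)) (type std 1)
    ])))) ∷
  pair (α 0 ∷ α 1 ∷ [ β 0 ]) (β 4 ∷ [ γ ]) － (dense 3 (1 each (1 ∷ 2 ∷ 3 ∷ 5 ∷ 6 ∷ 7 ∷ 8 ∷ 9 ∷ [ 11 ])) (((9 ∷ 8
    ∷ 3 ∷ [ 1 ]) , common 2 7 (split 1 6 (split 7 0 (split 4 0 (use 14 2 3 (at 9 [ 10 ↦ 0 ])) (type (std [ 8 ↦ 1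
    ]) 0)) (type (std [ 8 ↦ 1 ]) 0)) (use 50 1 3 std))) ∷ [ (6 ∷ 5 ∷ 2 ∷ [ 1 ]) , use 14 1 2 (at 9 [ 9 ↦ 0 ])
    ])) ∷
  pair (α 0 ∷ β 0 ∷ [ β 1 ]) (β 3 ∷ [ γ ]) ＋ (common 1 11 (split 11 0 (split 6 0 (split 10 0 (use 15 1 0 (at 2))
    (use 0 1 0 (at 7))) (type std 0)) (type std 0))) ∷
  pair (α 0 ∷ β 0 ∷ [ β 1 ]) (β 0 ∷ [ γ ]) － (dense 3 (1 each (0 ∷ 2 ∷ 3 ∷ 4 ∷ 5 ∷ 6 ∷ 7 ∷ 8 ∷ [ 11 ])) (((8 ∷ 4
    ∷ 3 ∷ [ 0 ]) , split 0 2 (common 1 7 (split 1 11 (split 13 0 (split 12 0 (split 7 0 (use 22 3 0 (at 7 [ 8 ↦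
    1 ])) (type (std [ 8 ↦ 1 ]) 0)) (type (std [ 8 ↦ 1 ]) 0)) (type (std [ 8 ↦ 1 ]) 0)) (use 56 1 3 std)))
    (split 10 0 (use 55 0 2 std) (use 51 0 2 std))) ∷ [ (11 ∷ 6 ∷ 5 ∷ [ 0 ]) , common 1 4 (split 1 12 (split 11
    0 (split 10 0 (split 6 0 (split 0 3 (use 73 3 0 (at 1 [ 5 ↦ 1 ])) (type (std [ 8 ↦ 0 ]) 3)) (type (std [ 5 ↦
    1 ]) 0)) (type (std [ 5 ↦ 1 ]) 0)) (type (std [ 5 ↦ 1 ]) 0)) (use 68 1 3 std)) ])) ∷
  pair (α 0 ∷ α 1 ∷ [ β 0 ]) (β 3 ∷ [ γ ]) ＋ (common 1 8 (common 2 7 (dense 3 (1 each (0 ∷ 3 ∷ 4 ∷ 5 ∷ 7 ∷ 8 ∷ 9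
    ∷ 11 ∷ [ 13 ])) (((9 ∷ 5 ∷ 4 ∷ [ 0 ]) , split 13 1 (split 8 1 (use 80 1 4 std) (type std 1)) (type std 1)) ∷
    ((8 ∷ 7 ∷ 4 ∷ [ 3 ]) , split 12 2 (split 7 2 (split 13 2 (use 3 3 2 (at 6 [ 11 ↦ 0 ])) (split 6 2 (use 0 3 2
    (at 1 [ 11 ↦ 0 ])) (type (std [ 11 ↦ 0 ]) 2))) (type (std [ 11 ↦ 0 ]) 2)) (type (std [ 11 ↦ 0 ]) 2)) ∷ [ (13
    ∷ 11 ∷ 7 ∷ [ 0 ]) , split 5 1 (use 72 1 4 std) (type std 1) ])))) ∷
  pair (β 0 ∷ [ γ ]) (β 1 ∷ [ γ ]) － (dense 3 (1 each (1 ∷ 2 ∷ 3 ∷ 4 ∷ 5 ∷ 6 ∷ 7 ∷ 8 ∷ [ 11 ])) (((8 ∷ 4 ∷ 3 ∷ [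
    1 ]) , split 0 1 (common 2 7 (split 1 11 (split 13 0 (split 12 0 (split 7 0 (use 5 2 0 (at 7 [ 8 ↦ 1 ]))
    (type (std [ 8 ↦ 1 ]) 0)) (type (std [ 8 ↦ 1 ]) 0)) (type (std [ 8 ↦ 1 ]) 0)) (use 56 3 1 (at 5)))) (split
    10 0 (use 13 1 0 (at 1)) (use 14 1 0 (at 5)))) ∷ [ (11 ∷ 6 ∷ 5 ∷ [ 1 ]) , common 2 4 (split 0 2 (split 1 12
    (split 11 0 (split 10 0 (split 6 0 (use 0 2 0 (at 1 [ 5 ↦ 1 ])) (type (std [ 5 ↦ 1 ]) 0)) (type (std [ 5 ↦ 1
    ]) 0)) (type (std [ 5 ↦ 1 ]) 0)) (use 56 3 1 (at 3))) (split 6 0 (split 11 0 (split 10 0 (use 13 2 0 (at 1))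
    (use 14 2 0 (at 1))) (split 10 0 (use 14 2 0 (at 5)) (type std 0))) (split 14 0 (split 11 0 (split 10 0 (use
    19 2 0 (at 0)) (type std 0)) (split 10 0 (use 22 2 0 (at 0)) (type std 0))) (split 11 0 (split 10 0 (use 21
    2 0 (at 5)) (type std 0)) (type std 0))))) ])) ∷
  pair (β 0 ∷ [ γ ]) (β 2 ∷ [ γ ]) － (dense 3 (1 each (1 ∷ 2 ∷ 3 ∷ 4 ∷ 5 ∷ 6 ∷ 7 ∷ 8 ∷ [ 11 ])) (((8 ∷ 4 ∷ 3 ∷ [
    1 ]) , common 2 7 (split 1 11 (split 13 0 (split 12 0 (split 7 0 (split 1 2 (use 21 2 1 (at 1 [ 5 ↦ 0 ]))
    (use 4 2 1 (at 1 [ 5 ↦ 0 ]))) (type (std [ 8 ↦ 1 ]) 0)) (type (std [ 8 ↦ 1 ]) 0)) (type (std [ 8 ↦ 1 ]) 0))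
    (use 57 3 1 (at 5)))) ∷ [ (11 ∷ 6 ∷ 5 ∷ [ 1 ]) , common 2 4 (split 1 12 (split 11 0 (split 10 0 (split 6 0
    (split 0 2 (use 21 2 0 (at 1 [ 5 ↦ 1 ])) (use 4 2 0 (at 1 [ 5 ↦ 1 ]))) (type (std [ 5 ↦ 1 ]) 0)) (type (std
    [ 5 ↦ 1 ]) 0)) (type (std [ 5 ↦ 1 ]) 0)) (use 57 3 1 (at 3))) ])) ∷
  pair (α 0 ∷ α 1 ∷ [ β 0 ]) (α 1 ∷ α 2 ∷ [ β 2 ]) － (common 1 6 (common 2 9 (dense 3 (1 each (1 ∷ 3 ∷ 4 ∷ 5 ∷ 7
    ∷ 8 ∷ 9 ∷ 11 ∷ [ 13 ])) (((9 ∷ 5 ∷ 4 ∷ [ 1 ]) , split 13 2 (split 8 2 (use 83 2 4 std) (type std 2)) (type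
    std 2)) ∷ ((8 ∷ 7 ∷ 4 ∷ [ 3 ]) , split 12 1 (split 7 1 (split 13 1 (use 35 3 1 (at 6 [ 11 ↦ 0 ])) (split 6 1
    (split 1 3 (use 64 1 3 (at 7 [ 11 ↦ 0 ])) (use 8 1 3 (at 7 [ 11 ↦ 0 ]))) (type (std [ 11 ↦ 0 ]) 1))) (type
    (std [ 11 ↦ 0 ]) 1)) (type (std [ 11 ↦ 0 ]) 1)) ∷ [ (13 ∷ 11 ∷ 7 ∷ [ 1 ]) , split 5 2 (use 75 2 4 std) (type
    std 2) ])))) ∷
  []

-- Search for a rotation suitable for all vertices

-- The neighbourhoods in Υ that are possible when the hubs a, b, c are c, b₂, b₃,
-- the antihubs u, v, w are b₀, a₁, a₄, and x is a₀.
table : List (Row × Class)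
table = (row (α 0 ∷ α 1 ∷ α 2 ∷ α 3 ∷ α 4 ∷ []) , hub 0₃)
      ∷ (row (α 0 ∷ α 4 ∷ β 0 ∷ β 4 ∷ [])       , hub 1₃)
      ∷ (row (α 0 ∷ α 1 ∷ β 0 ∷ β 1 ∷ [])       , hub 2₃)
      ∷ (row (α 2 ∷ α 3 ∷ β 2 ∷ β 3 ∷ [])       , anti 0₃)
      ∷ (row (β 3 ∷ β 4 ∷ γ ∷ [])               , anti 1₃)
      ∷ (row (β 1 ∷ β 2 ∷ γ ∷ [])               , anti 2₃)
      ∷ (row (β 2 ∷ β 3 ∷ γ ∷ [])               , X)
      ∷ (row (α 0 ∷ α 1 ∷ α 4 ∷ β 0 ∷ [])       , Y)
      ∷ (row (β 0 ∷ γ ∷ [])                     , R 0₃)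
      ∷ (row (β 0 ∷ β 4 ∷ γ ∷ [])               , R 0₃)
      ∷ (row (β 0 ∷ β 1 ∷ γ ∷ [])               , R 0₃)
      ∷ (row (α 1 ∷ α 2 ∷ β 2 ∷ [])             , R 1₃)
      ∷ (row (α 1 ∷ α 2 ∷ α 3 ∷ β 2 ∷ [])       , R 1₃)
      ∷ (row (α 1 ∷ β 1 ∷ β 2 ∷ [])             , R 1₃)
      ∷ (row (α 1 ∷ α 2 ∷ β 1 ∷ β 2 ∷ [])       , R 1₃)
      ∷ (row (α 3 ∷ α 4 ∷ β 3 ∷ [])             , R 2₃)
      ∷ (row (α 2 ∷ α 3 ∷ α 4 ∷ β 3 ∷ [])       , R 2₃)
      ∷ (row (α 4 ∷ β 3 ∷ β 4 ∷ [])             , R 2₃)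
      ∷ (row (α 3 ∷ α 4 ∷ β 3 ∷ β 4 ∷ [])       , R 2₃)
      ∷ []

find : List (Row × Class) → Row → Maybe Class
find []             σ = nothing
find ((τ , C) ∷ ts) σ = if sameRow τ σ then just C else find ts σ

good : List ℕ → Row → Bool
good e σ = is-just (find table (along e σ))

shares : Row → Row → Bool
shares (f ∷ σ) (g ∷ τ) = (is＋ f ∧ is＋ g) ∨ shares σ τ
shares _       _       = false

instanceOf : Row → Row → Fact → Pair → Bool
instanceOf σ τ f (σ₀ , τ₀ , g) =
  f == g ∧ ((sameRow σ σ₀ ∧ sameRow τ τ₀) ∨ (sameRow τ σ₀ ∧ sameRow σ τ₀))

rejects : List (List ℕ) → List Pair → Row → Row → Fact → Bool
rejects Es Kn σ τ f = (is＋ f ∧ shares σ τ) ∨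
  any (λ e → any (instanceOf (along e σ) (along e τ) f) Kn) Es

-- Two vertices are adjacent or not; if neither is possible for these rows, they do not occur
-- together in one graph.
excluded : List (List ℕ) → List Pair → Row → Row → Bool
excluded Es Kn σ τ = rejects Es Kn σ τ ＋ ∧ rejects Es Kn σ τ －

-- Rows of several vertices about whose mutual adjacency nothing is said.
joint : List Row → State
joint []       = Υs
joint (σ ∷ σs) = (map (λ _ → ？) σs ++ σ) ∷ joint σs

-- Tested when one bad row has been chosen for every rotation without any pair being excluded. What
-- then remains must contain an image of the single forbidden triple.
clique : List (List ℕ) → State → List Row → Bool
clique Es l σs = any (λ e → any (λ i → any (λ j → any (λ k →
    occurs (joint σs) l (i ∷ j ∷ k ∷ map (length σs +_) e)) ns) ns) ns) Es
  where
  ns : List ℕ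
  ns = upTo (length σs)

-- Vertices whose rows are bad for each of the rotations cannot exist besides
-- vertices with rows σs.
conflict : List (List ℕ) → List Row → List Pair → State → List Row → List (List ℕ) → Bool
conflict Es Ts Kn l σs []       = clique Es l σs
conflict Es Ts Kn l σs (r ∷ rs) =
  if any (λ σ → not (good r σ)) σs then conflict Es Ts Kn l σs rs
  else all (λ τ → good r τ ∨ (any (excluded Es Kn τ) σs ∨ conflict Es Ts Kn l (τ ∷ σs) rs)) Ts

consistent : List (List ℕ) → List Pair → Bool
consistent Es Kn = all (λ (σ , C) → all (λ (τ , D) → does (compat? C D) ∨ rejects Es Kn σ τ ＋) table) table

full : Row → Bool
full = all (λ f → is＋ f ∨ is－ f)

-- Correctness of the search

all-∈ : ∀ {A : Set} {p : A → Bool} {x xs} → all p xs ≡ true → x ∈ xs → p x ≡ true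
all-∈ {p = p} {xs = y ∷ _} e (here refl) = proj₁ (∧-true {p y} e)
all-∈ {p = p} {xs = y ∷ _} e (there x∈)  = all-∈ (proj₂ (∧-true {p y} e)) x∈

any-∃ : ∀ {A : Set} {p : A → Bool} xs → any p xs ≡ true → ∃[ x ] (x ∈ xs × p x ≡ true)
any-∃ {p = p} (x ∷ xs) e with ∨-true {p x} e
... | inj₁ e₁ = x , here refl , e₁
... | inj₂ e₂ with any-∃ xs e₂
...   | y , y∈ , py = y , there y∈ , py

filter-Any : ∀ {A : Set} {P : A → Set} {p : A → Bool} {xs} →
             (∀ {x} → P x → p x ≡ true) → Any P xs → Any P (filterᵇ p xs)
filter-Any {p = p} {x ∷ xs} h (here px) rewrite h px = here px
filter-Any {p = p} {x ∷ xs} h (there a) with p x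
... | true  = there (filter-Any h a)
... | false = filter-Any h a

==⇒≡ : ∀ f g → f == g ≡ true → f ≡ g
==⇒≡ ＋ ＋ _ = refl
==⇒≡ － － _ = refl

sameRow⇒≡ : ∀ σ τ → sameRow σ τ ≡ true → σ ≡ τ
sameRow⇒≡ []      []      _ = refl
sameRow⇒≡ (f ∷ σ) (g ∷ τ) e with ∧-true {f == g} e
... | e₁ , e₂ = cong₂ _∷_ (==⇒≡ f g e₁) (sameRow⇒≡ σ τ e₂)

find-∈ : ∀ ts σ {C} → find ts σ ≡ just C → (σ , C) ∈ ts
find-∈ ((τ , D) ∷ ts) σ e with sameRow τ σ in eq
find-∈ ((τ , D) ∷ ts) σ refl | true = here (cong (_, D) (sym (sameRow⇒≡ τ σ eq)))
find-∈ ((τ , D) ∷ ts) σ e | false = there (find-∈ ts σ e)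

classes : List Class
classes = hub 0₃ ∷ hub 1₃ ∷ hub 2₃ ∷ anti 0₃ ∷ anti 1₃ ∷ anti 2₃ ∷ R 0₃ ∷ R 1₃ ∷ R 2₃ ∷ X ∷ Y ∷ []

class∈ : ∀ C → C ∈ classes
class∈ (hub 0₃)  = here refl
class∈ (hub 1₃)  = there (here refl)
class∈ (hub 2₃)  = there (there (here refl))
class∈ (anti 0₃) = there (there (there (here refl)))
class∈ (anti 1₃) = there (there (there (there (here refl))))
class∈ (anti 2₃) = there (there (there (there (there (here refl)))))
class∈ (R 0₃)    = there (there (there (there (there (there (here refl))))))
class∈ (R 1₃)    = there (there (there (there (there (there (there (here refl)))))))
class∈ (R 2₃)    = there (there (there (there (there (there (there (there (here refl))))))))
class∈ X         = there (there (there (there (there (there (there (there (there (here refl)))))))))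
class∈ Y         = there (there (there (there (there (there (there (there (there (there (here refl))))))))))

triangle : Class → Class → Class → Bool
triangle C D E = not (does (link? C D) ∧ (does (compat? C E) ∧ does (compat? E D)))

no-triangle : all (λ C → all (λ D → all (triangle C D) classes) classes) classes ≡ true
no-triangle = refl

-- A finite check over all triples of classes. Together with maximality it forces every edge between
-- linked classes: a missing one would have a common neighbour, compatible with both ends.
link-no-common : ∀ {C D E} → Link C D → SymClosure Compat C E → ¬ SymClosure Compat E D
link-no-common {C} {D} {E} l p q = go (link? C D) (compat? C E) (compat? E D)
  (all-∈ {p = triangle C D} (all-∈ {p = λ D → all (triangle C D) classes}
    (all-∈ {p = λ C → all (λ D → all (triangle C D) classes) classes} no-triangle (class∈ C)) (class∈ D)) (class∈ E))
  where
  go : (x : Dec (Link C D)) (y : Dec (SymClosure Compat C E)) (z : Dec (SymClosure Compat E D)) →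
       ¬ not (does x ∧ (does y ∧ does z)) ≡ true
  go (yes _) (yes _) (yes _) ()
  go (no ¬l) _       _       _ = ¬l l
  go (yes _) (no ¬p) _       _ = ¬p p
  go (yes _) (yes _) (no ¬q) _ = ¬q q

module Local {n} (G : Graph (Fin n)) (_~?_ : Decidable (Adj G))
  (triangle-free : ∀ {x y z} → Adj G x y → Adj G y z → Adj G z x → ⊥)
  (common-nbr : ∀ {x y} → ¬ Adj G x y → ∃[ z ] (Adj G x z × Adj G z y)) (v₀ : Fin n) where

  private
    V : Set
    V = Fin n
    _~_ : V → V → Set
    _~_ = Adj G

  open Soundness _~_ _~?_ (adj-sym G) triangle-free common-nbr v₀

  rowOf : V → List V → Row
  rowOf z = map (λ u → if does (z ~? u) then ＋ else －)

  rowOf-ok : ∀ z vs → RowOK z (rowOf z vs) vs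
  rowOf-ok z []       j = tt
  rowOf-ok z (u ∷ vs) zero with z ~? u
  ... | yes e = e
  ... | no ¬e = ¬e
  rowOf-ok z (u ∷ vs) (suc j) = rowOf-ok z vs j

  full-unique : ∀ {z} σ vs → full σ ≡ true → length σ ≡ length vs → RowOK z σ vs → σ ≡ rowOf z vs
  full-unique []      []       _ _ _ = refl
  full-unique {z} (f ∷ σ) (u ∷ vs) e l ok with ∧-true {is＋ f ∨ is－ f} e
  ... | e₁ , e₂ =
      cong₂ _∷_ (head f e₁ (ok 0)) (full-unique σ vs e₂ (cong Data.Nat.Base.pred l) (λ j → ok (suc j)))
    where
    head : ∀ f → (is＋ f ∨ is－ f) ≡ true → Holds f z u → f ≡ (if does (z ~? u) then ＋ else －)
    head ＋ _ h with z ~? u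
    ... | yes _ = refl
    ... | no ¬e = ⊥-elim (¬e h)
    head － _ h with z ~? u
    ... | yes e = ⊥-elim (h e)
    ... | no _  = refl

  OK-length : ∀ {s vs} → OK s vs → length vs ≡ length s
  OK-length []      = refl
  OK-length (_ ∷ o) = cong suc (OK-length o)

  any-row : ∀ z vs → Any (λ τ → RowOK z τ vs) (rows (length vs))
  any-row z []       = here λ _ → tt
  any-row z (u ∷ vs) =
      cartesianProductWith⁺ _∷_ (λ h ok → λ { zero → h ; (suc j) → ok j }) (heads (z ~? u)) (any-row z vs)
    where
    heads : Dec (z ~ u) → Any (λ f → Holds f z u) (＋ ∷ － ∷ [])
    heads (yes e) = here e
    heads (no ¬e) = there (here ¬e)

  no-clash : ∀ {vs z τ} → OK Υs vs → RowOK z τ vs → not (clash τ) ≡ true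
  no-clash {vs} {z} {τ} o ok with clash τ in eq
  ... | false = refl
  ... | true with any-∃ (downFrom 11) eq
  ... | i , _ , e with any-∃ (downFrom 11) e
  ... | j , _ , e′ with ∧-true {is＋ (nthF τ i)} e′
  ... | pᵢ , e″ with ∧-true {is＋ (nthF τ j)} e″
  ... | pⱼ , ij = ⊥-elim (triangle-free (is＋-holds (nthF τ i) pᵢ (ok i)) (adj?-sound i j o ij)
                                        (adj-sym G (is＋-holds (nthF τ j) pⱼ (ok j))))

  unclashing-ok : ∀ {vs} m z → OK Υs vs → length vs ≡ m → Any (λ τ → RowOK z τ vs) (unclashing (rows m))
  unclashing-ok {vs} m z o refl =
      filter-Any {P = λ τ → RowOK z τ vs} (λ {τ} → no-clash {vs} {z} {τ} o) (any-row z vs)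

  allTypes-ok : TypeThm Υs allTypes
  allTypes-ok z o = unclashing-ok 11 z o (OK-length o)

  rowOf∈ : ∀ Ts → TypeThm Υs Ts → all (λ σ → full σ ∧ (length σ ≡ᵇ 11)) Ts ≡ true → ∀ {vs} z → OK Υs vs → rowOf z vs ∈ Ts
  rowOf∈ Ts types fulls {vs} z o = go Ts fulls (types z o)
    where
    go : ∀ Us → all (λ σ → full σ ∧ (length σ ≡ᵇ 11)) Us ≡ true → Any (λ τ → RowOK z τ vs) Us → rowOf z vs ∈ Us
    go (σ ∷ Us) e (there a) = there (go Us (proj₂ (∧-true {full σ ∧ (length σ ≡ᵇ 11)} e)) a)
    go (σ ∷ Us) e (here ok) with ∧-true {full σ} (proj₁ (∧-true {full σ ∧ (length σ ≡ᵇ 11)} e))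
    ... | e₁ , e₂ = here (sym (full-unique σ vs e₁ (trans (≡ᵇ-true {length σ} e₂) (sym (OK-length o))) ok))

  Realized : List V → Row → Set
  Realized vs σ = ∃[ z ] RowOK z σ vs

  along-ok : ∀ {z σ vs} e → RowOK z σ vs → RowOK z (along e σ) (vers vs e)
  along-ok []      ok j       = tt
  along-ok (i ∷ e) ok zero    = ok i
  along-ok {z} {σ} {vs} (i ∷ e) ok (suc j) = along-ok {z} {σ} {vs} e ok j

  cons-ok : ∀ {f v u r vs} → Holds f v u → RowOK v r vs → RowOK v (f ∷ r) (u ∷ vs)
  cons-ok h ok zero    = h
  cons-ok h ok (suc j) = ok j

  module Symmetric (Es : List (List ℕ)) (automorphic : ∀ {e} → e ∈ Es → occurs Υs Υs e ≡ true) where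

    rotated : ∀ {vs e} → OK Υs vs → e ∈ Es → OK Υs (vers vs e)
    rotated {e = e} o e∈ = occurs-sound Υs e o (automorphic e∈)

    -- Read along an automorphism, a vertex with row `σ` is one with row `τ` over the image of the
    -- copy, which is again a copy of Υ.
    similar-refuted : ∀ {τ σ} → Refuted (one-state τ) → similar Es τ σ ≡ true → Refuted (one-state σ)
    similar-refuted {τ} {σ} ref eq {z ∷ vs} (ok ∷ o) with any-∃ Es eq
    ... | e , e∈ , eq′ =
        ref (subst (λ r → RowOK z r (vers vs e)) (sameRow⇒≡ (along e σ) τ eq′) (along-ok {z} {σ} {vs} e ok) ∷ rotated o e∈)

    verify-sound : DenseThm → ∀ {Ts Kn} is → verify Es Ts Kn is ≡ true → TypeThm Υs Ts →
        All Refuted (map pair-state Kn) →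
                   TypeThm Υs (typesAfter Es Ts is) × All Refuted (map pair-state (knownAfter Kn is))
    verify-sound dense-thm [] _ types refs = types , refs
    verify-sound dense-thm {Ts} {Kn} (bad ls t ∷ is) eq types refs
      with ∧-true {check Υs Ts (map pair-state Kn) (one-state (row ls)) t} eq
    ... | e₁ , e₂ =
        verify-sound dense-thm is e₂ (λ {vs} z o → filter-Any {P = λ σ → RowOK z σ vs} (λ {σ} ok → keep σ {z} {vs} ok o) (types z o)) refs
      where
      ref : Refuted (one-state (row ls))
      ref = sound dense-thm types refs t e₁
      keep : ∀ σ {z vs} → RowOK z σ vs → OK Υs vs → not (similar Es (row ls) σ) ≡ true
      keep σ ok o with similar Es (row ls) σ in eq
      ... | false = refl
      ... | true  = ⊥-elim (similar-refuted {row ls} {σ} ref eq (ok ∷ o))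
    verify-sound dense-thm {Ts} {Kn} (pair ls ms f t ∷ is) eq types refs
      with ∧-true {check Υs Ts (map pair-state Kn) (pair-state (row ls , row ms , f)) t} eq
    ... | e₁ , e₂ = verify-sound dense-thm is e₂ types
          ((λ {vs} → sound dense-thm types refs {pair-state (row ls , row ms , f)} t e₁ {vs}) ∷ refs)

    module Pairs (Kn : List Pair) (refs : All Refuted (map pair-state Kn)) where

      pairs-refuted : ∀ {p} Ks → All Refuted (map pair-state Ks) → p ∈ Ks → Refuted (pair-state p)
      pairs-refuted (_ ∷ _)  (r ∷ _)  (here refl) {vs} = r {vs}
      pairs-refuted (_ ∷ Ks) (_ ∷ rs) (there p∈) {vs}  = pairs-refuted Ks rs p∈ {vs}

      shares-sound : ∀ {z y} σ τ vs → RowOK z σ vs → RowOK y τ vs → shares σ τ ≡ true → ¬ y ~ z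
      shares-sound (g ∷ σ) (k ∷ τ) vs okz oky eq yz with ∨-true {is＋ g ∧ is＋ k} eq
      ... | inj₁ e₁ with ∧-true {is＋ g} e₁
      ... | pg , pk = triangle-free yz (is＋-holds g pg (okz 0)) (adj-sym G (is＋-holds k pk (oky 0)))
      shares-sound (g ∷ σ) (k ∷ τ) [] okz oky eq yz | inj₂ e₂ =
        shares-sound σ τ [] (λ j → okz (suc j)) (λ j → oky (suc j)) e₂ yz
      shares-sound (g ∷ σ) (k ∷ τ) (u ∷ vs) okz oky eq yz | inj₂ e₂ =
        shares-sound σ τ vs (λ j → okz (suc j)) (λ j → oky (suc j)) e₂ yz

      instance-sound : ∀ {σ τ vs z y} f p → p ∈ Kn → OK Υs vs → RowOK z σ vs → RowOK y τ vs →
                       instanceOf σ τ f p ≡ true → ¬ Holds f y z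
      instance-sound {σ} {τ} {vs} {z} {y} f (σ₀ , τ₀ , g) p∈ o okz oky eq h with ∧-true {f == g} eq
      ... | fg , e₅ with ==⇒≡ f g fg | ∨-true {sameRow σ σ₀ ∧ sameRow τ τ₀} e₅
      ... | refl | inj₁ e₆ with ∧-true {sameRow σ σ₀} e₆
      ...   | s₁ , s₂ = pairs-refuted Kn refs p∈
                (cons-ok h (subst (λ r → RowOK y r vs) (sameRow⇒≡ τ τ₀ s₂) oky)
                 ∷ subst (λ r → RowOK z r vs) (sameRow⇒≡ σ σ₀ s₁) okz ∷ o)
      instance-sound {σ} {τ} {vs} {z} {y} f (σ₀ , τ₀ , g) p∈ o okz oky eq h | fg , e₅ | refl | inj₂ e₆
        with ∧-true {sameRow τ σ₀} e₆
      ...   | s₁ , s₂ = pairs-refuted Kn refs p∈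
                (cons-ok (Holds-sym f h) (subst (λ r → RowOK z r vs) (sameRow⇒≡ σ τ₀ s₂) okz)
                 ∷ subst (λ r → RowOK y r vs) (sameRow⇒≡ τ σ₀ s₁) oky ∷ o)

      rejects-sound : ∀ {σ τ vs z y} f → OK Υs vs → RowOK z σ vs → RowOK y τ vs →
                      rejects Es Kn σ τ f ≡ true → ¬ Holds f y z
      rejects-sound {σ} {τ} {vs} {z} {y} f o okz oky eq h with ∨-true {is＋ f ∧ shares σ τ} eq
      ... | inj₁ e₁ with ∧-true {is＋ f} e₁
      ...   | p , sh = shares-sound σ τ vs okz oky sh (is＋-holds f p h)
      rejects-sound {σ} {τ} {vs} {z} {y} f o okz oky eq h | inj₂ e₂ with any-∃ Es e₂
      ... | e , e∈ , e₃ with any-∃ Kn e₃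
      ... | p , p∈ , e₄ =
          instance-sound {along e σ} {along e τ} f p p∈ (rotated o e∈) (along-ok {z} {σ} {vs} e okz)
            (along-ok {y} {τ} {vs} e oky) e₄ h

      excluded-sound : ∀ {σ τ vs} → OK Υs vs → Realized vs σ → Realized vs τ → ¬ excluded Es Kn σ τ ≡ true
      excluded-sound {σ} {τ} {vs} o (z , okz) (y , oky) eq with ∧-true {rejects Es Kn σ τ ＋} eq
      ... | e₁ , e₂ = rejects-sound {σ} {τ} {vs} － o okz oky e₂ (rejects-sound {σ} {τ} {vs} ＋ o okz oky e₁)

      joint-ok : ∀ {vs} σs → OK Υs vs → All (Realized vs) σs →
          ∃[ us ] (length us ≡ length σs × OK (joint σs) (us ++ vs))
      joint-ok []       o [] = [] , refl , o
      joint-ok {vs} (σ ∷ σs) o ((z , ok) ∷ rs) with joint-ok σs o rs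
      ... | us , len , o′ = z ∷ us , cong suc len , pad us σs len ∷ o′
        where
        pad : ∀ (us : List V) (fs : List Row) → length us ≡ length fs → RowOK z (map (λ _ → ？) fs ++ σ) (us ++ vs)
        pad []       []       _   j       = ok j
        pad (u ∷ us) (f ∷ fs) _   zero    = tt
        pad (u ∷ us) (f ∷ fs) len (suc j) = pad us fs (suc-injective len) j

      module Search (Ts : List Row) (l : State) (ref-l : Refuted l)
        (possible : ∀ {vs} z → OK Υs vs → rowOf z vs ∈ Ts) where

        clique-sound : ∀ {vs} σs → OK Υs vs → All (Realized vs) σs → ¬ clique Es l σs ≡ true
        clique-sound σs o rs eq with any-∃ Es eq
        ... | e , _ , e₁ with any-∃ (upTo (length σs)) e₁
        ... | i , _ , e₂ with any-∃ (upTo (length σs)) e₂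
        ... | j , _ , e₃ with any-∃ (upTo (length σs)) e₃
        ... | k , _ , e₄ = ref-l (occurs-sound l _ (proj₂ (proj₂ (joint-ok σs o rs))) e₄)

        -- The search branches over all types, so one branch uses the actual row of the given bad
        -- vertex; following these branches, every chosen row stays realized. A rotation already
        -- spoiled by a chosen row causes no branching.
        conflict-sound : ∀ {vs} σs rs → OK Υs vs → conflict Es Ts Kn l σs rs ≡ true → All (Realized vs) σs →
                         All (λ r → ∃[ z ] good r (rowOf z vs) ≡ false) rs → ⊥
        conflict-sound σs [] o eq real [] = clique-sound σs o real eq
        conflict-sound {vs} σs (r ∷ rs) o eq real ((z , bad-z) ∷ bads) with any (λ σ → not (good r σ)) σs
        ... | true  = conflict-sound σs rs o eq real bads
        ... | false with ∨-true {good r (rowOf z vs)} (all-∈ {p = λ τ → good r τ ∨ (any (excluded Es Kn τ) σs ∨ conflict Es Ts Kn l (τ ∷ σs) rs)} eq (possible z o))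
        ...   | inj₁ g with trans (sym g) bad-z
        ...     | ()
        conflict-sound {vs} σs (r ∷ rs) o eq real ((z , bad-z) ∷ bads) | false | inj₂ e₂
          with ∨-true {any (excluded Es Kn (rowOf z vs)) σs} e₂
        ... | inj₂ e₃ = conflict-sound (rowOf z vs ∷ σs) rs o e₃ ((z , rowOf-ok z vs) ∷ real) bads
        ... | inj₁ e₃ with any-∃ σs e₃
        ... | σ , σ∈ , e₄ =
            excluded-sound {rowOf z vs} {σ} {vs} o (z , rowOf-ok z vs) (All.lookup real σ∈) e₄

        -- The vertex set is finite, so for each rotation it is decidable whether some vertex is bad
        -- for it. Bad vertices for all rotations at once are what `conflict-sound` refutes.
        good-rotation : ∀ {vs} rs → OK Υs vs → conflict Es Ts Kn l [] rs ≡ true →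
                        ∃[ r ] (r ∈ rs × (∀ z → good r (rowOf z vs) ≡ true))
        good-rotation {vs} rs o eq = pick rs (λ bads → conflict-sound [] rs o eq [] bads)
          where
          Bad : List ℕ → Set
          Bad r = ∃[ z ] good r (rowOf z vs) ≡ false
          pick : ∀ rs → ¬ All Bad rs → ∃[ r ] (r ∈ rs × (∀ z → good r (rowOf z vs) ≡ true))
          pick []       ¬bads = ⊥-elim (¬bads [])
          pick (r ∷ rs) ¬bads with all? (λ z → good r (rowOf z vs) ≟ᵇ true)
          ... | yes g = r , here refl , g
          ... | no ¬g with ¬∀⟶∃¬ _ (λ z → good r (rowOf z vs) ≡ true) (λ z → good r (rowOf z vs) ≟ᵇ true) ¬g
          ...   | z , b with pick rs (λ bads → ¬bads ((z , ¬-not b) ∷ bads))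
          ...     | r′ , r∈ , g = r′ , there r∈ , g

-- The classes of the vertices of G

module Υv = ΥVertex
module Υe = ΥEdge

module Classified {n} (G : Graph (Fin n)) (_~?_ : Decidable (Adj G))
  (triangle-free : ∀ {x y z} → Adj G x y → Adj G y z → Adj G z x → ⊥)
  (common-nbr : ∀ {x y} → ¬ Adj G x y → ∃[ z ] (Adj G x z × Adj G z y)) (v₀ : Fin n)
  (Es : List (List ℕ)) (automorphic : ∀ {e} → e ∈ Es → occurs Υs Υs e ≡ true)
  (Kn : List Pair) where

  open Soundness (Adj G) _~?_ (adj-sym G) triangle-free common-nbr v₀
  open Local G _~?_ triangle-free common-nbr v₀
  open Symmetric Es automorphic

  table-full : all (λ (σ , _) → full σ ∧ (length σ ≡ᵇ 11)) table ≡ true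
  table-full = refl

  -- Reading a row along `r` describes the same vertex over the rotated copy, and a row without
  -- unknown facts is determined by the vertex.
  recognise : ∀ {vs} r z → OK Υs (vers vs r) → good r (rowOf z vs) ≡ true →
      ∃[ C ] find table (rowOf z (vers vs r)) ≡ just C
  recognise {vs} r z o g with find table (along r (rowOf z vs)) in eq
  ... | just C with ∧-true {full (along r (rowOf z vs))} (all-∈ {p = λ (σ , _) → full σ ∧ (length σ ≡ᵇ 11)} table-full (find-∈ table (along r (rowOf z vs)) eq))
  ...   | e₁ , e₂ = C , trans (cong (find table) (sym
            (full-unique (along r (rowOf z vs)) (vers vs r) e₁
              (trans (≡ᵇ-true {length (along r (rowOf z vs))} e₂) (sym (OK-length o)))
              (along-ok {z} {rowOf z vs} {vs} r (rowOf-ok z vs))))) eq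

  module _ (refs : All Refuted (map pair-state Kn)) (coherent : consistent Es Kn ≡ true)
    {vs} (o : OK Υs vs) (found : ∀ z → ∃[ C ] find table (rowOf z vs) ≡ just C) where

    open Pairs Kn refs

    cls : Fin n → Class
    cls z = proj₁ (found z)

    compatible : ∀ {x y} → Adj G x y → SymClosure Compat (cls x) (cls y)
    compatible {x} {y} e = go (compat? (cls x) (cls y))
        (all-∈ {p = λ (τ , D) → does (compat? (cls x) D) ∨ rejects Es Kn (rowOf x vs) τ ＋}
          (all-∈ {p = λ (σ , C) → all (λ (τ , D) → does (compat? C D) ∨ rejects Es Kn σ τ ＋) table} coherent
            (find-∈ table (rowOf x vs) (proj₂ (found x))))
          (find-∈ table (rowOf y vs) (proj₂ (found y))))
      where
      go : (d : Dec (SymClosure Compat (cls x) (cls y))) →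
          does d ∨ rejects Es Kn (rowOf x vs) (rowOf y vs) ＋ ≡ true →
           SymClosure Compat (cls x) (cls y)
      go (yes p) _  = p
      go (no _)  eq =
          ⊥-elim
            (rejects-sound {rowOf x vs} {rowOf y vs} {vs} ＋ o (rowOf-ok x vs) (rowOf-ok y vs) eq (adj-sym G e))

    linked : ∀ {x y} → Link (cls x) (cls y) → Adj G x y
    linked {x} {y} l with x ~? y
    ... | yes e = e
    ... | no ¬e with common-nbr ¬e
    ... | z , xz , zy = ⊥-elim (link-no-common l (compatible xz) (compatible zy))

    -- A vertex of the copy has its neighbourhood in Υ as its row: the edges are recorded in `Υs`,
    -- the non-edges follow from common neighbours inside the copy.
    own-row : ∀ i ls {C} → holdsRow Υs (row ls) i (upTo 11) ≡ true → length vs ≡ 11 →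
        find table (row ls) ≡ just C →
              full (row ls) ≡ true → cls (ver vs i) ≡ C
    own-row i ls {C} h len f fl = just-injective (trans (sym (proj₂ (found (ver vs i))))
        (trans (cong (find table) (sym (full-unique (row ls) vs fl (sym len) (subst (RowOK (ver vs i) (row ls)) all-vs (holdsRow-sound (row ls) i (upTo 11) o h))))) f))
      where
      vers-upTo : ∀ us → length us ≡ 11 → vers us (upTo 11) ≡ us
      vers-upTo (_ ∷ _ ∷ _ ∷ _ ∷ _ ∷ _ ∷ _ ∷ _ ∷ _ ∷ _ ∷ _ ∷ []) _ = refl
      all-vs : vers vs (upTo 11) ≡ vs
      all-vs = vers-upTo vs len

    length-vs : length vs ≡ 11
    length-vs = OK-length o

    structured : Structured G cls
    structured = record
      { adj⇒  = compatible
      ; link⇒ = linked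
      ; hubs  = λ { 0₃ → ver vs 0 , own-row 0 (α 0 ∷ α 1 ∷ α 2 ∷ α 3 ∷ α 4 ∷ []) refl length-vs refl refl
                  ; 1₃ → ver vs 3 , own-row 3 (α 0 ∷ α 4 ∷ β 0 ∷ β 4 ∷ []) refl length-vs refl refl
                  ; 2₃ → ver vs 2 , own-row 2 (α 0 ∷ α 1 ∷ β 0 ∷ β 1 ∷ []) refl length-vs refl refl }
      ; antis = λ { 0₃ → ver vs 5 , own-row 5 (α 2 ∷ α 3 ∷ β 2 ∷ β 3 ∷ []) refl length-vs refl refl
                  ; 1₃ → ver vs 9 , own-row 9 (β 3 ∷ β 4 ∷ γ ∷ []) refl length-vs refl refl
                  ; 2₃ → ver vs 6 , own-row 6 (β 1 ∷ β 2 ∷ γ ∷ []) refl length-vs refl refl }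
      ; anX   = ver vs 10 , own-row 10 (β 2 ∷ β 3 ∷ γ ∷ []) refl length-vs refl refl
      }

    -- Under the isomorphism of Υ with the Vega graph for `i = 2` and both deletions, these vertices
    -- are the residues 0, 2, 4, 1, that is, the levels 0, 1, 2, 3 multiplied by 2 modulo 5.
    a₂b₄b₁a₃ : ∃[ p ] ∃[ q ] ∃[ r ] ∃[ s ]
      ((Adj G p q × Step (cls p) (cls q)) × (Adj G q r × Step (cls q) (cls r)) × (Adj G r s × Step (cls r) (cls s)))
    a₂b₄b₁a₃ = ver vs 8 , ver vs 1 , ver vs 4 , ver vs 7
      , (adj?-sound 8 1 o refl , steps A₂ B₄) , (adj?-sound 1 4 o refl , steps B₄ B₁) ,
        (adj?-sound 4 7 o refl , steps B₁ A₃)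
      where
      A₂ : cls (ver vs 8) ≡ R 0₃
      A₂ = own-row 8 (β 0 ∷ β 4 ∷ γ ∷ []) refl length-vs refl refl
      B₄ : cls (ver vs 1) ≡ R 1₃
      B₄ = own-row 1 (α 1 ∷ α 2 ∷ β 1 ∷ β 2 ∷ []) refl length-vs refl refl
      B₁ : cls (ver vs 4) ≡ R 2₃
      B₁ = own-row 4 (α 3 ∷ α 4 ∷ β 3 ∷ β 4 ∷ []) refl length-vs refl refl
      A₃ : cls (ver vs 7) ≡ R 0₃
      A₃ = own-row 7 (β 0 ∷ β 1 ∷ γ ∷ []) refl length-vs refl refl

-- Consequences of maximality and density; the copy of Υ

module Hypotheses {n} (G : Graph (Fin n)) (_~?_ : Decidable (Adj G))
  (maximal : MaximalTriangleFree G) (𝒟 : Property𝒟 4 G _~?_) where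

  private
    V : Set
    V = Fin n
    _~_ : V → V → Set
    _~_ = Adj G

  triangle-free : ∀ {x y z} → x ~ y → y ~ z → z ~ x → ⊥
  triangle-free xy yz zx = proj₁ maximal (_ , _ , _ , xy , yz , zx)

  -- Density for a constant sequence of length three. It settles the case `x = y` of `common-nbr`,
  -- about which maximality says nothing.
  neighbour : ∀ x → ∃[ y ] x ~ y
  neighbour x with 𝒟 1 (s≤s z≤n) (s≤s z≤n) (x ∷ x ∷ x ∷ [])
  ... | y , 2≤ with x ~? y
  ...   | yes e = y , e
  ...   | no _ with 2≤
  ...     | ()

  common-nbr : ∀ {x y} → ¬ x ~ y → ∃[ z ] (x ~ z × z ~ y)
  common-nbr {x} {y} ¬xy with x ≟ᶠ y
  ... | yes refl = let z , xz = neighbour x in z , xz , adj-sym G xz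
  ... | no x≢y = go (proj₂ maximal x y x≢y ¬xy)
    where
    G⁺ : Graph V
    G⁺ = addEdge G x y x≢y
    New : V → V → Set
    New p q = (p ≡ x × q ≡ y) ⊎ (p ≡ y × q ≡ x)
    -- The first edge of the triangle is the new one. A second new edge would make two of its
    -- vertices coincide, so the other two edges are old and meet in a common neighbour.
    apex₁ : ∀ {p q r} → New p q → Adj G⁺ q r → Adj G⁺ r p → ∃[ z ] (x ~ z × z ~ y)
    apex₁ {r = r} (inj₁ (refl , refl)) (inj₁ yr) (inj₁ rx) = r , adj-sym G rx , adj-sym G yr
    apex₁ {r = r} (inj₂ (refl , refl)) (inj₁ xr) (inj₁ ry) = r , xr , ry
    apex₁ (inj₁ (refl , refl)) (inj₂ (inj₁ (e , _))) _ = ⊥-elim (x≢y (sym e))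
    apex₁ (inj₁ (refl , refl)) (inj₂ (inj₂ (_ , refl))) rx = ⊥-elim (adj-irrefl G⁺ rx)
    apex₁ (inj₂ (refl , refl)) (inj₂ (inj₁ (_ , refl))) ry = ⊥-elim (adj-irrefl G⁺ ry)
    apex₁ (inj₂ (refl , refl)) (inj₂ (inj₂ (e , _))) _ = ⊥-elim (x≢y e)
    apex₁ (inj₁ (refl , refl)) qr@(inj₁ _) (inj₂ (inj₁ (_ , e))) = ⊥-elim (x≢y e)
    apex₁ (inj₁ (refl , refl)) qr@(inj₁ _) (inj₂ (inj₂ (refl , _))) = ⊥-elim (adj-irrefl G⁺ qr)
    apex₁ (inj₂ (refl , refl)) qr@(inj₁ _) (inj₂ (inj₁ (refl , _))) = ⊥-elim (adj-irrefl G⁺ qr)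
    apex₁ (inj₂ (refl , refl)) qr@(inj₁ _) (inj₂ (inj₂ (_ , e))) = ⊥-elim (x≢y (sym e))
    go : HasTriangle G⁺ → ∃[ z ] (x ~ z × z ~ y)
    go (p , q , r , inj₂ pq , qr , rp) = apex₁ pq qr rp
    go (p , q , r , pq , inj₂ qr , rp) = apex₁ qr rp pq
    go (p , q , r , pq , qr , inj₂ rp) = apex₁ rp pq qr
    go (p , q , r , inj₁ pq , inj₁ qr , inj₁ rp) = ⊥-elim (triangle-free pq qr rp)

  𝒟₂ : (xs : Vec V 6) → ∃[ y ] 3 ≤ count (λ x → x ~? y) xs
  𝒟₂ = 𝒟 2 (s≤s z≤n) (s≤s (s≤s z≤n))

  module _ (v₀ : V) where
    open Soundness _~_ _~?_ (adj-sym G) triangle-free common-nbr v₀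

    expand : List (V × ℕ) → List V
    expand []             = []
    expand ((v , k) ∷ ws) = replicate k v ++ expand ws

    length-expand : ∀ ws → length (expand ws) ≡ sum (map proj₂ ws)
    length-expand []             = refl
    length-expand ((v , k) ∷ ws) =
        trans (length-++ (replicate k v)) (cong₂ _+_ (length-replicate k) (length-expand ws))

    count-expand : ∀ y ws → count (λ x → x ~? y) (fromList (expand ws)) ≡ wsum y ws
    count-expand y []             = refl
    count-expand y ((v , k) ∷ ws) =
        trans (go k) (cong ((if does (v ~? y) then k else 0) +_) (count-expand y ws))
      where
      go : ∀ k → count (λ x → x ~? y) (fromList (replicate k v ++ expand ws)) ≡
                 (if does (v ~? y) then k else 0) + count (λ x → x ~? y) (fromList (expand ws))
      go zero with does (v ~? y)
      ... | true  = refl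
      ... | false = refl
      go (suc k) with does (v ~? y) | go k
      ... | true  | e = cong suc e
      ... | false | e = e

    dense-thm : DenseThm
    dense-thm m 1≤m m≤4 ws total = go (3 * m) (trans (length-expand ws) total) (𝒟 m 1≤m m≤4)
      where
      go : ∀ t → length (expand ws) ≡ t → ((xs : Vec V t) → ∃[ y ] m + 1 ≤ count (λ x → x ~? y) xs) → ∃[ y ] m < wsum y ws
      go t refl h with h (fromList (expand ws))
      ... | y , m+1≤ = y , subst (m <_) (count-expand y ws) (≤-trans (≤-reflexive (+-comm 1 m)) m+1≤)

    -- `RowOK` as a product over the entries, so that a row can be verified by listing its edges.
    Fits : V → Row → List V → Set
    Fits v []      us       = ⊤
    Fits v (f ∷ r) []       = ⊥
    Fits v (f ∷ r) (u ∷ us) = Holds f v u × Fits v r us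

    fits-ok : ∀ {v} r us → Fits v r us → RowOK v r us
    fits-ok []      us       _        j       = tt
    fits-ok (f ∷ r) (u ∷ us) (h , _)  zero    = h
    fits-ok (f ∷ r) (u ∷ us) (_ , hs) (suc j) = fits-ok r us hs j

    infixr 4 _▹_
    _▹_ : ∀ {r s v us} → Fits v r us → OK s us → OK (r ∷ s) (v ∷ us)
    _▹_ {r} {us = us} h o = fits-ok r us h ∷ o

    copy : (f : ΥVertex → V) → (∀ {p q} → Adj Υ p q → f p ~ f q) → ∃[ vs ] OK Υs vs
    copy f hom = vs
      -- The rows of `Υs` in order, with `tt` for unknown entries. The quotient in `divides` is 1
      -- where `j ± 2` leaves the range from 0 to 4, and 0 elsewhere.
      , (tt , tt , tt , tt , tt , ca , ca , ca , ca , ca , tt)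
      ▹
        (tt , hom (bwd (Υe.bb (divides 0 refl))) , hom (fwd (Υe.bb (divides 1 refl))) , tt , tt , tt , hom (bwd (Υe.ab⁺ (divides 0 refl))) , hom (bwd (Υe.ab⁻ (divides 1 refl))) , tt , tt)
      ▹
        (tt , hom (bwd (Υe.bb (divides 0 refl))) , hom (fwd (Υe.bb (divides 1 refl))) , tt , tt , tt , hom (bwd (Υe.ab⁺ (divides 0 refl))) , hom (bwd (Υe.ab⁻ (divides 1 refl))) , tt)
      ▹
        (tt , hom (bwd (Υe.bb (divides 0 refl))) , hom (bwd (Υe.ab⁻ (divides 0 refl))) , tt , tt , tt , hom (bwd (Υe.ab⁺ (divides 0 refl))) , tt)
      ▹ (tt , hom (bwd (Υe.ab⁺ (divides 1 refl))) , hom (bwd (Υe.ab⁻ (divides 0 refl))) , tt , tt , tt , tt)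
      ▹ (tt , hom (bwd (Υe.ab⁺ (divides 1 refl))) , hom (bwd (Υe.ab⁻ (divides 0 refl))) , tt , tt , tt)
      ▹ tt ▹ tt ▹ tt ▹ tt ▹ tt ▹ []
      where
      fa fb : Fin 5 → V
      fa j = f (Υv.a j)
      fb j = f (Υv.b j)
      vs : List V
      vs =
          f Υv.c ∷ fb (# 4) ∷ fb (# 3) ∷ fb (# 2) ∷ fb (# 1) ∷ fb (# 0) ∷ fa (# 4) ∷ fa (# 3) ∷ fa
            (# 2) ∷ fa (# 1) ∷ fa (# 0) ∷ []
      ca : ∀ {j} → f Υv.c ~ fa j
      ca = hom (bwd Υe.ac)

-- Evaluation of the certificate and conclusion

types : List Row
types = typesAfter automorphisms allTypes items

pairs : List Pair
pairs = knownAfter [] items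

-- The pairs of these rows are possible, but no rotation is good for all three.
triple : State
triple =
    joint
      (row (α 1 ∷ α 2 ∷ α 3 ∷ β 2 ∷ []) ∷ row (α 0 ∷ α 1 ∷ α 2 ∷ β 1 ∷ []) ∷ row (α 0 ∷ α 1 ∷ α 4 ∷ β 0 ∷ []) ∷ [])

triple-tree : Tree
triple-tree =
  dense 2 (1 each (0 ∷ 1 ∷ 6 ∷ 7 ∷ 10 ∷ [ 13 ])) (((13 ∷ 7 ∷ [ 0 ]) , split 9 0 (use 75 0 3 std)
    (type std 0)) ∷ [ (10 ∷ 6 ∷ [ 1 ]) , split 6 0 (split 0 3 (use 88 0 3 (at 9)) (use 86 0 3 (at
    9))) (type std 0) ])

automorphisms-ok : all (occurs Υs Υs) automorphisms ≡ true
automorphisms-ok = refl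

rotations-ok : all (occurs Υs Υs) rotations ≡ true
rotations-ok = refl

items-verified : verify automorphisms allTypes [] items ≡ true
items-verified = refl

triple-verified : check Υs types (map pair-state pairs) triple triple-tree ≡ true
triple-verified = refl

types-full : all (λ σ → full σ ∧ (length σ ≡ᵇ 11)) types ≡ true
types-full = refl

types-conflict : conflict automorphisms types pairs triple [] rotations ≡ true
types-conflict = refl

pairs-consistent : consistent automorphisms pairs ≡ true
pairs-consistent = refl

module Theorem {n} (G : Graph (Fin n)) (_~?_ : Decidable (Adj G))
  (maximal : MaximalTriangleFree G) (𝒟 : Property𝒟 4 G _~?_)
  (f : ΥVertex → Fin n) (hom : ∀ {p q} → Adj Υ p q → Adj G (f p) (f q)) where

  open Hypotheses G _~?_ maximal 𝒟

  v₀ : Fin n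
  v₀ = f ΥVertex.c

  open Soundness (Adj G) _~?_ (adj-sym G) triangle-free common-nbr v₀
  open Local G _~?_ triangle-free common-nbr v₀
  open Assemble G _~?_ triangle-free common-nbr 𝒟₂

  -- Types, pairs, triple and rotations are variables here: the argument depends on the computed
  -- lists only through the refutations and the Boolean equations assumed about them.
  conclude : ∀ Es Ts Kn l rs → (∀ {e} → e ∈ Es → occurs Υs Υs e ≡ true) →
      (∀ {e} → e ∈ rs → occurs Υs Υs e ≡ true) →
    TypeThm Υs Ts → All Refuted (map pair-state Kn) → Refuted l →
    all (λ σ → full σ ∧ (length σ ≡ᵇ 11)) Ts ≡ true → conflict Es Ts Kn l [] rs ≡ true → consistent Es Kn ≡ true →
    ∃[ i ] ∃[ μ ] ∃[ ν ] (2 ≤ i × G IsBlowUpOf Vega i μ ν)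
  conclude Es Ts Kn l rs autE autR tys refs ref-l fulls confl coh = from-copy (copy v₀ f hom)
    where
    open Symmetric Es autE
    open Pairs Kn refs
    open Classified G _~?_ triangle-free common-nbr v₀ Es autE Kn
    open Search Ts l ref-l (rowOf∈ Ts tys fulls)

    from-copy : ∃[ vs ] OK Υs vs → ∃[ i ] ∃[ μ ] ∃[ ν ] (2 ≤ i × G IsBlowUpOf Vega i μ ν)
    from-copy (vs , o) with good-rotation rs o confl
    ... | r , r∈ , g = structured⇒blow-up (structured refs coh o′ found) (a₂b₄b₁a₃ refs coh o′ found)
      where
      o′ : OK Υs (vers vs r)
      o′ = occurs-sound Υs r o (autR r∈)
      found : ∀ z → ∃[ C ] find table (rowOf z (vers vs r)) ≡ just C
      found z = recognise {vs} r z o′ (g z)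

  blow-up : ∃[ i ] ∃[ μ ] ∃[ ν ] (2 ≤ i × G IsBlowUpOf Vega i μ ν)
  blow-up =
    let tys , refs = verify-sound (dense-thm v₀) items items-verified allTypes-ok []
    in conclude automorphisms types pairs triple rotations aut (all-∈ {p = occurs Υs Υs} rotations-ok) tys refs
         (λ {vs} → sound (dense-thm v₀) tys refs {triple} triple-tree triple-verified {vs})
         types-full types-conflict pairs-consistent
    where
    aut : ∀ {e} → e ∈ automorphisms → occurs Υs Υs e ≡ true
    aut = all-∈ {p = occurs Υs Υs} automorphisms-ok
    open Symmetric automorphisms aut

theorem1p3 : ∀ {n : ℕ} (G : Graph (Fin n)) (_~?_ : Decidable (Adj G)) →
    MaximalTriangleFree G →
    G ContainsSubgraph Υ →
    Property𝒟 4 G _~?_ →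
    ∃[ i ] ∃[ μ ] ∃[ ν ] (2 ≤ i × G IsBlowUpOf Vega i μ ν)
theorem1p3 G _~?_ maximal (f , _ , hom) 𝒟 = Theorem.blow-up G _~?_ maximal 𝒟 f hom
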